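{- For all $n \geq 0$, $$p_{\xi}(48n+4) \equiv p_{\xi}(12n+1) \equiv \begin{cases} 2(-1)^k \pmod{8}, & \text{if } n=k(3k-1) \text{ for some integer } k,\\ 0 \pmod{8}, & \text{otherwise}.\end{cases}$$
   Context: $(a;q)_n=(1-a)(1-aq)\cdots(1-aq^{n-1})$, $(a;q)_0=1$. The coefficients $p_\xi(n)$ are defined by $\sum_{n\ge0}p_\xi(n)q^n=\xi(q)=1+2\sum_{n\ge1}\frac{q^{6n^2-6n+1}}{(q;q^6)_n(q^5;q^6)_n}$. -}

module Defs where

open import Data.Nat using (ℕ; zero; suc; _+_; _*_; _∸_; _≤?_; _≟_)
open import Data.Nat.Divisibility using (_∣?_)
open import Data.Bool using (if_then_else_)
open import Relation.Nullary.Decidable using (⌊_⌋)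

-- Formal power series in q with natural-number coefficients,
-- represented by their coefficient function.
Series : Set
Series = ℕ → ℕ

sumTo : ℕ → (ℕ → ℕ) → ℕ
sumTo zero    f = f 0
sumTo (suc m) f = sumTo m f + f (suc m)

_⊛_ : Series → Series → Series
(f ⊛ g) m = sumTo m (λ i → f i * g (m ∸ i))

one : Series
one m = if ⌊ m ≟ 0 ⌋ then 1 else 0

-- 1/(1 - q^a) = Σ_{k ≥ 0} q^{a k}   (used only for a ≥ 1)
geomInv : ℕ → Series
geomInv a m = if ⌊ a ∣? m ⌋ then 1 else 0

pochInv : ℕ → Series
pochInv zero    = one
pochInv (suc n) = pochInv n ⊛ (geomInv (6 * n + 1) ⊛ geomInv (6 * n + 5))

shift : ℕ → Series → Series
shift e f m = if ⌊ e ≤? m ⌋ then f (m ∸ e) else 0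

xiTerm : ℕ → Series
xiTerm n = shift (6 * n * n ∸ 6 * n + 1) (pochInv n)

-- ξ(q) = 1 + 2 Σ_{n ≥ 1} xiTerm n.  For the coefficient of q^N only the
-- summands with n ≤ N can contribute (since 6n²-6n+1 ≥ n for n ≥ 1),
-- so the sum over n = 1 .. N+1 gives the exact coefficient.
pξ : ℕ → ℕ
pξ N = one N + 2 * sumTo N (λ i → xiTerm (suc i) N)

{-# OPTIONS --safe #-}

-- Write p_ξ(m) = 2 s(m) for m > 0, Q = q⁶ and β_M = Π_{t<M} 1/((1 - q^{6t+1})(1 - q^{6t+5})).
-- Expanding β_M in partial fractions and summing over M by q-Vandermonde gives
--   Σ s(m) q^m = q/(Q;Q)_∞ · Σ_{t≥0} (-1)^t q^{9t(t+1)} (1/(1 - q^{6t+1}) + q^{6t+5}/(1 - q^{6t+5})).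
-- In the exponents 3n + 1 the factor q^{9t(t+1)} becomes q^{3t(t+1)}, and the resulting sum is the
-- limit M → ∞ of the same partial fractions, so that Σ s(3n+1) q^n = (Q;Q)_∞² β_∞ / (q²;q²)_∞.
-- By the Jacobi triple product this is U(q²) Σ_{k∈ℤ} q^{3k²-2k} modulo 4, where
-- U(p) = 1 + 2 Σ_{k≥1} (p^{k²} + p^{3k²}), and U(p) Σ_{k∈ℤ} p^{k(3k-1)/2} = (p;p)_∞ modulo 4.
-- Splitting by the parity of k, the section 4n + 1 of U(q²) Σ q^{3k²-2k} is the series itself, and
-- its section 4n is U(q²) Σ q^{k(3k-1)} = (q²;q²)_∞, which the pentagonal number theorem evaluates.
module Submission where

open import Algebra.Bundles using (CommutativeRing)
open import Algebra.Morphism.Structures using (IsRingHomomorphism)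
import Algebra.Solver.Ring as RingSolver
open import Algebra.Solver.Ring.AlmostCommutativeRing
  using (fromCommutativeRing; _-Raw-AlmostCommutative⟶_; Induced-equivalence)
open import Data.Integer as ℤ using (ℤ; +_; -[1+_]; _⊖_)
import Data.Integer.Divisibility as ℤUnsigned
open import Data.Integer.Divisibility.Signed as ℤDiv using (divides)
import Data.Integer.Properties as ℤP
import Data.Integer.Tactic.RingSolver as ℤSolver
open import Data.Maybe using (just; nothing)
open import Data.Nat as ℕ using (ℕ; zero; suc; z≤n; s≤s; _≤?_)
import Data.Nat.Divisibility as ℕDiv
open import Data.Nat.DivMod as DivMod using (_/_; _%_)
import Data.Nat.Properties as ℕP
open import Data.Nat.Tactic.RingSolver using (solve-∀)
open import Data.Product using (_,_; _×_; ∃)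
open import Data.Sum using (inj₁; inj₂)
open import Function using (_∘_)
open import Level using (0ℓ)
open import Relation.Binary.Definitions using (WeaklyDecidable)
open import Relation.Binary.PropositionalEquality as ≡ using (_≡_; _≢_)
open import Relation.Nullary using (¬_; yes; no; contradiction)
open import Defs

-- The modulus 4 enters in two ways: a series of the form 1 + 2v is its own inverse, and signs under
-- a factor 2 disappear. So a quotient of two such series equals their product. The product formulas
-- naturally give the quotient ϑ(p)/ϑ(p³) with ϑ(p) = Σ (-1)^k p^(k²); `U` is the product ϑ(p)ϑ(p³).
--
-- Limits are replaced by nilpotency: identities are proved in an arbitrary commutative ring for
-- elements with `x ^ L ≈ 0`, the model being power series modulo q^L. Infinite products are
-- stationary after L factors, and theta sums can be cut at any large enough bound; L is fixed at
-- the very end, just above the index in question. A nilpotent variable cannot be inverted. This is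
-- why bilateral sums are kept as two halves, in `x` and in `y` with `x * y ≈ Q`, and why inverses
-- of products are explicit finite geometric sums.
--
-- Coefficients are reached through the ring endomorphism q ↦ q^m: a decomposition Σ q^s E(f s) over
-- s < m exhibits all sections at once, so that dissections are ring identities.

-- Normalisation of ring expressions with integer coefficients

module IntegerSolver {c ℓ} (R : CommutativeRing c ℓ) where
  open CommutativeRing R
  open import Algebra.Properties.Ring ring
    using (-‿distribˡ-*; -0#≈0#; -‿involutive)
  open import Algebra.Properties.AbelianGroup +-abelianGroup using (⁻¹-∙-comm)
  open import Algebra.Properties.Semiring.Mult semiring using (×-homo-+; ×1-homo-*)
    renaming (_×_ to _×ᵤ_)
  open import Algebra.Properties.Semiring.Mult.TCOptimised semiring using (×ᵤ≈×)
    renaming (_×_ to _×ₒ_)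
  open import Relation.Binary.Reasoning.Setoid setoid

  private
    -- With the optimised multiple, `ι 1` reduces to `1#`, so `con (+ 1)` matches the units that
    -- occur in goals.
    ι : ℕ → Carrier
    ι n = n ×ₒ 1#

    ι-+ : ∀ m n → ι (m ℕ.+ n) ≈ ι m + ι n
    ι-+ m n = trans (sym (×ᵤ≈× (m ℕ.+ n) 1#)) (trans (×-homo-+ 1# m n) (+-cong (×ᵤ≈× m 1#) (×ᵤ≈× n 1#)))

    ι-* : ∀ m n → ι (m ℕ.* n) ≈ ι m * ι n
    ι-* m n = trans (sym (×ᵤ≈× (m ℕ.* n) 1#)) (trans (×1-homo-* m n) (*-cong (×ᵤ≈× m 1#) (×ᵤ≈× n 1#)))

    κ : ℤ → Carrier
    κ (+ n)    = ι n
    κ -[1+ n ] = - ι (suc n)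

    cancel : ∀ x a b → a + - b ≈ (x + a) + - (x + b)
    cancel x a b = begin
      a + - b                 ≈⟨ +-congʳ (+-identityˡ a) ⟨
      (0# + a) + - b          ≈⟨ +-congʳ (+-congʳ (-‿inverseʳ x)) ⟨
      ((x + - x) + a) + - b   ≈⟨ +-congʳ (+-assoc x (- x) a) ⟩
      (x + (- x + a)) + - b   ≈⟨ +-congʳ (+-congˡ (+-comm (- x) a)) ⟩
      (x + (a + - x)) + - b   ≈⟨ +-congʳ (+-assoc x a (- x)) ⟨
      ((x + a) + - x) + - b   ≈⟨ +-assoc (x + a) (- x) (- b) ⟩
      (x + a) + (- x + - b)   ≈⟨ +-congˡ (⁻¹-∙-comm x b) ⟩
      (x + a) + - (x + b)     ∎

    κ-⊖ : ∀ m n → κ (m ⊖ n) ≈ ι m + - ι n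
    κ-⊖ m zero          = sym (trans (+-congˡ -0#≈0#) (+-identityʳ (ι m)))
    κ-⊖ zero (suc n)    = sym (+-identityˡ _)
    κ-⊖ (suc m) (suc n) rewrite ℤP.[1+m]⊖[1+n]≡m⊖n m n = begin
      κ (m ⊖ n)                      ≈⟨ κ-⊖ m n ⟩
      ι m + - ι n                    ≈⟨ cancel 1# (ι m) (ι n) ⟩
      (1# + ι m) + - (1# + ι n)      ≈⟨ +-cong (ι-+ 1 m) (-‿cong (ι-+ 1 n)) ⟨
      ι (suc m) + - ι (suc n)        ∎

    κ-+ : ∀ i j → κ (i ℤ.+ j) ≈ κ i + κ j
    κ-+ (+ m) (+ n)       = ι-+ m n
    κ-+ (+ m) -[1+ n ]    = κ-⊖ m (suc n)
    κ-+ -[1+ m ] (+ n)    = trans (κ-⊖ n (suc m)) (+-comm _ _)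
    κ-+ -[1+ m ] -[1+ n ] = begin
      - ι (suc (suc (m ℕ.+ n)))        ≡⟨ ≡.cong (λ k → - ι (suc k)) (ℕP.+-suc m n) ⟨
      - ι (suc m ℕ.+ suc n)            ≈⟨ -‿cong (ι-+ (suc m) (suc n)) ⟩
      - (ι (suc m) + ι (suc n))        ≈⟨ ⁻¹-∙-comm _ _ ⟨
      - ι (suc m) + - ι (suc n)        ∎

    κ-neg : ∀ i → κ (ℤ.- i) ≈ - κ i
    κ-neg (+ zero)    = sym -0#≈0#
    κ-neg (+ (suc n)) = refl
    κ-neg -[1+ n ]    = sym (-‿involutive _)

    κ-*-pos : ∀ m j → κ (+ m ℤ.* j) ≈ ι m * κ j
    κ-*-pos m (+ n)    rewrite ≡.sym (ℤP.pos-* m n) = ι-* m n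
    κ-*-pos m -[1+ n ] = begin
      κ (+ m ℤ.* (ℤ.- (+ suc n)))    ≡⟨ ≡.cong κ (ℤP.neg-distribʳ-* (+ m) (+ suc n)) ⟨
      κ (ℤ.- (+ m ℤ.* + suc n))      ≈⟨ κ-neg (+ m ℤ.* + suc n) ⟩
      - κ (+ m ℤ.* + suc n)          ≈⟨ -‿cong (κ-*-pos m (+ suc n)) ⟩
      - (ι m * ι (suc n))            ≈⟨ -‿cong (*-comm _ _) ⟩
      - (ι (suc n) * ι m)            ≈⟨ -‿distribˡ-* _ _ ⟩
      - ι (suc n) * ι m              ≈⟨ *-comm _ _ ⟩
      ι m * - ι (suc n)              ∎

    κ-* : ∀ i j → κ (i ℤ.* j) ≈ κ i * κ j
    κ-* (+ m) j    = κ-*-pos m j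
    κ-* -[1+ m ] j = begin
      κ ((ℤ.- (+ suc m)) ℤ.* j)   ≡⟨ ≡.cong κ (ℤP.neg-distribˡ-* (+ suc m) j) ⟨
      κ (ℤ.- (+ suc m ℤ.* j))     ≈⟨ κ-neg (+ suc m ℤ.* j) ⟩
      - κ (+ suc m ℤ.* j)         ≈⟨ -‿cong (κ-*-pos (suc m) j) ⟩
      - (ι (suc m) * κ j)         ≈⟨ -‿distribˡ-* _ _ ⟩
      - ι (suc m) * κ j           ∎

    morphism : ℤ.+-*-rawRing -Raw-AlmostCommutative⟶ fromCommutativeRing R
    morphism = record
      { ⟦_⟧ = κ ; +-homo = κ-+ ; *-homo = κ-* ; -‿homo = κ-neg ; 0-homo = refl ; 1-homo = refl }

    coefficient≟ : WeaklyDecidable (Induced-equivalence morphism)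
    coefficient≟ i j with i ℤ.≟ j
    ... | yes ≡.refl = just refl
    ... | no _       = nothing

  open RingSolver ℤ.+-*-rawRing (fromCommutativeRing R) morphism coefficient≟ public
    using (solve; _:=_; _:+_; _:*_; _:-_; :-_; con; Polynomial)

  :1 : ∀ {n} → Polynomial n
  :1 = con (+ 1)

-- Finite sums and products

module FiniteSums {c ℓ} (R : CommutativeRing c ℓ) where
  open CommutativeRing R
  open import Algebra.Properties.CommutativeSemigroup +-commutativeSemigroup using (interchange)
  open import Relation.Binary.Reasoning.Setoid setoid

  sum : ℕ → (ℕ → Carrier) → Carrier
  sum zero    f = 0#
  sum (suc n) f = sum n f + f n

  prod : ℕ → (ℕ → Carrier) → Carrier
  prod zero    f = 1#
  prod (suc n) f = prod n f * f n

  sum-cong< : ∀ n {f g} → (∀ i → i ℕ.< n → f i ≈ g i) → sum n f ≈ sum n g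
  sum-cong< zero    h = refl
  sum-cong< (suc n) h = +-cong (sum-cong< n (λ i i<n → h i (ℕP.m≤n⇒m≤1+n i<n))) (h n ℕP.≤-refl)

  sum-cong : ∀ n {f g} → (∀ i → f i ≈ g i) → sum n f ≈ sum n g
  sum-cong n h = sum-cong< n (λ i _ → h i)

  sum-zero : ∀ n {f} → (∀ i → i ℕ.< n → f i ≈ 0#) → sum n f ≈ 0#
  sum-zero zero    h = refl
  sum-zero (suc n) h =
    trans (+-cong (sum-zero n (λ i i<n → h i (ℕP.m≤n⇒m≤1+n i<n))) (h n ℕP.≤-refl)) (+-identityʳ 0#)

  sum-+ : ∀ n f g → sum n (λ i → f i + g i) ≈ sum n f + sum n g
  sum-+ zero    f g = sym (+-identityʳ 0#)
  sum-+ (suc n) f g = trans (+-congʳ (sum-+ n f g)) (interchange _ _ _ _)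

  sum-*ˡ : ∀ n x f → x * sum n f ≈ sum n (λ i → x * f i)
  sum-*ˡ zero    x f = zeroʳ x
  sum-*ˡ (suc n) x f = trans (distribˡ x _ _) (+-congʳ (sum-*ˡ n x f))

  sum-*ʳ : ∀ n f x → sum n f * x ≈ sum n (λ i → f i * x)
  sum-*ʳ zero    f x = zeroˡ x
  sum-*ʳ (suc n) f x = trans (distribʳ x _ _) (+-congʳ (sum-*ʳ n f x))

  sum-head : ∀ n f → sum (suc n) f ≈ f 0 + sum n (λ i → f (suc i))
  sum-head zero    f = +-comm _ _
  sum-head (suc n) f = trans (+-congʳ (sum-head n f)) (+-assoc _ _ _)

  sum-split : ∀ m n f → sum (m ℕ.+ n) f ≈ sum m f + sum n (λ i → f (m ℕ.+ i))
  sum-split m zero    f rewrite ℕP.+-identityʳ m = sym (+-identityʳ _)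
  sum-split m (suc n) f rewrite ℕP.+-suc m n =
    trans (+-congʳ (sum-split m n f)) (+-assoc _ _ _)

  sum-swap : ∀ m n (f : ℕ → ℕ → Carrier) → sum m (λ i → sum n (λ j → f i j)) ≈ sum n (λ j → sum m (λ i → f i j))
  sum-swap zero    n f = sym (sum-zero n (λ _ _ → refl))
  sum-swap (suc m) n f = trans (+-congʳ (sum-swap m n f)) (sym (sum-+ n _ _))

  prod-cong : ∀ n {f g} → (∀ i → f i ≈ g i) → prod n f ≈ prod n g
  prod-cong zero    h = refl
  prod-cong (suc n) h = *-cong (prod-cong n h) (h n)

  sum-extend : ∀ {m n} f → m ℕ.≤ n → (∀ i → m ℕ.≤ i → f i ≈ 0#) → sum m f ≈ sum n f
  sum-extend {m} {n} f m≤n h = begin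
    sum m f                                          ≈⟨ +-identityʳ _ ⟨
    sum m f + 0#                                     ≈⟨ +-congˡ (sum-zero (n ℕ.∸ m) (λ i _ → h (m ℕ.+ i) (ℕP.m≤m+n m i))) ⟨
    sum m f + sum (n ℕ.∸ m) (λ i → f (m ℕ.+ i))      ≈⟨ sum-split m (n ℕ.∸ m) f ⟨
    sum (m ℕ.+ (n ℕ.∸ m)) f                          ≡⟨ ≡.cong (λ k → sum k f) (ℕP.m+[n∸m]≡n m≤n) ⟩
    sum n f                                          ∎

-- Finite q-series identities

module QSeries {c ℓ} (R : CommutativeRing c ℓ) where
  open CommutativeRing R
  open FiniteSums R public
  open IntegerSolver R
  open import Algebra.Properties.Semiring.Exp semiring public
  open import Algebra.Properties.Group +-group using (inverseˡ-unique)
  open import Relation.Binary.Reasoning.Setoid setoid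

  -- k(k-1)/2, the exponent of Q in theta series.
  tri : ℕ → ℕ
  tri zero    = 0
  tri (suc k) = k ℕ.+ tri k

  sgn : ℕ → Carrier
  sgn zero    = 1#
  sgn (suc k) = - sgn k

  one-minus-zero : ∀ {a} → a ≈ 1# → 1# - a ≈ 0#
  one-minus-zero h = trans (+-congˡ (-‿cong h)) (-‿inverseʳ 1#)

  module WithInverses (Q : Carrier) (inv : ℕ → Carrier)
    (inv-inverse : ∀ n → (1# - Q ^ suc n) * inv n ≈ 1#) where

    cancel : ∀ n {a b} → (1# - Q ^ suc n) * a ≈ (1# - Q ^ suc n) * b → a ≈ b
    cancel n {a} {b} h = begin
      a                                ≈⟨ expand a ⟩
      inv n * ((1# - Q ^ suc n) * a)   ≈⟨ *-congˡ h ⟩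
      inv n * ((1# - Q ^ suc n) * b)   ≈⟨ expand b ⟨
      b                                ∎
      where
      expand : ∀ a → a ≈ inv n * ((1# - Q ^ suc n) * a)
      expand a = begin
        a                                ≈⟨ *-identityˡ a ⟨
        1# * a                           ≈⟨ *-congʳ (inv-inverse n) ⟨
        ((1# - Q ^ suc n) * inv n) * a   ≈⟨ solve 3 (λ u v w → (u :* v) :* w := v :* (u :* w)) refl _ _ _ ⟩
        inv n * ((1# - Q ^ suc n) * a)   ∎

    -- ρ n = 1/(Q;Q)_n and ρ∸ n k = 1/(Q;Q)_{n-k}, which vanishes for k > n.
    ρ : ℕ → Carrier
    ρ n = prod n inv

    ρ∸ : ℕ → ℕ → Carrier
    ρ∸ n       zero    = ρ n
    ρ∸ zero    (suc k) = 0#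
    ρ∸ (suc n) (suc k) = ρ∸ n k

    ρ-suc : ∀ n → ρ n ≈ ρ (suc n) * (1# - Q ^ suc n)
    ρ-suc n = begin
      ρ n                                ≈⟨ *-identityʳ _ ⟨
      ρ n * 1#                           ≈⟨ *-congˡ (inv-inverse n) ⟨
      ρ n * ((1# - Q ^ suc n) * inv n)   ≈⟨ solve 3 (λ u v w → u :* (v :* w) := (u :* w) :* v) refl _ _ _ ⟩
      ρ (suc n) * (1# - Q ^ suc n)       ∎

    -- For k > n the truncated subtraction gives exponent 0, and 1 - Q^0 = 0 matches the vanishing
    -- of `ρ∸ n k`; so the boundary case k = n + 1 is included.
    ρ∸-suc : ∀ n k → ρ∸ n k ≈ ρ∸ (suc n) k * (1# - Q ^ (suc n ℕ.∸ k))
    ρ∸-suc n       zero    = ρ-suc n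
    ρ∸-suc zero    (suc k) = sym (trans (*-congˡ (one-minus-zero (^-congʳ Q (ℕP.0∸n≡0 k)))) (zeroʳ _))
    ρ∸-suc (suc n) (suc k) = ρ∸-suc n k

    -- The exponents add up to n only for k ≤ n; elsewhere `ρ∸ n k` kills both sides. This lets the
    -- recurrences below hold for every index, without a bound.
    ρ∸-^ : ∀ n k → ρ∸ n k * (Q ^ (n ℕ.∸ k) * Q ^ k) ≈ ρ∸ n k * Q ^ n
    ρ∸-^ n       zero    = *-congˡ (*-identityʳ _)
    ρ∸-^ zero    (suc k) = trans (zeroˡ _) (sym (zeroˡ _))
    ρ∸-^ (suc n) (suc k) = begin
      ρ∸ n k * (Q ^ (n ℕ.∸ k) * (Q * Q ^ k))   ≈⟨ solve 4 (λ r a q b → r :* (a :* (q :* b)) := q :* (r :* (a :* b))) refl _ _ _ _ ⟩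
      Q * (ρ∸ n k * (Q ^ (n ℕ.∸ k) * Q ^ k))   ≈⟨ *-congˡ (ρ∸-^ n k) ⟩
      Q * (ρ∸ n k * Q ^ n)                     ≈⟨ solve 3 (λ q r a → q :* (r :* a) := r :* (q :* a)) refl _ _ _ ⟩
      ρ∸ n k * Q ^ suc n                       ∎

    ρ∸-> : ∀ n k → n ℕ.< k → ρ∸ n k ≡ 0#
    ρ∸-> zero    (suc k) _         = ≡.refl
    ρ∸-> (suc n) (suc k) (s≤s n<k) = ρ∸-> n k n<k

    ρ∸-+ : ∀ m k → ρ∸ (k ℕ.+ m) k ≡ ρ m
    ρ∸-+ m zero    = ≡.refl
    ρ∸-+ m (suc k) = ρ∸-+ m k

    -- The case of q-Vandermonde in which one parameter tends to infinity. Induction on a that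
    -- raises k: split 1 - Q^(a+1) as Q^m (1 - Q^(a+1-m)) + (1 - Q^m). The first part lowers
    -- `ρ∸ (suc a) m` to `ρ∸ a m`, the second lowers `ρ m`; after a shift of m by one in the second,
    -- the two combine to the summand for a and k + 1.
    q-vandermonde : ∀ a k →
      sum (suc a) (λ m → Q ^ (m ℕ.* (m ℕ.+ k)) * (ρ∸ a m * (ρ m * ρ (m ℕ.+ k)))) ≈ ρ a * ρ (a ℕ.+ k)
    q-vandermonde zero    k = solve 1 (λ r → con (+ 0) :+ :1 :* (:1 :* (:1 :* r)) := :1 :* r) refl (ρ k)
    q-vandermonde (suc a) k = cancel a (begin
      (1# - Q ^ suc a) * sum (suc (suc a)) f               ≈⟨ sum-*ˡ (suc (suc a)) _ f ⟩
      sum (suc (suc a)) (λ m → (1# - Q ^ suc a) * f m)     ≈⟨ sum-cong (suc (suc a)) split ⟩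
      sum (suc (suc a)) (λ m → g m + h m)                  ≈⟨ sum-+ (suc (suc a)) g h ⟩
      (sum (suc a) g + g (suc a)) + sum (suc (suc a)) h    ≈⟨ +-cong (trans (+-congˡ g-top) (+-identityʳ _))
                                                                    (trans (sum-head (suc a) h) (trans (+-congʳ h-bottom) (+-identityˡ _))) ⟩
      sum (suc a) g + sum (suc a) (λ m → h (suc m))        ≈⟨ sum-+ (suc a) g (λ m → h (suc m)) ⟨
      sum (suc a) (λ m → g m + h (suc m))                  ≈⟨ sum-cong (suc a) merge ⟩
      sum (suc a) (λ m → Q ^ (m ℕ.* (m ℕ.+ suc k)) * (ρ∸ a m * (ρ m * ρ (m ℕ.+ suc k))))
                                                           ≈⟨ q-vandermonde a (suc k) ⟩
      ρ a * ρ (a ℕ.+ suc k)                                ≈⟨ *-cong (ρ-suc a) (reflexive (≡.cong ρ (ℕP.+-suc a k))) ⟩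
      (ρ (suc a) * (1# - Q ^ suc a)) * ρ (suc a ℕ.+ k)     ≈⟨ solve 3 (λ u v w → (u :* v) :* w := v :* (u :* w)) refl _ _ _ ⟩
      (1# - Q ^ suc a) * (ρ (suc a) * ρ (suc a ℕ.+ k))     ∎)
      where
      f g h : ℕ → Carrier
      f m = Q ^ (m ℕ.* (m ℕ.+ k)) * (ρ∸ (suc a) m * (ρ m * ρ (m ℕ.+ k)))
      g m = Q ^ (m ℕ.* (m ℕ.+ k)) * (Q ^ m * (ρ∸ a m * (ρ m * ρ (m ℕ.+ k))))
      h m = Q ^ (m ℕ.* (m ℕ.+ k)) * (ρ∸ (suc a) m * ((1# - Q ^ m) * (ρ m * ρ (m ℕ.+ k))))

      split : ∀ m → (1# - Q ^ suc a) * f m ≈ g m + h m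
      split m = begin
        (1# - Q ^ suc a) * f m
          ≈⟨ solve 5 (λ E A r s t → (:1 :- A) :* (E :* (r :* (s :* t))) := E :* ((s :* t) :* (r :- r :* A))) refl
               (Q ^ (m ℕ.* (m ℕ.+ k))) (Q ^ suc a) (ρ∸ (suc a) m) (ρ m) (ρ (m ℕ.+ k)) ⟩
        Q ^ (m ℕ.* (m ℕ.+ k)) * ((ρ m * ρ (m ℕ.+ k)) * (ρ∸ (suc a) m - ρ∸ (suc a) m * Q ^ suc a))
          ≈⟨ *-congˡ (*-congˡ (+-congˡ (-‿cong (ρ∸-^ (suc a) m)))) ⟨
        Q ^ (m ℕ.* (m ℕ.+ k)) * ((ρ m * ρ (m ℕ.+ k)) * (ρ∸ (suc a) m - ρ∸ (suc a) m * (Q ^ (suc a ℕ.∸ m) * Q ^ m)))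
          ≈⟨ solve 6 (λ E A B r s t → E :* ((s :* t) :* (r :- r :* (A :* B)))
                 := E :* (B :* ((r :* (:1 :- A)) :* (s :* t))) :+ E :* (r :* ((:1 :- B) :* (s :* t)))) refl
               (Q ^ (m ℕ.* (m ℕ.+ k))) (Q ^ (suc a ℕ.∸ m)) (Q ^ m) (ρ∸ (suc a) m) (ρ m) (ρ (m ℕ.+ k)) ⟩
        Q ^ (m ℕ.* (m ℕ.+ k)) * (Q ^ m * ((ρ∸ (suc a) m * (1# - Q ^ (suc a ℕ.∸ m))) * (ρ m * ρ (m ℕ.+ k)))) + h m
          ≈⟨ +-congʳ (*-congˡ (*-congˡ (*-congʳ (ρ∸-suc a m)))) ⟨
        g m + h m ∎

      g-top : g (suc a) ≈ 0#
      g-top = begin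
        g (suc a)                             ≡⟨ ≡.cong (λ z → E * (Q ^ suc a * (z * (ρ (suc a) * ρ (suc a ℕ.+ k))))) (ρ∸-> a (suc a) ℕP.≤-refl) ⟩
        E * (Q ^ suc a * (0# * (ρ (suc a) * ρ (suc a ℕ.+ k))))            ≈⟨ solve 3 (λ e x y → e :* (x :* (con (+ 0) :* y)) := con (+ 0)) refl _ _ _ ⟩
        0#                                    ∎
        where
        E : Carrier
        E = Q ^ (suc a ℕ.* (suc a ℕ.+ k))

      h-bottom : h 0 ≈ 0#
      h-bottom = solve 2 (λ r s → :1 :* (r :* ((:1 :- :1) :* s)) := con (+ 0)) refl _ _

      merge : ∀ m → g m + h (suc m) ≈ Q ^ (m ℕ.* (m ℕ.+ suc k)) * (ρ∸ a m * (ρ m * ρ (m ℕ.+ suc k)))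
      merge m rewrite ℕP.+-suc m k = begin
        g m + h (suc m)
          ≈⟨ +-cong (*-congˡ (*-congˡ (*-congˡ (*-congˡ (ρ-suc (m ℕ.+ k))))))
                    (*-cong (trans (^-congʳ Q exponent′) (^-homo-* Q e (suc (m ℕ.+ k)))) (*-congˡ (trans (sym (*-assoc _ _ _)) (*-congʳ (trans (*-comm _ _) (sym (ρ-suc m))))))) ⟩
        E * (Q ^ m * (ρ∸ a m * (ρ m * (ρ (suc (m ℕ.+ k)) * (1# - Q ^ suc (m ℕ.+ k))))))
          + (Q ^ e * Q ^ suc (m ℕ.+ k)) * (ρ∸ a m * (ρ m * ρ (suc (m ℕ.+ k))))
          ≈⟨ +-congʳ (sym (*-assoc E (Q ^ m) _)) ⟩
        (E * Q ^ m) * (ρ∸ a m * (ρ m * (ρ (suc (m ℕ.+ k)) * (1# - Q ^ suc (m ℕ.+ k)))))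
          + (Q ^ e * Q ^ suc (m ℕ.+ k)) * (ρ∸ a m * (ρ m * ρ (suc (m ℕ.+ k))))
          ≈⟨ +-congʳ (*-congʳ (trans (sym (^-homo-* Q (m ℕ.* (m ℕ.+ k)) m)) (^-congʳ Q exponent))) ⟩
        Q ^ e * (ρ∸ a m * (ρ m * (ρ (suc (m ℕ.+ k)) * (1# - Q ^ suc (m ℕ.+ k)))))
          + (Q ^ e * Q ^ suc (m ℕ.+ k)) * (ρ∸ a m * (ρ m * ρ (suc (m ℕ.+ k))))
          ≈⟨ solve 5 (λ x r s t z → x :* (r :* (s :* (t :* (:1 :- z)))) :+ (x :* z) :* (r :* (s :* t)) := x :* (r :* (s :* t))) refl
               (Q ^ e) (ρ∸ a m) (ρ m) (ρ (suc (m ℕ.+ k))) (Q ^ suc (m ℕ.+ k)) ⟩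
        Q ^ e * (ρ∸ a m * (ρ m * ρ (suc (m ℕ.+ k)))) ∎
        where
        E : Carrier
        E = Q ^ (m ℕ.* (m ℕ.+ k))
        e : ℕ
        e = m ℕ.* suc (m ℕ.+ k)
        exponent : m ℕ.* (m ℕ.+ k) ℕ.+ m ≡ e
        exponent = ≡.trans (ℕP.+-comm _ m) (≡.sym (ℕP.*-suc m (m ℕ.+ k)))
        exponent′ : suc m ℕ.* (suc m ℕ.+ k) ≡ e ℕ.+ suc (m ℕ.+ k)
        exponent′ = ℕP.+-comm (suc (m ℕ.+ k)) e

    -- The finite Jacobi triple product

    jtpTerm : ℕ → ℕ → Carrier → ℕ → Carrier
    jtpTerm m n x k = (ρ∸ m k * ρ (n ℕ.+ k)) * (x ^ k * Q ^ tri k)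

    -- The sum over all k ∈ ℤ: for `x * y ≈ Q` the term of index -k, x^(-k) Q^(k(k+1)/2), is y^k
    -- Q^(k(k-1)/2). A bound `B` exceeding m and n loses no nonzero term and gives both halves the
    -- same length.
    jtpSum : ℕ → ℕ → ℕ → Carrier → Carrier → Carrier
    jtpSum B m n x y = sum B (λ k → jtpTerm m n x (suc k)) + sum B (λ k → jtpTerm n m y k)

    jtpTerm-> : ∀ m n x k → m ℕ.< k → jtpTerm m n x k ≈ 0#
    jtpTerm-> m n x k m<k = trans (*-congʳ (trans (*-congʳ (reflexive (ρ∸-> m k m<k))) (zeroˡ _))) (zeroˡ _)

    shifted-sum : ∀ B m n x → m ℕ.< B →
      jtpTerm m n x 0 + sum B (λ k → jtpTerm m n x (suc k)) ≈ sum B (jtpTerm m n x)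
    shifted-sum B m n x m<B = begin
      jtpTerm m n x 0 + sum B (λ k → jtpTerm m n x (suc k))  ≈⟨ sum-head B (jtpTerm m n x) ⟨
      sum B (jtpTerm m n x) + jtpTerm m n x B                ≈⟨ +-congˡ (jtpTerm-> m n x B m<B) ⟩
      sum B (jtpTerm m n x) + 0#                             ≈⟨ +-identityʳ _ ⟩
      sum B (jtpTerm m n x)                                  ∎

    jtpTerm-0 : ∀ m n x y → jtpTerm m n x 0 ≈ jtpTerm n m y 0
    jtpTerm-0 m n x y rewrite ℕP.+-identityʳ n | ℕP.+-identityʳ m = *-congʳ (*-comm _ _)

    jtpSum-sym : ∀ B m n x y → m ℕ.< B → n ℕ.< B → jtpSum B m n x y ≈ jtpSum B n m y x
    jtpSum-sym B m n x y m<B n<B = begin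
      sum B (λ k → jtpTerm m n x (suc k)) + sum B (jtpTerm n m y)
        ≈⟨ +-congˡ (shifted-sum B n m y n<B) ⟨
      sum B (λ k → jtpTerm m n x (suc k)) + (jtpTerm n m y 0 + sum B (λ k → jtpTerm n m y (suc k)))
        ≈⟨ solve 3 (λ a b c → a :+ (b :+ c) := c :+ (b :+ a)) refl _ _ _ ⟩
      sum B (λ k → jtpTerm n m y (suc k)) + (jtpTerm n m y 0 + sum B (λ k → jtpTerm m n x (suc k)))
        ≈⟨ +-congˡ (+-congʳ (jtpTerm-0 n m y x)) ⟩
      sum B (λ k → jtpTerm n m y (suc k)) + (jtpTerm m n x 0 + sum B (λ k → jtpTerm m n x (suc k)))
        ≈⟨ +-congˡ (shifted-sum B m n x m<B) ⟩
      sum B (λ k → jtpTerm n m y (suc k)) + sum B (jtpTerm m n x) ∎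

    -- The Pascal recurrence of q-binomial coefficients, from 1 - Q^(m+n+1) = (1 - Q^(m-k)) +
    -- Q^(m-k) (1 - Q^(n+k+1)): each part lowers one of the two reciprocal factorials.
    rising-term : ∀ m n x k →
      (1# - Q ^ suc (m ℕ.+ n)) * jtpTerm (suc m) n x (suc k)
        ≈ jtpTerm m n x (suc k) + (x * Q ^ m) * jtpTerm m n x k
    rising-term m n x k = begin
      (1# - Q * Q ^ (m ℕ.+ n)) * ((ρ∸ m k * ρ (n ℕ.+ suc k)) * ((x * x ^ k) * Q ^ (k ℕ.+ tri k)))
        ≈⟨ *-cong (+-congˡ (-‿cong (*-congˡ (^-homo-* Q m n)))) (*-congˡ (*-congˡ (^-homo-* Q k (tri k)))) ⟩
      (1# - Q * (Q ^ m * Q ^ n)) * ((ρ∸ m k * ρ (n ℕ.+ suc k)) * ((x * x ^ k) * (Q ^ k * Q ^ tri k)))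
        ≈⟨ solve 9 (λ q M N r s x X K T → (:1 :- q :* (M :* N)) :* ((r :* s) :* ((x :* X) :* (K :* T)))
              := (r :- (r :* M) :* (q :* N)) :* (s :* ((x :* X) :* (K :* T)))) refl
              Q (Q ^ m) (Q ^ n) (ρ∸ m k) (ρ (n ℕ.+ suc k)) x (x ^ k) (Q ^ k) (Q ^ tri k) ⟩
      (ρ∸ m k - (ρ∸ m k * Q ^ m) * (Q * Q ^ n)) * (s * ((x * x ^ k) * (Q ^ k * Q ^ tri k)))
        ≈⟨ *-congʳ (+-congˡ (-‿cong (*-congʳ (ρ∸-^ m k)))) ⟨
      (ρ∸ m k - (ρ∸ m k * (P * Q ^ k)) * (Q * Q ^ n)) * (s * ((x * x ^ k) * (Q ^ k * Q ^ tri k)))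
        ≈⟨ solve 9 (λ q P N r s x X K T →
              (r :- (r :* (P :* K)) :* (q :* N)) :* (s :* ((x :* X) :* (K :* T)))
              := ((r :* (:1 :- P)) :* s) :* ((x :* X) :* (K :* T))
                 :+ (x :* (r :* (P :* K))) :* ((s :* (:1 :- q :* (N :* K))) :* (X :* T))) refl
              Q P (Q ^ n) (ρ∸ m k) s x (x ^ k) (Q ^ k) (Q ^ tri k) ⟩
      ((ρ∸ m k * (1# - P)) * s) * ((x * x ^ k) * (Q ^ k * Q ^ tri k))
        + (x * (ρ∸ m k * (P * Q ^ k))) * ((s * (1# - Q * (Q ^ n * Q ^ k))) * (x ^ k * Q ^ tri k))
        ≈⟨ +-cong (*-cong (*-congʳ (sym (ρ∸-suc m (suc k)))) (*-congˡ (sym (^-homo-* Q k (tri k)))))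
                  (*-cong (*-congˡ (ρ∸-^ m k)) (*-congʳ s-step)) ⟩
      (ρ∸ m (suc k) * s) * ((x * x ^ k) * Q ^ (k ℕ.+ tri k))
        + (x * (ρ∸ m k * Q ^ m)) * (ρ (n ℕ.+ k) * (x ^ k * Q ^ tri k))
        ≈⟨ +-congˡ (solve 6 (λ x r M t X T → (x :* (r :* M)) :* (t :* (X :* T)) := (x :* M) :* ((r :* t) :* (X :* T))) refl _ _ _ _ _ _) ⟩
      jtpTerm m n x (suc k) + (x * Q ^ m) * jtpTerm m n x k ∎
      where
      P s : Carrier
      P = Q ^ (m ℕ.∸ k)
      s = ρ (n ℕ.+ suc k)
      s-step : s * (1# - Q * (Q ^ n * Q ^ k)) ≈ ρ (n ℕ.+ k)
      s-step rewrite ℕP.+-suc n k =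
        trans (*-congˡ (+-congˡ (-‿cong (*-congˡ (sym (^-homo-* Q n k)))))) (sym (ρ-suc (n ℕ.+ k)))

    -- The recurrence on the other half, from 1 - Q^(m+n+1) = (1 - Q^(m+k+1)) + Q^(m+k+1) (1 -
    -- Q^(n-k)). Here `x * y ≈ Q` rewrites Q^(m+1) as x Q^m times y, which brings out the same
    -- factor `x * Q ^ m` as in `rising-term`.
    falling-term : ∀ m n x y k → x * y ≈ Q →
      (1# - Q ^ suc (m ℕ.+ n)) * jtpTerm n (suc m) y k
        ≈ jtpTerm n m y k + (x * Q ^ m) * jtpTerm n m y (suc k)
    falling-term m n x y k xy≈Q = begin
      (1# - Q * Q ^ (m ℕ.+ n)) * ((ρ∸ n k * s) * (y ^ k * Q ^ tri k))
        ≈⟨ *-congʳ (+-congˡ (-‿cong (*-congˡ (^-homo-* Q m n)))) ⟩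
      (1# - Q * (Q ^ m * Q ^ n)) * ((ρ∸ n k * s) * (y ^ k * Q ^ tri k))
        ≈⟨ solve 7 (λ q M N r s Y T → (:1 :- q :* (M :* N)) :* ((r :* s) :* (Y :* T))
              := (r :- (r :* N) :* (q :* M)) :* (s :* (Y :* T))) refl
              Q (Q ^ m) (Q ^ n) (ρ∸ n k) s (y ^ k) (Q ^ tri k) ⟩
      (ρ∸ n k - (ρ∸ n k * Q ^ n) * (Q * Q ^ m)) * (s * (y ^ k * Q ^ tri k))
        ≈⟨ *-congʳ (+-congˡ (-‿cong (*-congʳ (ρ∸-^ n k)))) ⟨
      (ρ∸ n k - (ρ∸ n k * (P * Q ^ k)) * (Q * Q ^ m)) * (s * (y ^ k * Q ^ tri k))
        ≈⟨ solve 8 (λ q P M r s Y K T →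
              (r :- (r :* (P :* K)) :* (q :* M)) :* (s :* (Y :* T))
              := (r :* (s :* (:1 :- q :* (M :* K)))) :* (Y :* T)
                 :+ (q :* M) :* (((r :* (:1 :- P)) :* s) :* (Y :* (K :* T)))) refl
              Q P (Q ^ m) (ρ∸ n k) s (y ^ k) (Q ^ k) (Q ^ tri k) ⟩
      (ρ∸ n k * (s * (1# - Q * (Q ^ m * Q ^ k)))) * (y ^ k * Q ^ tri k)
        + (Q * Q ^ m) * (((ρ∸ n k * (1# - P)) * s) * (y ^ k * (Q ^ k * Q ^ tri k)))
        ≈⟨ +-cong (*-congʳ (*-congˡ s-step))
             (*-cong (*-congʳ (sym xy≈Q))
                     (*-cong (*-cong (sym (ρ∸-suc n (suc k))) (reflexive (≡.cong ρ (≡.sym (ℕP.+-suc m k)))))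
                             (*-congˡ (sym (^-homo-* Q k (tri k)))))) ⟩
      jtpTerm n m y k
        + ((x * y) * Q ^ m) * ((ρ∸ n (suc k) * ρ (m ℕ.+ suc k)) * (y ^ k * Q ^ (k ℕ.+ tri k)))
        ≈⟨ +-congˡ (solve 6 (λ x y M r Y T → ((x :* y) :* M) :* (r :* (Y :* T)) := (x :* M) :* (r :* ((y :* Y) :* T))) refl _ _ _ _ _ _) ⟩
      jtpTerm n m y k + (x * Q ^ m) * jtpTerm n m y (suc k) ∎
      where
      P s : Carrier
      P = Q ^ (n ℕ.∸ k)
      s = ρ (suc m ℕ.+ k)
      s-step : s * (1# - Q * (Q ^ m * Q ^ k)) ≈ ρ (m ℕ.+ k)
      s-step = trans (*-congˡ (+-congˡ (-‿cong (*-congˡ (sym (^-homo-* Q m k)))))) (sym (ρ-suc (m ℕ.+ k)))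

    jtpSum-step : ∀ B m n x y → x * y ≈ Q → m ℕ.< B → n ℕ.< B →
      (1# - Q ^ suc (m ℕ.+ n)) * jtpSum B (suc m) n x y ≈ (1# + x * Q ^ m) * jtpSum B m n x y
    jtpSum-step B m n x y xy≈Q m<B n<B = begin
      z * (sum B (λ k → jtpTerm (suc m) n x (suc k)) + sum B (jtpTerm n (suc m) y))
        ≈⟨ distribˡ z _ _ ⟩
      z * sum B (λ k → jtpTerm (suc m) n x (suc k)) + z * sum B (jtpTerm n (suc m) y)
        ≈⟨ +-cong (sum-*ˡ B z _) (sum-*ˡ B z _) ⟩
      sum B (λ k → z * jtpTerm (suc m) n x (suc k)) + sum B (λ k → z * jtpTerm n (suc m) y k)
        ≈⟨ +-cong (sum-cong B (rising-term m n x)) (sum-cong B (λ k → falling-term m n x y k xy≈Q)) ⟩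
      sum B (λ k → jtpTerm m n x (suc k) + w * jtpTerm m n x k)
        + sum B (λ k → jtpTerm n m y k + w * jtpTerm n m y (suc k))
        ≈⟨ +-cong (trans (sum-+ B _ _) (+-congˡ (sym (sum-*ˡ B w _)))) (trans (sum-+ B _ _) (+-congˡ (sym (sum-*ˡ B w _)))) ⟩
      (α′ + w * sum B (jtpTerm m n x)) + (β + w * β′)
        ≈⟨ +-congʳ (+-congˡ (*-congˡ (shifted-sum B m n x m<B))) ⟨
      -- The sums multiplied by w are shifted by one against the halves; moving the term of index 0
      -- from the half in `x` to the half in `y` restores the bilateral sum.
      (α′ + w * (jtpTerm m n x 0 + α′)) + (β + w * β′)
        ≈⟨ solve 5 (λ w a b c t → (a :+ w :* (t :+ a)) :+ (b :+ w :* c) := a :+ b :+ w :* (a :+ (t :+ c))) refl w α′ β β′ _ ⟩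
      α′ + β + w * (α′ + (jtpTerm m n x 0 + β′))
        ≈⟨ +-congˡ (*-congˡ (+-congˡ (trans (+-congʳ (jtpTerm-0 m n x y)) (shifted-sum B n m y n<B)))) ⟩
      α′ + β + w * (α′ + β)
        ≈⟨ solve 2 (λ w a → a :+ w :* a := (:1 :+ w) :* a) refl w (α′ + β) ⟩
      (1# + w) * (α′ + β) ∎
      where
      z w α′ β β′ : Carrier
      z = 1# - Q ^ suc (m ℕ.+ n)
      w = x * Q ^ m
      α′ = sum B (λ k → jtpTerm m n x (suc k))
      β = sum B (jtpTerm n m y)
      β′ = sum B (λ k → jtpTerm n m y (suc k))

    factors : Carrier → ℕ → Carrier
    factors x n = prod n (λ i → 1# + x * Q ^ i)

    FiniteJTP : ℕ → ℕ → ℕ → Carrier → Carrier → Set _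
    FiniteJTP B m n x y = ρ (m ℕ.+ n) * (factors x m * factors y n) ≈ jtpSum B m n x y

    extend-left : ∀ B n x y → x * y ≈ Q → n ℕ.< B → FiniteJTP B 0 n x y →
      ∀ m → m ℕ.< B → FiniteJTP B m n x y
    extend-left B n x y xy≈Q n<B base zero    m<B = base
    extend-left B n x y xy≈Q n<B base (suc m) m<B = cancel (m ℕ.+ n) (begin
      z * (ρ (suc (m ℕ.+ n)) * ((factors x m * (1# + x * Q ^ m)) * factors y n))
        ≈⟨ solve 5 (λ z r a u b → z :* (r :* ((a :* u) :* b)) := u :* ((r :* z) :* (a :* b))) refl _ _ _ _ _ ⟩
      (1# + x * Q ^ m) * ((ρ (suc (m ℕ.+ n)) * z) * (factors x m * factors y n))
        ≈⟨ *-congˡ (*-congʳ (ρ-suc (m ℕ.+ n))) ⟨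
      (1# + x * Q ^ m) * (ρ (m ℕ.+ n) * (factors x m * factors y n))
        ≈⟨ *-congˡ (extend-left B n x y xy≈Q n<B base m m<B′) ⟩
      (1# + x * Q ^ m) * jtpSum B m n x y
        ≈⟨ jtpSum-step B m n x y xy≈Q m<B′ n<B ⟨
      z * jtpSum B (suc m) n x y ∎)
      where
      z : Carrier
      z = 1# - Q ^ suc (m ℕ.+ n)
      m<B′ : m ℕ.< B
      m<B′ = ℕP.<-trans (ℕP.n<1+n m) m<B

    swap : ∀ B m n x y → m ℕ.< B → n ℕ.< B → FiniteJTP B m n x y → FiniteJTP B n m y x
    swap B m n x y m<B n<B h =
      trans (*-cong (reflexive (≡.cong ρ (ℕP.+-comm n m))) (*-comm _ _)) (trans h (jtpSum-sym B m n x y m<B n<B))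

    -- From m = n = 0, raise one index with `x` and `y` exchanged, swap by the symmetry k ↦ -k of
    -- the bilateral sum, then raise the other.
    finite-jacobi-triple-product : ∀ B m n x y → x * y ≈ Q → m ℕ.< B → n ℕ.< B → FiniteJTP B m n x y
    finite-jacobi-triple-product B m n x y xy≈Q m<B n<B =
      extend-left B n x y xy≈Q n<B
        (swap B n 0 y x n<B 0<B
          (extend-left B 0 y x (trans (*-comm y x) xy≈Q) 0<B base n n<B))
        m m<B
      where
      0<B : 0 ℕ.< B
      0<B = ℕP.≤-<-trans z≤n m<B
      base : FiniteJTP B 0 0 y x
      base = begin
        1# * (1# * 1#)                ≈⟨ solve 0 (:1 :* (:1 :* :1) := (:1 :* :1) :* (:1 :* :1) :+ con (+ 0)) refl ⟩
        jtpTerm 0 0 x 0 + 0#          ≈⟨ +-congˡ (sum-zero B (λ k _ → jtpTerm-> 0 0 x (suc k) (s≤s z≤n))) ⟨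
        jtpTerm 0 0 x 0 + sum B (λ k → jtpTerm 0 0 x (suc k))
                                      ≈⟨ shifted-sum B 0 0 x 0<B ⟩
        sum B (jtpTerm 0 0 x)         ≈⟨ +-identityˡ _ ⟨
        0# + sum B (jtpTerm 0 0 x)    ≈⟨ +-congʳ (sum-zero B (λ k _ → jtpTerm-> 0 0 y (suc k) (s≤s z≤n))) ⟨
        jtpSum B 0 0 y x              ∎

    -- Partial fractions and the summation over a Bailey pair

    weight : ℕ → Carrier
    weight t = sgn t * (Q ^ tri t * (1# - Q ^ suc (t ℕ.+ t)))

    ρ∸-diag : ∀ n → ρ∸ n n ≡ 1#
    ρ∸-diag zero    = ≡.refl
    ρ∸-diag (suc n) = ρ∸-diag n

    -- At T = N this gives the coefficient of the last factor A N in partial-fractions.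
    telescope : ∀ N T →
      (1# - Q ^ N) * sum T (λ t → weight t * (ρ∸ N t * ρ (suc N ℕ.+ t)))
        + (sgn T * Q ^ tri T) * ((1# - Q ^ T) * (ρ∸ N T * ρ (N ℕ.+ T))) ≈ 0#
    telescope N zero    = solve 3 (λ a r s → (:1 :- a) :* con (+ 0) :+ (:1 :* :1) :* ((:1 :- :1) :* (r :* s)) := con (+ 0)) refl _ _ _
    telescope N (suc T) = begin
      (1# - M) * (S + (sgn T * (X * (1# - Q * Q ^ (T ℕ.+ T)))) * (r * s))
        + (- sgn T * Q ^ (T ℕ.+ tri T)) * ((1# - Q * K) * (ρ∸ N (suc T) * ρ (N ℕ.+ suc T)))
        ≈⟨ +-cong (*-congˡ (+-congˡ (*-congʳ (*-congˡ (*-congˡ (+-congˡ (-‿cong (*-congˡ (^-homo-* Q T T)))))))))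
                  (*-cong (*-congˡ (^-homo-* Q T (tri T))) (*-congˡ (*-cong (ρ∸-suc N (suc T)) (reflexive (≡.cong ρ (ℕP.+-suc N T)))))) ⟩
      (1# - M) * (S + (sgn T * (X * (1# - Q * (K * K)))) * (r * s))
        + (- sgn T * (K * X)) * ((1# - Q * K) * ((r * (1# - P)) * s))
        ≈⟨ solve 9 (λ M S g X Q K r s P →
              (:1 :- M) :* (S :+ (g :* (X :* (:1 :- Q :* (K :* K)))) :* (r :* s))
                :+ (:- g :* (K :* X)) :* ((:1 :- Q :* K) :* ((r :* (:1 :- P)) :* s))
              := (:1 :- M) :* S :+ (g :* X) :* (s :* ((r :- r :* M) :* (:1 :- Q :* (K :* K)) :- (r :* K :- r :* (P :* K)) :* (:1 :- Q :* K))))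
              refl M S (sgn T) X Q K r s P ⟩
      (1# - M) * S + (sgn T * X) * (s * ((r - r * M) * (1# - Q * (K * K)) - (r * K - r * (P * K)) * (1# - Q * K)))
        ≈⟨ +-congˡ (*-congˡ (*-congˡ (+-congˡ (-‿cong (*-congʳ (+-congˡ (-‿cong (ρ∸-^ N T)))))))) ⟩
      (1# - M) * S + (sgn T * X) * (s * ((r - r * M) * (1# - Q * (K * K)) - (r * K - r * M) * (1# - Q * K)))
        ≈⟨ solve 8 (λ M S g X Q K r s →
              (:1 :- M) :* S :+ (g :* X) :* (s :* ((r :- r :* M) :* (:1 :- Q :* (K :* K)) :- (r :* K :- r :* M) :* (:1 :- Q :* K)))
              := (:1 :- M) :* S :+ (g :* X) :* ((:1 :- K) :* (r :* (s :* (:1 :- Q :* (M :* K))))))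
              refl M S (sgn T) X Q K r s ⟩
      (1# - M) * S + (sgn T * X) * ((1# - K) * (r * (s * (1# - Q * (M * K)))))
        ≈⟨ +-congˡ (*-congˡ (*-congˡ (*-congˡ (trans (*-congˡ (+-congˡ (-‿cong (*-congˡ (sym (^-homo-* Q N T)))))) (sym (ρ-suc (N ℕ.+ T))))))) ⟩
      (1# - M) * S + (sgn T * X) * ((1# - K) * (r * ρ (N ℕ.+ T)))
        ≈⟨ telescope N T ⟩
      0# ∎
      where
      M S X K r s P : Carrier
      M = Q ^ N
      S = sum T (λ t → weight t * (ρ∸ N t * ρ (suc N ℕ.+ t)))
      X = Q ^ tri T
      K = Q ^ T
      r = ρ∸ N T
      s = ρ (suc N ℕ.+ T)
      P = Q ^ (N ℕ.∸ T)

    weight-sum : ∀ M → let N = suc M in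
      -- `N` is a successor so that the factor 1 - Q^N of `telescope` can be cancelled.
      sum N (λ t → weight t * (ρ∸ N t * ρ (suc N ℕ.+ t))) ≈ - ((sgn N * Q ^ tri N) * ρ (N ℕ.+ N))
    weight-sum M = cancel M (begin
      z * S                                            ≈⟨ inverseˡ-unique _ _ (telescope N N) ⟩
      - ((sgn N * Q ^ tri N) * (z * (ρ∸ N N * ρ (N ℕ.+ N))))
        ≡⟨ ≡.cong (λ r → - ((sgn N * Q ^ tri N) * (z * (r * ρ (N ℕ.+ N))))) (ρ∸-diag N) ⟩
      - ((sgn N * Q ^ tri N) * (z * (1# * ρ (N ℕ.+ N))))
        ≈⟨ solve 3 (λ g z r → :- (g :* (z :* (:1 :* r))) := z :* (:- (g :* r))) refl _ _ _ ⟩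
      z * - ((sgn N * Q ^ tri N) * ρ (N ℕ.+ N))        ∎)
      where
      N : ℕ
      N = suc M
      z S : Carrier
      z = 1# - Q ^ N
      S = sum N (λ t → weight t * (ρ∸ N t * ρ (suc N ℕ.+ t)))

    module PartialFractions (x y : Carrier) (xy≈Q : x * y ≈ Q) (A : ℕ → Carrier)
      (A-inverse : ∀ t → ((1# - x * Q ^ t) * (1# - y * Q ^ t)) * A t ≈ 1#) where

      -- Put D_t = (1 - x Q^t)(1 - y Q^t) = 1 - (x + y) Q^t + Q^(2t+1). In D_N - Q^(N-t) D_t the
      -- terms in x + y cancel, and the rest factors as (1 - Q^(N-t))(1 - Q^(N+t+1)).
      product-of-two : ∀ t s → let p = Q ^ t; r = Q ^ s; N = s ℕ.+ t in
        ((1# - r) * (1# - Q ^ suc (N ℕ.+ t))) * (A t * A N) ≈ A t - r * A N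
      product-of-two t s = begin
        ((1# - r) * (1# - Q * Q ^ (N ℕ.+ t))) * (A t * A N)
          ≈⟨ *-congʳ (*-congˡ (+-congˡ (-‿cong (*-cong (sym xy≈Q) (trans (^-homo-* Q N t) (*-congʳ (^-homo-* Q s t))))))) ⟩
        ((1# - r) * (1# - (x * y) * ((r * p) * p))) * (A t * A N)
          ≈⟨ solve 6 (λ x y p r a b →
               ((:1 :- r) :* (:1 :- (x :* y) :* ((r :* p) :* p))) :* (a :* b)
               := a :* (((:1 :- x :* (r :* p)) :* (:1 :- y :* (r :* p))) :* b) :- (r :* b) :* (((:1 :- x :* p) :* (:1 :- y :* p)) :* a))
               refl x y p r (A t) (A N) ⟩
        A t * (((1# - x * (r * p)) * (1# - y * (r * p))) * A N) - (r * A N) * (((1# - x * p) * (1# - y * p)) * A t)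
          ≈⟨ +-cong (*-congˡ (trans (*-congʳ (*-cong (+-congˡ (-‿cong (*-congˡ (sym (^-homo-* Q s t)))))
                                                     (+-congˡ (-‿cong (*-congˡ (sym (^-homo-* Q s t))))))) (A-inverse N)))
                    (-‿cong (*-congˡ (A-inverse t))) ⟩
        A t * 1# - (r * A N) * 1#
          ≈⟨ +-cong (*-identityʳ _) (-‿cong (*-identityʳ _)) ⟩
        A t - r * A N ∎
        where
        N : ℕ
        N = s ℕ.+ t
        p r : Carrier
        p = Q ^ t
        r = Q ^ s

      -- Induction on M: after multiplication by the new factor `A N`, every `A t * A N` is
      -- separated by `product-of-two`, and the resulting coefficients of `A N` are summed by
      -- `weight-sum`. Up to normalisation this is a Bailey pair relative to Q, with the product as
      -- its β side.
      partial-fractions : ∀ M →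
        prod (suc M) A ≈ sum (suc M) (λ t → (weight t * Q ^ t) * (A t * (ρ∸ M t * ρ (suc M ℕ.+ t))))
      partial-fractions zero = begin
        1# * A 0
          ≈⟨ *-congʳ (inv-inverse 0) ⟨
        ((1# - Q * 1#) * inv 0) * A 0
          ≈⟨ solve 3 (λ q i a → ((:1 :- q :* :1) :* i) :* a := con (+ 0) :+ ((:1 :* (:1 :* (:1 :- q :* :1))) :* :1) :* (a :* (:1 :* (:1 :* i)))) refl _ _ _ ⟩
        0# + (weight 0 * Q ^ 0) * (A 0 * (ρ∸ 0 0 * ρ (suc 0 ℕ.+ 0))) ∎
      partial-fractions (suc M) = begin
        prod N A * A N
          ≈⟨ *-congʳ (partial-fractions M) ⟩
        sum N (λ t → (weight t * Q ^ t) * (A t * (ρ∸ M t * ρ (N ℕ.+ t)))) * A N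
          ≈⟨ sum-*ʳ N _ (A N) ⟩
        sum N (λ t → ((weight t * Q ^ t) * (A t * (ρ∸ M t * ρ (N ℕ.+ t)))) * A N)
          ≈⟨ sum-cong< N (λ t t<N → term t (ℕP.<⇒≤ t<N)) ⟩
        sum N (λ t → f t + (- (Q ^ N * A N)) * u t)
          ≈⟨ sum-+ N f _ ⟩
        sum N f + sum N (λ t → (- (Q ^ N * A N)) * u t)
          ≈⟨ +-congˡ (sum-*ˡ N (- (Q ^ N * A N)) u) ⟨
        sum N f + (- (Q ^ N * A N)) * sum N u
          ≈⟨ +-congˡ (*-congˡ (trans (weight-sum M) (-‿cong (*-congˡ (ρ-suc (N ℕ.+ N)))))) ⟩
        sum N f + (- (Q ^ N * A N)) * - ((sgn N * Q ^ tri N) * (ρ (suc (N ℕ.+ N)) * (1# - Q ^ suc (N ℕ.+ N))))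
          ≈⟨ +-congˡ (solve 6 (λ K a g X r Z →
               (:- (K :* a)) :* :- ((g :* X) :* (r :* (:1 :- Z))) := ((g :* (X :* (:1 :- Z))) :* K) :* (a :* (:1 :* r)))
               refl (Q ^ N) (A N) (sgn N) (Q ^ tri N) (ρ (suc (N ℕ.+ N))) (Q ^ suc (N ℕ.+ N))) ⟩
        sum N f + (weight N * Q ^ N) * (A N * (1# * ρ (suc (N ℕ.+ N))))
          ≡⟨ ≡.cong (λ r → sum N f + (weight N * Q ^ N) * (A N * (r * ρ (suc (N ℕ.+ N))))) (ρ∸-diag N) ⟨
        sum N f + f N ∎
        where
        N : ℕ
        N = suc M
        f u : ℕ → Carrier
        f t = (weight t * Q ^ t) * (A t * (ρ∸ N t * ρ (suc N ℕ.+ t)))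
        u t = weight t * (ρ∸ N t * ρ (suc N ℕ.+ t))

        term : ∀ t → t ℕ.≤ N →
          ((weight t * Q ^ t) * (A t * (ρ∸ M t * ρ (N ℕ.+ t)))) * A N ≈ f t + (- (Q ^ N * A N)) * u t
        term t t≤N = begin
          ((weight t * Q ^ t) * (A t * (ρ∸ M t * ρ (N ℕ.+ t)))) * A N
            ≈⟨ *-congʳ (*-congˡ (*-congˡ (*-cong (ρ∸-suc M t) (ρ-suc (N ℕ.+ t))))) ⟩
          ((weight t * Q ^ t) * (A t * ((ρ∸ N t * (1# - Q ^ s)) * (ρ (suc N ℕ.+ t) * (1# - Q ^ suc (N ℕ.+ t)))))) * A N
            ≈⟨ solve 7 (λ w a r e s f b → (w :* (a :* ((r :* e) :* (s :* f)))) :* b := (w :* (r :* s)) :* ((e :* f) :* (a :* b))) refl _ _ _ _ _ _ _ ⟩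
          ((weight t * Q ^ t) * (ρ∸ N t * ρ (suc N ℕ.+ t))) * (((1# - Q ^ s) * (1# - Q ^ suc (N ℕ.+ t))) * (A t * A N))
            ≈⟨ *-congˡ two ⟩
          ((weight t * Q ^ t) * (ρ∸ N t * ρ (suc N ℕ.+ t))) * (A t - Q ^ s * A N)
            ≈⟨ solve 6 (λ w K d a S b → ((w :* K) :* d) :* (a :- S :* b) := (w :* K) :* (a :* d) :+ (:- ((S :* K) :* b)) :* (w :* d)) refl _ _ _ _ _ _ ⟩
          f t + (- ((Q ^ s * Q ^ t) * A N)) * u t
            ≈⟨ +-congˡ (*-congʳ (-‿cong (*-congʳ (trans (sym (^-homo-* Q s t)) (^-congʳ Q (ℕP.m∸n+n≡m t≤N)))))) ⟩
          f t + (- (Q ^ N * A N)) * u t ∎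
          where
          s : ℕ
          s = N ℕ.∸ t
          two : ((1# - Q ^ s) * (1# - Q ^ suc (N ℕ.+ t))) * (A t * A N) ≈ A t - Q ^ s * A N
          two = ≡.subst (λ n → ((1# - Q ^ s) * (1# - Q ^ suc (n ℕ.+ t))) * (A t * A n) ≈ A t - Q ^ s * A n)
                  (ℕP.m∸n+n≡m t≤N) (product-of-two t s)

      -- Terms with M < t vanish, and M = t + m turns M(M+1) into t(t+1) + m(m + 2t + 1); what
      -- remains is q-Vandermonde with shift k = 2t + 1.
      durfee : ∀ a t → t ℕ.≤ a →
        sum (suc a) (λ M → Q ^ (M ℕ.* suc M) * (ρ∸ a M * (ρ∸ M t * ρ (suc M ℕ.+ t))))
          ≈ Q ^ (t ℕ.* suc t) * (ρ∸ a t * ρ (suc a ℕ.+ t))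
      durfee a t t≤a with ℕP.m≤n⇒∃[o]m+o≡n t≤a
      ... | b , ≡.refl = begin
        sum (suc (t ℕ.+ b)) f
          ≡⟨ ≡.cong (λ n → sum n f) (ℕP.+-suc t b) ⟨
        sum (t ℕ.+ suc b) f
          ≈⟨ sum-split t (suc b) f ⟩
        sum t f + sum (suc b) (λ m → f (t ℕ.+ m))
          ≈⟨ +-cong (sum-zero t low) (sum-cong (suc b) high) ⟩
        0# + sum (suc b) (λ m → Q ^ (t ℕ.* suc t) * (Q ^ (m ℕ.* (m ℕ.+ k)) * (ρ∸ b m * (ρ m * ρ (m ℕ.+ k)))))
          ≈⟨ trans (+-identityˡ _) (sym (sum-*ˡ (suc b) _ _)) ⟩
        Q ^ (t ℕ.* suc t) * sum (suc b) (λ m → Q ^ (m ℕ.* (m ℕ.+ k)) * (ρ∸ b m * (ρ m * ρ (m ℕ.+ k))))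
          ≈⟨ *-congˡ (q-vandermonde b k) ⟩
        Q ^ (t ℕ.* suc t) * (ρ b * ρ (b ℕ.+ k))
          ≡⟨ ≡.cong₂ (λ r n → Q ^ (t ℕ.* suc t) * (r * ρ n)) (≡.sym (ρ∸-+ b t)) (index b t) ⟩
        Q ^ (t ℕ.* suc t) * (ρ∸ (t ℕ.+ b) t * ρ (suc (t ℕ.+ b) ℕ.+ t)) ∎
        where
        k : ℕ
        k = suc (t ℕ.+ t)
        f : ℕ → Carrier
        f M = Q ^ (M ℕ.* suc M) * (ρ∸ (t ℕ.+ b) M * (ρ∸ M t * ρ (suc M ℕ.+ t)))
        low : ∀ i → i ℕ.< t → f i ≈ 0#
        low i i<t = trans (*-congˡ (*-congˡ (*-congʳ (reflexive (ρ∸-> i t i<t)))))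
          (solve 3 (λ a b c → a :* (b :* (con (+ 0) :* c)) := con (+ 0)) refl _ _ _)
        index : ∀ b t → b ℕ.+ suc (t ℕ.+ t) ≡ suc (t ℕ.+ b) ℕ.+ t
        index = solve-∀
        exponent : ∀ t m → (t ℕ.+ m) ℕ.* suc (t ℕ.+ m) ≡ t ℕ.* suc t ℕ.+ m ℕ.* (m ℕ.+ suc (t ℕ.+ t))
        exponent = solve-∀
        ρ∸-shift : ∀ t b m → ρ∸ (t ℕ.+ b) (t ℕ.+ m) ≡ ρ∸ b m
        ρ∸-shift zero    b m = ≡.refl
        ρ∸-shift (suc t) b m = ρ∸-shift t b m
        high : ∀ m → f (t ℕ.+ m) ≈ Q ^ (t ℕ.* suc t) * (Q ^ (m ℕ.* (m ℕ.+ k)) * (ρ∸ b m * (ρ m * ρ (m ℕ.+ k))))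
        high m = trans
          (*-cong (trans (^-congʳ Q (exponent t m)) (^-homo-* Q (t ℕ.* suc t) (m ℕ.* (m ℕ.+ k))))
            (*-cong (reflexive (ρ∸-shift t b m))
              (*-cong (reflexive (ρ∸-+ m t)) (reflexive (≡.cong ρ (≡.sym (index m t)))))))
          (*-assoc _ _ _)

      -- Bailey's lemma for the pair above: insert the partial fractions, exchange the sums,
      -- evaluate the inner one by `durfee`. The factor `ρ∸ a M` gives the inner sum a closed form
      -- at finite a, and turns into a constant in the limit.
      finite-appell-lerch : ∀ a →
        sum (suc a) (λ M → Q ^ (M ℕ.* suc M) * (ρ∸ a M * prod (suc M) A))
          ≈ sum (suc a) (λ t → ((weight t * Q ^ t) * A t) * (Q ^ (t ℕ.* suc t) * (ρ∸ a t * ρ (suc a ℕ.+ t))))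
      finite-appell-lerch a = begin
        sum (suc a) (λ M → Q ^ (M ℕ.* suc M) * (ρ∸ a M * prod (suc M) A))
          ≈⟨ sum-cong< (suc a) (λ M M<1+a → expand M M<1+a) ⟩
        sum (suc a) (λ M → sum (suc a) (λ t → ((weight t * Q ^ t) * A t) * g M t))
          ≈⟨ sum-swap (suc a) (suc a) _ ⟩
        sum (suc a) (λ t → sum (suc a) (λ M → ((weight t * Q ^ t) * A t) * g M t))
          ≈⟨ sum-cong< (suc a) (λ t t<1+a → trans (sym (sum-*ˡ (suc a) _ _)) (*-congˡ (durfee a t (ℕP.≤-pred t<1+a)))) ⟩
        sum (suc a) (λ t → ((weight t * Q ^ t) * A t) * (Q ^ (t ℕ.* suc t) * (ρ∸ a t * ρ (suc a ℕ.+ t)))) ∎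
        where
        g : ℕ → ℕ → Carrier
        g M t = Q ^ (M ℕ.* suc M) * (ρ∸ a M * (ρ∸ M t * ρ (suc M ℕ.+ t)))
        expand : ∀ M → M ℕ.< suc a →
          Q ^ (M ℕ.* suc M) * (ρ∸ a M * prod (suc M) A) ≈ sum (suc a) (λ t → ((weight t * Q ^ t) * A t) * g M t)
        expand M M<1+a = begin
          Q ^ (M ℕ.* suc M) * (ρ∸ a M * prod (suc M) A)
            ≈⟨ *-assoc _ _ _ ⟨
          (Q ^ (M ℕ.* suc M) * ρ∸ a M) * prod (suc M) A
            -- `ρ∸ M t` vanishes for t > M, so the range of t can be made independent of M before
            -- the sums are exchanged.
            ≈⟨ *-congˡ (trans (partial-fractions M) (sum-extend _ M<1+a vanish)) ⟩
          (Q ^ (M ℕ.* suc M) * ρ∸ a M) * sum (suc a) (λ t → (weight t * Q ^ t) * (A t * (ρ∸ M t * ρ (suc M ℕ.+ t))))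
            ≈⟨ sum-*ˡ (suc a) _ _ ⟩
          sum (suc a) (λ t → (Q ^ (M ℕ.* suc M) * ρ∸ a M) * ((weight t * Q ^ t) * (A t * (ρ∸ M t * ρ (suc M ℕ.+ t)))))
            ≈⟨ sum-cong (suc a) (λ t → solve 5 (λ e r w b d → (e :* r) :* (w :* (b :* d)) := (w :* b) :* (e :* (r :* d))) refl _ _ _ _ _) ⟩
          sum (suc a) (λ t → ((weight t * Q ^ t) * A t) * g M t) ∎
          where
          vanish : ∀ t → suc M ℕ.≤ t → (weight t * Q ^ t) * (A t * (ρ∸ M t * ρ (suc M ℕ.+ t))) ≈ 0#
          vanish t M<t = trans (*-congˡ (*-congˡ (*-congʳ (reflexive (ρ∸-> M t M<t)))))
            (solve 3 (λ a b c → a :* (b :* (con (+ 0) :* c)) := con (+ 0)) refl _ _ _)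

-- Limits in a nilpotent variable

module Truncated {c ℓ} (R : CommutativeRing c ℓ) (L : ℕ) where
  open CommutativeRing R
  open QSeries R
  open IntegerSolver R
  open import Relation.Binary.Reasoning.Setoid setoid

  -- Elements of order at least one in the power series ring modulo q^L.
  Nil : Carrier → Set ℓ
  Nil x = x ^ L ≈ 0#

  nil-power : ∀ {x} → Nil x → ∀ {n} → L ℕ.≤ n → x ^ n ≈ 0#
  nil-power {x} nil {n} L≤n = begin
    x ^ n                        ≡⟨ ≡.cong (x ^_) (ℕP.m+[n∸m]≡n L≤n) ⟨
    x ^ (L ℕ.+ (n ℕ.∸ L))        ≈⟨ ^-homo-* x L (n ℕ.∸ L) ⟩
    x ^ L * x ^ (n ℕ.∸ L)        ≈⟨ *-congʳ nil ⟩
    0# * x ^ (n ℕ.∸ L)           ≈⟨ zeroˡ _ ⟩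
    0#                           ∎

  nil-^ : ∀ {x} → Nil x → ∀ n → Nil (x ^ suc n)
  nil-^ {x} nil n = trans (^-assocʳ x (suc n) L) (nil-power nil (ℕP.m≤m+n L (n ℕ.* L)))

  module Limit (Q : Carrier) (Q-nil : Nil Q) (inv : ℕ → Carrier)
    (inv-inverse : ∀ n → (1# - Q ^ suc n) * inv n ≈ 1#) where
    open WithInverses Q inv inv-inverse public

    ρ∞ : Carrier
    ρ∞ = ρ L

    qfact : ℕ → Carrier
    qfact n = prod n (λ i → 1# - Q ^ suc i)

    qfact-ρ : ∀ n → qfact n * ρ n ≈ 1#
    qfact-ρ zero    = *-identityˡ 1#
    qfact-ρ (suc n) = begin
      (qfact n * (1# - Q ^ suc n)) * (ρ n * inv n)
        ≈⟨ solve 4 (λ a b c d → (a :* b) :* (c :* d) := (a :* c) :* (b :* d)) refl _ _ _ _ ⟩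
      (qfact n * ρ n) * ((1# - Q ^ suc n) * inv n)
        ≈⟨ *-cong (qfact-ρ n) (inv-inverse n) ⟩
      1# * 1#   ≈⟨ *-identityˡ 1# ⟩
      1#        ∎

    ρ-+ : ∀ n → ρ (n ℕ.+ L) ≈ ρ∞
    ρ-+ zero    = refl
    ρ-+ (suc n) = begin
      ρ (n ℕ.+ L) * inv (n ℕ.+ L)        ≈⟨ *-congˡ inv≈1 ⟩
      ρ (n ℕ.+ L) * 1#                   ≈⟨ *-identityʳ _ ⟩
      ρ (n ℕ.+ L)                        ≈⟨ ρ-+ n ⟩
      ρ∞                                 ∎
      where
      inv≈1 : inv (n ℕ.+ L) ≈ 1#
      inv≈1 = begin
        inv (n ℕ.+ L)                                    ≈⟨ solve 1 (λ i → i := (:1 :- con (+ 0)) :* i) refl _ ⟩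
        (1# - 0#) * inv (n ℕ.+ L)                        ≈⟨ *-congʳ (+-congˡ (-‿cong (nil-power Q-nil (ℕP.m≤n+m L (suc n))))) ⟨
        (1# - Q ^ suc (n ℕ.+ L)) * inv (n ℕ.+ L)         ≈⟨ inv-inverse (n ℕ.+ L) ⟩
        1#                                               ∎

    ρ-limit : ∀ {n} → L ℕ.≤ n → ρ n ≈ ρ∞
    ρ-limit {n} L≤n = trans (reflexive (≡.cong ρ (≡.sym (ℕP.m∸n+n≡m L≤n)))) (ρ-+ (n ℕ.∸ L))

    qfact-ρ∞ : ∀ {n} → L ℕ.≤ n → qfact n * ρ∞ ≈ 1#
    qfact-ρ∞ {n} L≤n = trans (*-congˡ (sym (ρ-limit L≤n))) (qfact-ρ n)

    -- The origin of the bound 2L: for k ≥ L both sides vanish with z^k, and for k ≤ L it leaves n -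
    -- k ≥ L, where `ρ` is stationary.
    ρ∸-limit : ∀ {z} → Nil z → ∀ {n} k → L ℕ.+ L ℕ.≤ n → ρ∸ n k * z ^ k ≈ ρ∞ * z ^ k
    ρ∸-limit {z} nil {n} k 2L≤n with ℕP.≤-total L k
    ... | inj₁ L≤k = trans (*-congˡ z^k≈0) (trans (zeroʳ _) (sym (trans (*-congˡ z^k≈0) (zeroʳ _))))
      where
      z^k≈0 : z ^ k ≈ 0#
      z^k≈0 = nil-power nil L≤k
    ... | inj₂ k≤L = *-congʳ (begin
      ρ∸ n k                       ≡⟨ ≡.cong (λ n → ρ∸ n k) (ℕP.m+[n∸m]≡n k≤n) ⟨
      ρ∸ (k ℕ.+ (n ℕ.∸ k)) k       ≡⟨ ρ∸-+ (n ℕ.∸ k) k ⟩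
      ρ (n ℕ.∸ k)                  ≈⟨ ρ-limit (ℕP.m+n≤o⇒m≤o∸n L (ℕP.≤-trans (ℕP.+-monoʳ-≤ L k≤L) 2L≤n)) ⟩
      ρ∞                           ∎)
      where
      k≤n : k ℕ.≤ n
      k≤n = ℕP.≤-trans k≤L (ℕP.≤-trans (ℕP.m≤m+n L L) 2L≤n)

    theta : ℕ → Carrier → Carrier → Carrier
    theta B x y = sum B (λ k → x ^ suc k * Q ^ tri (suc k)) + sum B (λ k → y ^ k * Q ^ tri k)

    -- In the finite identity each term of the sum acquires `ρ∞` twice, the product side once;
    -- multiplication by the square of `qfact n` clears them and leaves one `qfact n` on the product
    -- side.
    jacobi-triple-product : ∀ {x y} → x * y ≈ Q → Nil x → Nil y → ∀ n → L ℕ.+ L ℕ.≤ n →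
      qfact n * (factors x n * factors y n) ≈ theta (suc n) x y
    jacobi-triple-product {x} {y} xy≈Q x-nil y-nil n 2L≤n = begin
      qfact n * F
        ≈⟨ *-congʳ (trans (*-congˡ (qfact-ρ∞ L≤n)) (*-identityʳ _)) ⟨
      (qfact n * (qfact n * ρ∞)) * F
        ≈⟨ solve 3 (λ a b c → (a :* (a :* b)) :* c := (a :* a) :* (b :* c)) refl _ _ _ ⟩
      (qfact n * qfact n) * (ρ∞ * F)
        ≈⟨ *-congˡ (*-congʳ (sym (ρ-limit (ℕP.≤-trans L≤n (ℕP.m≤m+n n n))))) ⟩
      (qfact n * qfact n) * (ρ (n ℕ.+ n) * F)
        ≈⟨ *-congˡ (finite-jacobi-triple-product (suc n) n n x y xy≈Q ℕP.≤-refl ℕP.≤-refl) ⟩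
      (qfact n * qfact n) * jtpSum (suc n) n n x y
        ≈⟨ *-congˡ (+-cong (trans (sum-cong (suc n) (λ k → term x-nil (suc k))) (sym (sum-*ˡ (suc n) _ _)))
                           (trans (sum-cong (suc n) (term y-nil)) (sym (sum-*ˡ (suc n) _ _)))) ⟩
      (qfact n * qfact n) * ((ρ∞ * ρ∞) * α + (ρ∞ * ρ∞) * β)
        ≈⟨ solve 4 (λ a r u v → (a :* a) :* ((r :* r) :* u :+ (r :* r) :* v) := (a :* r) :* ((a :* r) :* (u :+ v))) refl _ _ _ _ ⟩
      (qfact n * ρ∞) * ((qfact n * ρ∞) * (α + β))
        ≈⟨ *-cong (qfact-ρ∞ L≤n) (*-congʳ (qfact-ρ∞ L≤n)) ⟩
      1# * (1# * (α + β))
        ≈⟨ trans (*-identityˡ _) (*-identityˡ _) ⟩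
      theta (suc n) x y ∎
      where
      L≤n : L ℕ.≤ n
      L≤n = ℕP.≤-trans (ℕP.m≤m+n L L) 2L≤n
      F α β : Carrier
      F = factors x n * factors y n
      α = sum (suc n) (λ k → x ^ suc k * Q ^ tri (suc k))
      β = sum (suc n) (λ k → y ^ k * Q ^ tri k)
      term : ∀ {z} → Nil z → ∀ k → jtpTerm n n z k ≈ (ρ∞ * ρ∞) * (z ^ k * Q ^ tri k)
      term {z} z-nil k = begin
        (ρ∸ n k * ρ (n ℕ.+ k)) * (z ^ k * Q ^ tri k)
          ≈⟨ solve 4 (λ a b c d → (a :* b) :* (c :* d) := b :* ((a :* c) :* d)) refl _ _ _ _ ⟩
        ρ (n ℕ.+ k) * ((ρ∸ n k * z ^ k) * Q ^ tri k)
          ≈⟨ *-cong (ρ-limit (ℕP.≤-trans L≤n (ℕP.m≤m+n n k))) (*-congʳ (ρ∸-limit z-nil k 2L≤n)) ⟩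
        ρ∞ * ((ρ∞ * z ^ k) * Q ^ tri k)
          ≈⟨ solve 3 (λ a c d → a :* ((a :* c) :* d) := (a :* a) :* (c :* d)) refl _ _ _ ⟩
        (ρ∞ * ρ∞) * (z ^ k * Q ^ tri k) ∎

    module PartialFractionsLimit (x y : Carrier) (xy≈Q : x * y ≈ Q) (a b : ℕ → Carrier)
      (a-inverse : ∀ t → (1# - x * Q ^ t) * a t ≈ 1#)
      (b-inverse : ∀ t → (1# - y * Q ^ t) * b t ≈ 1#) where

      A : ℕ → Carrier
      A t = a t * b t

      A-inverse : ∀ t → ((1# - x * Q ^ t) * (1# - y * Q ^ t)) * A t ≈ 1#
      A-inverse t = begin
        ((1# - x * Q ^ t) * (1# - y * Q ^ t)) * (a t * b t)
          ≈⟨ solve 4 (λ a b c d → (a :* b) :* (c :* d) := (a :* c) :* (b :* d)) refl _ _ _ _ ⟩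
        ((1# - x * Q ^ t) * a t) * ((1# - y * Q ^ t) * b t)
          ≈⟨ *-cong (a-inverse t) (b-inverse t) ⟩
        1# * 1#   ≈⟨ *-identityˡ 1# ⟩
        1#        ∎

      open PartialFractions x y xy≈Q A A-inverse public

      lambertTerm : ℕ → Carrier
      lambertTerm t = (sgn t * Q ^ tri t) * (Q ^ t * (a t + (y * Q ^ t) * b t))

      -- With K = Q^t, the factor 1 - Q^(2t+1) of `weight t` is 1 - x y K² = (1 - y K) + y K (1 - x
      -- K), which splits the product `a t * b t` into its two geometric series.
      weight-A : ∀ t → (weight t * Q ^ t) * A t ≈ lambertTerm t
      weight-A t = begin
        ((sgn t * (Q ^ tri t * (1# - Q * Q ^ (t ℕ.+ t)))) * Q ^ t) * (a t * b t)
          ≈⟨ *-congʳ (*-congʳ (*-congˡ (*-congˡ (+-congˡ (-‿cong (*-cong (sym xy≈Q) (^-homo-* Q t t))))))) ⟩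
        ((sgn t * (Q ^ tri t * (1# - (x * y) * (Q ^ t * Q ^ t)))) * Q ^ t) * (a t * b t)
          ≈⟨ solve 7 (λ g X x y K a b →
               ((g :* (X :* (:1 :- (x :* y) :* (K :* K)))) :* K) :* (a :* b)
               := (g :* X) :* (K :* (a :* ((:1 :- y :* K) :* b) :+ (y :* K) :* (b :* ((:1 :- x :* K) :* a)))))
               refl (sgn t) (Q ^ tri t) x y (Q ^ t) (a t) (b t) ⟩
        (sgn t * Q ^ tri t) * (Q ^ t * (a t * ((1# - y * Q ^ t) * b t) + (y * Q ^ t) * (b t * ((1# - x * Q ^ t) * a t))))
          ≈⟨ *-congˡ (*-congˡ (+-cong (trans (*-congˡ (b-inverse t)) (*-identityʳ _))
                                      (*-congˡ (trans (*-congˡ (a-inverse t)) (*-identityʳ _))))) ⟩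
        lambertTerm t ∎

      reciprocal-theta : ∀ n → L ℕ.+ L ℕ.≤ n →
        prod (suc n) A ≈ (ρ∞ * ρ∞) * sum (suc n) lambertTerm
      reciprocal-theta n 2L≤n = begin
        prod (suc n) A
          ≈⟨ partial-fractions n ⟩
        sum (suc n) (λ t → (weight t * Q ^ t) * (A t * (ρ∸ n t * ρ (suc n ℕ.+ t))))
          ≈⟨ sum-cong (suc n) term ⟩
        sum (suc n) (λ t → (ρ∞ * ρ∞) * lambertTerm t)
          ≈⟨ sum-*ˡ (suc n) _ _ ⟨
        (ρ∞ * ρ∞) * sum (suc n) lambertTerm ∎
        where
        term : ∀ t → (weight t * Q ^ t) * (A t * (ρ∸ n t * ρ (suc n ℕ.+ t))) ≈ (ρ∞ * ρ∞) * lambertTerm t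
        term t = begin
          (weight t * Q ^ t) * (A t * (ρ∸ n t * ρ (suc n ℕ.+ t)))
            ≈⟨ solve 5 (λ w K a r s → (w :* K) :* (a :* (r :* s)) := (r :* K) :* (w :* (a :* s))) refl _ _ _ _ _ ⟩
          -- The Q^t in the coefficient supplies the nilpotent power that `ρ∸-limit` asks for.
          (ρ∸ n t * Q ^ t) * (weight t * (A t * ρ (suc n ℕ.+ t)))
            ≈⟨ *-cong (ρ∸-limit Q-nil t 2L≤n) (*-congˡ (*-congˡ (ρ-limit
                 (ℕP.≤-trans (ℕP.m≤m+n L L) (ℕP.≤-trans 2L≤n (ℕP.≤-trans (ℕP.n≤1+n n) (ℕP.m≤m+n (suc n) t))))))) ⟩
          (ρ∞ * Q ^ t) * (weight t * (A t * ρ∞))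
            ≈⟨ solve 4 (λ r K w a → (r :* K) :* (w :* (a :* r)) := (r :* r) :* ((w :* K) :* a)) refl _ _ _ _ ⟩
          (ρ∞ * ρ∞) * ((weight t * Q ^ t) * A t)
            ≈⟨ *-congˡ (weight-A t) ⟩
          (ρ∞ * ρ∞) * lambertTerm t ∎

      appell-lerch : ∀ n → L ℕ.+ L ℕ.≤ n →
        sum (suc n) (λ M → Q ^ (M ℕ.* suc M) * prod (suc M) A)
          ≈ ρ∞ * sum (suc n) (λ t → Q ^ (t ℕ.* suc t) * lambertTerm t)
      appell-lerch n 2L≤n = begin
        S                                ≈⟨ *-identityˡ S ⟨
        1# * S                           ≈⟨ *-congʳ (qfact-ρ∞ L≤n) ⟨
        (qfact n * ρ∞) * S               ≈⟨ *-assoc _ _ _ ⟩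
        qfact n * (ρ∞ * S)               ≈⟨ *-congˡ (trans (sum-*ˡ (suc n) _ _) (sum-cong (suc n) (λ M → sym (left M)))) ⟩
        qfact n * sum (suc n) (λ M → Q ^ (M ℕ.* suc M) * (ρ∸ n M * prod (suc M) A))
                                         ≈⟨ *-congˡ (finite-appell-lerch n) ⟩
        qfact n * sum (suc n) (λ t → ((weight t * Q ^ t) * A t) * (Q ^ (t ℕ.* suc t) * (ρ∸ n t * ρ (suc n ℕ.+ t))))
                                         ≈⟨ *-congˡ (trans (sum-cong (suc n) right) (sym (sum-*ˡ (suc n) _ _))) ⟩
        qfact n * ((ρ∞ * ρ∞) * T)        ≈⟨ solve 3 (λ a r t → a :* ((r :* r) :* t) := (a :* r) :* (r :* t)) refl _ _ _ ⟩
        (qfact n * ρ∞) * (ρ∞ * T)        ≈⟨ *-congʳ (qfact-ρ∞ L≤n) ⟩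
        1# * (ρ∞ * T)                    ≈⟨ *-identityˡ _ ⟩
        ρ∞ * T                           ∎
        where
        L≤n : L ℕ.≤ n
        L≤n = ℕP.≤-trans (ℕP.m≤m+n L L) 2L≤n
        S T : Carrier
        S = sum (suc n) (λ M → Q ^ (M ℕ.* suc M) * prod (suc M) A)
        T = sum (suc n) (λ t → Q ^ (t ℕ.* suc t) * lambertTerm t)
        -- A factor Q^M is set aside so that `ρ∸-limit` can replace `ρ∸ n M` by `ρ∞`.
        square : ∀ M → Q ^ (M ℕ.* suc M) ≈ Q ^ M * Q ^ (M ℕ.* M)
        square M = trans (^-congʳ Q (ℕP.*-suc M M)) (^-homo-* Q M (M ℕ.* M))
        left : ∀ M → Q ^ (M ℕ.* suc M) * (ρ∸ n M * prod (suc M) A) ≈ ρ∞ * (Q ^ (M ℕ.* suc M) * prod (suc M) A)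
        left M = begin
          Q ^ (M ℕ.* suc M) * (ρ∸ n M * prod (suc M) A)        ≈⟨ *-congʳ (square M) ⟩
          (Q ^ M * Q ^ (M ℕ.* M)) * (ρ∸ n M * prod (suc M) A)  ≈⟨ solve 4 (λ a b c d → (a :* b) :* (c :* d) := (c :* a) :* (b :* d)) refl _ _ _ _ ⟩
          (ρ∸ n M * Q ^ M) * (Q ^ (M ℕ.* M) * prod (suc M) A)  ≈⟨ *-congʳ (ρ∸-limit Q-nil M 2L≤n) ⟩
          (ρ∞ * Q ^ M) * (Q ^ (M ℕ.* M) * prod (suc M) A)      ≈⟨ solve 4 (λ a b c d → (a :* b) :* (c :* d) := a :* ((b :* c) :* d)) refl _ _ _ _ ⟩
          ρ∞ * ((Q ^ M * Q ^ (M ℕ.* M)) * prod (suc M) A)      ≈⟨ *-congˡ (*-congʳ (square M)) ⟨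
          ρ∞ * (Q ^ (M ℕ.* suc M) * prod (suc M) A)            ∎
        right : ∀ t → ((weight t * Q ^ t) * A t) * (Q ^ (t ℕ.* suc t) * (ρ∸ n t * ρ (suc n ℕ.+ t)))
                        ≈ (ρ∞ * ρ∞) * (Q ^ (t ℕ.* suc t) * lambertTerm t)
        right t = begin
          ((weight t * Q ^ t) * A t) * (Q ^ (t ℕ.* suc t) * (ρ∸ n t * ρ (suc n ℕ.+ t)))
            ≈⟨ solve 6 (λ w K a e r s → ((w :* K) :* a) :* (e :* (r :* s)) := (r :* K) :* (w :* (a :* (e :* s)))) refl _ _ _ _ _ _ ⟩
          (ρ∸ n t * Q ^ t) * (weight t * (A t * (Q ^ (t ℕ.* suc t) * ρ (suc n ℕ.+ t))))
            ≈⟨ *-cong (ρ∸-limit Q-nil t 2L≤n) (*-congˡ (*-congˡ (*-congˡ (ρ-limit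
                 (ℕP.≤-trans L≤n (ℕP.≤-trans (ℕP.n≤1+n n) (ℕP.m≤m+n (suc n) t))))))) ⟩
          (ρ∞ * Q ^ t) * (weight t * (A t * (Q ^ (t ℕ.* suc t) * ρ∞)))
            ≈⟨ solve 5 (λ r K w a e → (r :* K) :* (w :* (a :* (e :* r))) := (r :* r) :* (e :* ((w :* K) :* a))) refl _ _ _ _ _ ⟩
          (ρ∞ * ρ∞) * (Q ^ (t ℕ.* suc t) * ((weight t * Q ^ t) * A t))
            ≈⟨ *-congˡ (*-congˡ (weight-A t)) ⟩
          (ρ∞ * ρ∞) * (Q ^ (t ℕ.* suc t) * lambertTerm t) ∎

-- Infinite products, theta series and classical product identities

module InfiniteProducts {c ℓ} (R : CommutativeRing c ℓ) (L : ℕ) where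
  open CommutativeRing R
  open QSeries R
  open IntegerSolver R
  open Truncated R L public
  open import Algebra.Properties.CommutativeSemiring.Exp commutativeSemiring using (^-distrib-*)
  open import Relation.Binary.Reasoning.Setoid setoid

  nil-* : ∀ {x} y → Nil x → Nil (x * y)
  nil-* {x} y nil = trans (^-distrib-* x y L) (trans (*-congʳ nil) (zeroˡ _))

  nil-cong : ∀ {x y} → x ≈ y → Nil x → Nil y
  nil-cong x≈y nil = trans (^-congˡ L (sym x≈y)) nil

  geom : Carrier → Carrier
  geom x = sum L (x ^_)

  geom-finite : ∀ x n → (1# - x) * sum n (x ^_) ≈ 1# - x ^ n
  geom-finite x zero    = trans (zeroʳ _) (sym (one-minus-zero refl))
  geom-finite x (suc n) = begin
    (1# - x) * (sum n (x ^_) + x ^ n)   ≈⟨ trans (distribˡ _ _ _) (+-congʳ (geom-finite x n)) ⟩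
    (1# - x ^ n) + (1# - x) * x ^ n     ≈⟨ solve 2 (λ x y → (:1 :- y) :+ (:1 :- x) :* y := :1 :- x :* y) refl x (x ^ n) ⟩
    1# - x * x ^ n                      ∎

  geom-inverse : ∀ {x} → Nil x → (1# - x) * geom x ≈ 1#
  geom-inverse {x} nil = begin
    (1# - x) * geom x   ≈⟨ geom-finite x L ⟩
    1# - x ^ L          ≈⟨ +-congˡ (-‿cong nil) ⟩
    1# - 0#             ≈⟨ solve 0 (:1 :- con (+ 0) := :1) refl ⟩
    1#                  ∎

  inverse-cancel : ∀ {a b x y} → a * b ≈ 1# → a * x ≈ a * y → x ≈ y
  inverse-cancel {a} {b} {x} {y} ab≈1 ax≈ay = begin
    x             ≈⟨ expand x ⟩
    b * (a * x)   ≈⟨ *-congˡ ax≈ay ⟩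
    b * (a * y)   ≈⟨ expand y ⟨
    y             ∎
    where
    expand : ∀ x → x ≈ b * (a * x)
    expand x = begin
      x             ≈⟨ *-identityˡ x ⟨
      1# * x        ≈⟨ *-congʳ ab≈1 ⟨
      (a * b) * x   ≈⟨ solve 3 (λ a b x → (a :* b) :* x := b :* (a :* x)) refl a b x ⟩
      b * (a * x)   ∎

  inverse-unique : ∀ {a b c} → a * b ≈ 1# → a * c ≈ 1# → b ≈ c
  inverse-unique ab≈1 ac≈1 = inverse-cancel ab≈1 (trans ab≈1 (sym ac≈1))

  prod-* : ∀ n f g → prod n (λ i → f i * g i) ≈ prod n f * prod n g
  prod-* zero    f g = sym (*-identityˡ 1#)
  prod-* (suc n) f g = trans (*-congʳ (prod-* n f g))
    (solve 4 (λ a b c d → (a :* b) :* (c :* d) := (a :* c) :* (b :* d)) refl _ _ _ _)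

  prod-one : ∀ n {f} → (∀ i → f i ≈ 1#) → prod n f ≈ 1#
  prod-one zero    h = refl
  prod-one (suc n) h = trans (*-cong (prod-one n h) (h n)) (*-identityˡ 1#)

  prod-inverse : ∀ n {f g} → (∀ i → f i * g i ≈ 1#) → prod n f * prod n g ≈ 1#
  prod-inverse n h = trans (sym (prod-* n _ _)) (prod-one n h)

  prod-swap : ∀ m n (f : ℕ → ℕ → Carrier) → prod m (λ i → prod n (λ j → f i j)) ≈ prod n (λ j → prod m (λ i → f i j))
  prod-swap zero    n f = sym (prod-one n (λ _ → refl))
  prod-swap (suc m) n f = trans (*-congʳ (prod-swap m n f)) (sym (prod-* n _ _))

  prod-split : ∀ m n f → prod (m ℕ.+ n) f ≈ prod m f * prod n (λ i → f (m ℕ.+ i))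
  prod-split m zero    f rewrite ℕP.+-identityʳ m = sym (*-identityʳ _)
  prod-split m (suc n) f rewrite ℕP.+-suc m n = trans (*-congʳ (prod-split m n f)) (*-assoc _ _ _)

  prod-block : ∀ d n f → prod (n ℕ.* d) f ≈ prod n (λ i → prod d (λ j → f (i ℕ.* d ℕ.+ j)))
  prod-block d zero    f = refl
  prod-block d (suc n) f = begin
    prod (d ℕ.+ n ℕ.* d) f   ≡⟨ ≡.cong (λ k → prod k f) (ℕP.+-comm d (n ℕ.* d)) ⟩
    prod (n ℕ.* d ℕ.+ d) f   ≈⟨ prod-split (n ℕ.* d) d f ⟩
    prod (n ℕ.* d) f * prod d (λ j → f (n ℕ.* d ℕ.+ j))   ≈⟨ *-congʳ (prod-block d n f) ⟩
    prod (suc n) (λ i → prod d (λ j → f (i ℕ.* d ℕ.+ j))) ∎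

  prod-limit : ∀ {f n} → (∀ i → L ℕ.≤ i → f i ≈ 1#) → L ℕ.≤ n → prod n f ≈ prod L f
  prod-limit {f} {n} h L≤n = begin
    prod n f                                            ≡⟨ ≡.cong (λ k → prod k f) (ℕP.m+[n∸m]≡n L≤n) ⟨
    prod (L ℕ.+ (n ℕ.∸ L)) f                            ≈⟨ prod-split L (n ℕ.∸ L) f ⟩
    prod L f * prod (n ℕ.∸ L) (λ i → f (L ℕ.+ i))       ≈⟨ *-congˡ (prod-one (n ℕ.∸ L) (λ i → h (L ℕ.+ i) (ℕP.m≤m+n L i))) ⟩
    prod L f * 1#                                       ≈⟨ *-identityʳ _ ⟩
    prod L f                                            ∎

  -- Φ ε p k m = (-ε p^k; p^m)_∞.
  Φ : Carrier → Carrier → ℕ → ℕ → Carrier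
  Φ ε p k m = prod L (λ i → 1# + ε * p ^ (k ℕ.+ i ℕ.* m))

  φ⁺ φ⁻ : Carrier → ℕ → ℕ → Carrier
  φ⁺ = Φ 1#
  φ⁻ = Φ (- 1#)

  Φ-limit : ∀ ε {p} → Nil p → ∀ k m {n} → L ℕ.≤ n →
    prod n (λ i → 1# + ε * p ^ (k ℕ.+ i ℕ.* suc m)) ≈ Φ ε p k (suc m)
  Φ-limit ε {p} nil k m = prod-limit (λ i L≤i →
    trans (+-congˡ (trans (*-congˡ (nil-power nil (ℕP.≤-trans L≤i
            (ℕP.≤-trans (ℕP.m≤m*n i (suc m)) (ℕP.m≤n+m (i ℕ.* suc m) k))))) (zeroʳ ε)))
          (+-identityʳ 1#))

  Φ-^ : ∀ ε p d k m → Φ ε (p ^ d) k m ≈ Φ ε p (d ℕ.* k) (d ℕ.* m)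
  Φ-^ ε p d k m = prod-cong L (λ i → +-congˡ (*-congˡ
    (trans (^-assocʳ p d (k ℕ.+ i ℕ.* m)) (^-congʳ p (exponent d k i m)))))
    where
    exponent : ∀ d k i m → d ℕ.* (k ℕ.+ i ℕ.* m) ≡ d ℕ.* k ℕ.+ i ℕ.* (d ℕ.* m)
    exponent = solve-∀

  Φ-split : ∀ ε {p} → Nil p → ∀ d k m →
    Φ ε p k (suc m) ≈ prod (suc d) (λ j → Φ ε p (k ℕ.+ j ℕ.* suc m) (suc d ℕ.* suc m))
  Φ-split ε {p} nil d k m = begin
    Φ ε p k (suc m)
      ≈⟨ Φ-limit ε nil k m (ℕP.m≤m*n L (suc d)) ⟨
    prod (L ℕ.* suc d) (λ i → 1# + ε * p ^ (k ℕ.+ i ℕ.* suc m))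
      ≈⟨ prod-block (suc d) L _ ⟩
    prod L (λ i → prod (suc d) (λ j → 1# + ε * p ^ (k ℕ.+ (i ℕ.* suc d ℕ.+ j) ℕ.* suc m)))
      ≈⟨ prod-swap L (suc d) _ ⟩
    prod (suc d) (λ j → prod L (λ i → 1# + ε * p ^ (k ℕ.+ (i ℕ.* suc d ℕ.+ j) ℕ.* suc m)))
      ≈⟨ prod-cong (suc d) (λ j → prod-cong L (λ i → +-congˡ (*-congˡ (^-congʳ p (exponent k i j d m))))) ⟩
    prod (suc d) (λ j → Φ ε p (k ℕ.+ j ℕ.* suc m) (suc d ℕ.* suc m)) ∎
    where
    exponent : ∀ k i j d m → k ℕ.+ (i ℕ.* suc d ℕ.+ j) ℕ.* suc m ≡ k ℕ.+ j ℕ.* suc m ℕ.+ i ℕ.* (suc d ℕ.* suc m)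
    exponent = solve-∀

  Φ-split₂ : ∀ ε {p} → Nil p → ∀ k m → Φ ε p k (suc m) ≈ Φ ε p k (2 ℕ.* suc m) * Φ ε p (k ℕ.+ suc m) (2 ℕ.* suc m)
  Φ-split₂ ε {p} nil k m = trans (Φ-split ε nil 1 k m)
    (*-cong (trans (*-identityˡ _) (reflexive (≡.cong (λ k → Φ ε p k (2 ℕ.* suc m)) (ℕP.+-identityʳ k))))
            (reflexive (≡.cong (λ j → Φ ε p (k ℕ.+ j) (2 ℕ.* suc m)) (ℕP.+-identityʳ (suc m)))))

  Φ-split₃ : ∀ ε {p} → Nil p → Φ ε p 1 1 ≈ (Φ ε p 1 3 * Φ ε p 2 3) * Φ ε p 3 3
  Φ-split₃ ε nil = trans (Φ-split ε nil 2 1 0) (*-congʳ (*-congʳ (*-identityˡ _)))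

  φ-conjugate : ∀ p k m → φ⁺ p k m * φ⁻ p k m ≈ φ⁻ p (2 ℕ.* k) (2 ℕ.* m)
  φ-conjugate p k m = trans (sym (prod-* L _ _)) (prod-cong L factor)
    where
    exponent : ∀ k i m → (k ℕ.+ i ℕ.* m) ℕ.+ (k ℕ.+ i ℕ.* m) ≡ 2 ℕ.* k ℕ.+ i ℕ.* (2 ℕ.* m)
    exponent = solve-∀
    factor : ∀ i → let z = p ^ (k ℕ.+ i ℕ.* m) in
      (1# + 1# * z) * (1# + - 1# * z) ≈ 1# + - 1# * p ^ (2 ℕ.* k ℕ.+ i ℕ.* (2 ℕ.* m))
    factor i = begin
      (1# + 1# * z) * (1# + - 1# * z)   ≈⟨ solve 1 (λ z → (:1 :+ :1 :* z) :* (:1 :+ :- :1 :* z) := :1 :+ :- :1 :* (z :* z)) refl z ⟩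
      1# + - 1# * (z * z)               ≈⟨ +-congˡ (*-congˡ (trans (sym (^-homo-* p e e)) (^-congʳ p (exponent k i m)))) ⟩
      1# + - 1# * p ^ (2 ℕ.* k ℕ.+ i ℕ.* (2 ℕ.* m)) ∎
      where
      e : ℕ
      e = k ℕ.+ i ℕ.* m
      z : Carrier
      z = p ^ e

  -- The sign comes from 1 + ε z = 1 - z (-ε); the nilpotent factor stands first to suit `nil-*`.
  Φ⁻¹ : Carrier → Carrier → ℕ → ℕ → Carrier
  Φ⁻¹ ε p k m = prod L (λ i → geom (p ^ (k ℕ.+ i ℕ.* m) * - ε))

  -- The positive exponent `suc k` makes every power of p in the product nilpotent, hence each
  -- factor a unit.
  Φ-inverse : ∀ ε {p} → Nil p → ∀ k m → Φ ε p (suc k) m * Φ⁻¹ ε p (suc k) m ≈ 1#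
  Φ-inverse ε {p} nil k m = prod-inverse L (λ i → trans
    (*-congʳ (solve 2 (λ e z → :1 :+ e :* z := :1 :- z :* :- e) refl ε _))
    (geom-inverse (nil-* (- ε) (nil-^ nil (k ℕ.+ i ℕ.* m)))))

  Φ-cancel : ∀ ε {p} → Nil p → ∀ k m {x y} → Φ ε p (suc k) m * x ≈ Φ ε p (suc k) m * y → x ≈ y
  Φ-cancel ε nil k m = inverse-cancel (Φ-inverse ε nil k m)

  expo : ℕ → ℕ → ℕ → ℕ
  expo a m k = k ℕ.* a ℕ.+ tri k ℕ.* m

  -- θ ε B p a b m is the sum over all integers k with -B < k ≤ B of ε^|k| p^{ka + mk(k-1)/2},
  -- for a + b = m.
  θ : Carrier → ℕ → Carrier → ℕ → ℕ → ℕ → Carrier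
  θ ε B p a b m = sum B (λ k → ε ^ suc k * p ^ expo a m (suc k)) + sum B (λ k → ε ^ k * p ^ expo b m k)

  θ⁺ θ⁻ : ℕ → Carrier → ℕ → ℕ → ℕ → Carrier
  θ⁺ = θ 1#
  θ⁻ = θ (- 1#)

  module PowerBase {p : Carrier} (nil : Nil p) (m-1 : ℕ) where
    m : ℕ
    m = suc m-1
    Q : Carrier
    Q = p ^ m
    Q-nil : Nil Q
    Q-nil = nil-^ nil m-1
    open Limit Q Q-nil (λ i → geom (Q ^ suc i)) (λ i → geom-inverse (nil-^ Q-nil i)) public

    power : ∀ k i → p ^ k * Q ^ i ≈ p ^ (k ℕ.+ i ℕ.* m)
    power k i = trans (*-congˡ (trans (^-assocʳ p m i) (^-congʳ p (ℕP.*-comm m i)))) (sym (^-homo-* p k (i ℕ.* m)))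

    factors-Φ : ∀ ε k {n} → L ℕ.≤ n → factors (ε * p ^ suc k) n ≈ Φ ε p (suc k) m
    factors-Φ ε k {n} L≤n = trans (prod-cong n (λ i → +-congˡ (trans (*-assoc _ _ _) (*-congˡ (power (suc k) i)))))
      (Φ-limit ε nil (suc k) m-1 L≤n)

    qfact-φ⁻ : ∀ {n} → L ℕ.≤ n → qfact n ≈ φ⁻ p m m
    qfact-φ⁻ {n} L≤n = trans (prod-cong n (λ i → +-congˡ (trans (solve 1 (λ z → :- z := :- :1 :* z) refl _) (*-congˡ (power m i)))))
      (Φ-limit (- 1#) nil m m-1 L≤n)

    ρ∞-Φ⁻¹ : ρ∞ ≈ Φ⁻¹ (- 1#) p m m
    ρ∞-Φ⁻¹ = inverse-unique (trans (*-congʳ (sym (qfact-φ⁻ ℕP.≤-refl))) (qfact-ρ∞ ℕP.≤-refl)) (Φ-inverse (- 1#) nil m-1 m)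

  -- The triple product at x = ε p^(a+1), y = ε p^(b+1). The condition on ε gives x y = p^m and
  -- covers the signed and the unsigned theta series together.
  product-θ : ∀ {ε p} → ε * ε ≈ 1# → Nil p → ∀ a b n → L ℕ.+ L ℕ.≤ n → let m = suc a ℕ.+ suc b in
    φ⁻ p m m * (Φ ε p (suc a) m * Φ ε p (suc b) m) ≈ θ ε (suc n) p (suc a) (suc b) m
  product-θ {ε} {p} ε²≈1 nil a b n 2L≤n = begin
    φ⁻ p m m * (Φ ε p (suc a) m * Φ ε p (suc b) m)
      ≈⟨ *-cong (qfact-φ⁻ L≤n) (*-cong (factors-Φ ε a L≤n) (factors-Φ ε b L≤n)) ⟨
    qfact n * (factors x n * factors y n)
      ≈⟨ jacobi-triple-product xy≈Q (nil-cong (*-comm _ ε) (nil-* ε (nil-^ nil a))) (nil-cong (*-comm _ ε) (nil-* ε (nil-^ nil b))) n 2L≤n ⟩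
    theta (suc n) x y
      ≈⟨ +-cong (sum-cong (suc n) (λ k → term (suc a) (suc k))) (sum-cong (suc n) (term (suc b))) ⟩
    θ ε (suc n) p (suc a) (suc b) m ∎
    where
    open PowerBase nil (a ℕ.+ suc b)
    x y : Carrier
    x = ε * p ^ suc a
    y = ε * p ^ suc b
    L≤n : L ℕ.≤ n
    L≤n = ℕP.≤-trans (ℕP.m≤m+n L L) 2L≤n
    xy≈Q : x * y ≈ Q
    xy≈Q = begin
      x * y                             ≈⟨ solve 3 (λ e u v → (e :* u) :* (e :* v) := (e :* e) :* (u :* v)) refl _ _ _ ⟩
      (ε * ε) * (p ^ suc a * p ^ suc b) ≈⟨ *-cong ε²≈1 (sym (^-homo-* p (suc a) (suc b))) ⟩
      1# * Q                            ≈⟨ *-identityˡ Q ⟩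
      Q                                 ∎
    term : ∀ k i → (ε * p ^ k) ^ i * Q ^ tri i ≈ ε ^ i * p ^ expo k m i
    term k i = begin
      (ε * p ^ k) ^ i * Q ^ tri i         ≈⟨ *-congʳ (trans (^-distrib-* ε (p ^ k) i) (*-congˡ (^-assocʳ p k i))) ⟩
      (ε ^ i * p ^ (k ℕ.* i)) * Q ^ tri i ≈⟨ *-assoc _ _ _ ⟩
      ε ^ i * (p ^ (k ℕ.* i) * Q ^ tri i) ≈⟨ *-congˡ (power (k ℕ.* i) (tri i)) ⟩
      ε ^ i * p ^ (k ℕ.* i ℕ.+ tri i ℕ.* m) ≡⟨ ≡.cong (λ e → ε ^ i * p ^ (e ℕ.+ tri i ℕ.* m)) (ℕP.*-comm k i) ⟩
      ε ^ i * p ^ expo k m i              ∎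

  module _ {p : Carrier} (nil : Nil p) where

    -- Euler's theorem on odd parts and distinct parts, obtained by multiplying with (p²;p²)_∞.
    euler : φ⁻ p 1 2 * φ⁺ p 1 1 ≈ 1#
    euler = Φ-cancel (- 1#) nil 1 2 (begin
      φ⁻ p 2 2 * (φ⁻ p 1 2 * φ⁺ p 1 1)   ≈⟨ solve 3 (λ a b c → a :* (b :* c) := c :* (b :* a)) refl _ _ _ ⟩
      φ⁺ p 1 1 * (φ⁻ p 1 2 * φ⁻ p 2 2)   ≈⟨ *-congˡ (Φ-split₂ (- 1#) nil 1 0) ⟨
      φ⁺ p 1 1 * φ⁻ p 1 1                ≈⟨ φ-conjugate p 1 1 ⟩
      φ⁻ p 2 2                           ≈⟨ *-identityʳ _ ⟨
      φ⁻ p 2 2 * 1#                      ∎)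

    -- Euler's theorem restricted to parts prime to 3: distinct ones against odd ones.
    euler₃ : (φ⁺ p 1 3 * φ⁺ p 2 3) * (φ⁻ p 1 6 * φ⁻ p 5 6) ≈ 1#
    euler₃ = Φ-cancel (- 1#) nil 1 6 (Φ-cancel (- 1#) nil 3 6 (begin
      φ⁻ p 4 6 * (φ⁻ p 2 6 * ((φ⁺ p 1 3 * φ⁺ p 2 3) * (φ⁻ p 1 6 * φ⁻ p 5 6)))
        ≈⟨ solve 6 (λ a b c d e f → a :* (b :* ((c :* d) :* (e :* f))) := (c :* (e :* a)) :* (d :* (b :* f))) refl _ _ _ _ _ _ ⟩
      (φ⁺ p 1 3 * (φ⁻ p 1 6 * φ⁻ p 4 6)) * (φ⁺ p 2 3 * (φ⁻ p 2 6 * φ⁻ p 5 6))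
        ≈⟨ *-cong (*-congˡ (Φ-split₂ (- 1#) nil 1 2)) (*-congˡ (Φ-split₂ (- 1#) nil 2 2)) ⟨
      (φ⁺ p 1 3 * φ⁻ p 1 3) * (φ⁺ p 2 3 * φ⁻ p 2 3)
        ≈⟨ *-cong (φ-conjugate p 1 3) (φ-conjugate p 2 3) ⟩
      φ⁻ p 2 6 * φ⁻ p 4 6
        ≈⟨ solve 2 (λ a b → a :* b := b :* (a :* :1)) refl _ _ ⟩
      φ⁻ p 4 6 * (φ⁻ p 2 6 * 1#) ∎))

    -- Gauss's formula for Σ (-1)^k p^(k²). Of the two factors (p;p²)_∞ in the triple product,
    -- `euler` removes one and the other completes (p²;p²)_∞ to (p;p)_∞.
    gauss : ∀ n → L ℕ.+ L ℕ.≤ n → θ⁻ (suc n) p 1 1 2 * φ⁺ p 1 1 ≈ φ⁻ p 1 1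
    gauss n 2L≤n = begin
      θ⁻ (suc n) p 1 1 2 * φ⁺ p 1 1
        ≈⟨ *-congʳ (product-θ (solve 0 (:- :1 :* :- :1 := :1) refl) nil 0 0 n 2L≤n) ⟨
      (φ⁻ p 2 2 * (φ⁻ p 1 2 * φ⁻ p 1 2)) * φ⁺ p 1 1
        ≈⟨ solve 3 (λ a b c → (a :* (b :* b)) :* c := (b :* a) :* (b :* c)) refl _ _ _ ⟩
      (φ⁻ p 1 2 * φ⁻ p 2 2) * (φ⁻ p 1 2 * φ⁺ p 1 1)
        ≈⟨ *-cong (sym (Φ-split₂ (- 1#) nil 1 0)) euler ⟩
      φ⁻ p 1 1 * 1#   ≈⟨ *-identityʳ _ ⟩
      φ⁻ p 1 1        ∎

  tri-double : ∀ t → tri t ℕ.* 2 ℕ.+ t ≡ t ℕ.* t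
  tri-double zero    = ≡.refl
  tri-double (suc t) = ≡.trans (step t (tri t)) (≡.trans (≡.cong (λ e → e ℕ.+ (t ℕ.+ suc t)) (tri-double t)) (square t))
    where
    step : ∀ t x → (t ℕ.+ x) ℕ.* 2 ℕ.+ suc t ≡ (x ℕ.* 2 ℕ.+ t) ℕ.+ (t ℕ.+ suc t)
    step = solve-∀
    square : ∀ t → t ℕ.* t ℕ.+ (t ℕ.+ suc t) ≡ suc t ℕ.* suc t
    square = solve-∀

  -- Only j = 9, from the series of ξ, and j = 3, from the reciprocal theta product, occur.
  Λ : ℕ → ℕ → Carrier → Carrier
  Λ j n q = sum (suc n) (λ t → (sgn t * q ^ (j ℕ.* (t ℕ.* suc t)))
    * (geom (q ^ (1 ℕ.+ t ℕ.* 6)) + q ^ (5 ℕ.+ t ℕ.* 6) * geom (q ^ (5 ℕ.+ t ℕ.* 6))))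

  -- The inverses are arbitrary since they arrive in two guises: as `geom` in `lambert-product`, and
  -- as the divisibility indicators `geomInv` in the coefficients of ξ.
  module BaseSix {q : Carrier} (nil : Nil q) (a b : ℕ → Carrier)
    (a-inverse : ∀ t → (1# - q ^ (1 ℕ.+ t ℕ.* 6)) * a t ≈ 1#)
    (b-inverse : ∀ t → (1# - q ^ (5 ℕ.+ t ℕ.* 6)) * b t ≈ 1#) where

    private
      module PB = PowerBase nil 5
      module PF = PB.PartialFractionsLimit (q ^ 1) (q ^ 5) (sym (^-homo-* q 1 5)) a b
        (λ t → trans (*-congʳ (+-congˡ (-‿cong (PB.power 1 t)))) (a-inverse t))
        (λ t → trans (*-congʳ (+-congˡ (-‿cong (PB.power 5 t)))) (b-inverse t))
    open PB using (Q; ρ∞; power)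

    lambertTerm-power : ∀ t → PF.lambertTerm t ≈ (sgn t * q ^ (3 ℕ.* (t ℕ.* suc t)))
      * (geom (q ^ (1 ℕ.+ t ℕ.* 6)) + q ^ (5 ℕ.+ t ℕ.* 6) * geom (q ^ (5 ℕ.+ t ℕ.* 6)))
    lambertTerm-power t = begin
      (sgn t * Q ^ tri t) * (Q ^ t * (a t + (q ^ 5 * Q ^ t) * b t))
        ≈⟨ solve 4 (λ s x y z → (s :* x) :* (y :* z) := (s :* (x :* y)) :* z) refl _ _ _ _ ⟩
      (sgn t * (Q ^ tri t * Q ^ t)) * (a t + (q ^ 5 * Q ^ t) * b t)
        ≈⟨ *-cong (*-congˡ (trans (sym (^-homo-* Q (tri t) t)) (trans (^-assocʳ q 6 (tri t ℕ.+ t)) (^-congʳ q exponent))))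
                  (+-cong (inverse-unique (a-inverse t) (geom-inverse (nil-^ nil (t ℕ.* 6))))
                          (*-cong (power 5 t) (inverse-unique (b-inverse t) (geom-inverse (nil-^ nil (4 ℕ.+ t ℕ.* 6)))))) ⟩
      (sgn t * q ^ (3 ℕ.* (t ℕ.* suc t)))
        * (geom (q ^ (1 ℕ.+ t ℕ.* 6)) + q ^ (5 ℕ.+ t ℕ.* 6) * geom (q ^ (5 ℕ.+ t ℕ.* 6))) ∎
      where
      rearrange : ∀ x t → 6 ℕ.* (x ℕ.+ t) ≡ 3 ℕ.* ((x ℕ.* 2 ℕ.+ t) ℕ.+ t)
      rearrange = solve-∀
      square : ∀ t → t ℕ.* t ℕ.+ t ≡ t ℕ.* suc t
      square = solve-∀
      exponent : 6 ℕ.* (tri t ℕ.+ t) ≡ 3 ℕ.* (t ℕ.* suc t)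
      exponent = ≡.trans (rearrange (tri t) t) (≡.cong (3 ℕ.*_) (≡.trans (≡.cong (ℕ._+ t) (tri-double t)) (square t)))

    appell-lerch-six : ∀ n → L ℕ.+ L ℕ.≤ n →
      sum (suc n) (λ M → q ^ (6 ℕ.* (M ℕ.* suc M)) * prod (suc M) (λ t → a t * b t)) ≈ Φ⁻¹ (- 1#) q 6 6 * Λ 9 n q
    appell-lerch-six n 2L≤n = begin
      sum (suc n) (λ M → q ^ (6 ℕ.* (M ℕ.* suc M)) * prod (suc M) (λ t → a t * b t))
        ≈⟨ sum-cong (suc n) (λ M → *-congʳ (^-assocʳ q 6 (M ℕ.* suc M))) ⟨
      sum (suc n) (λ M → Q ^ (M ℕ.* suc M) * prod (suc M) (λ t → a t * b t))
        ≈⟨ PF.appell-lerch n 2L≤n ⟩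
      ρ∞ * sum (suc n) (λ t → Q ^ (t ℕ.* suc t) * PF.lambertTerm t)
        ≈⟨ *-cong PB.ρ∞-Φ⁻¹ (sum-cong (suc n) term) ⟩
      Φ⁻¹ (- 1#) q 6 6 * Λ 9 n q ∎
      where
      -- The 9 in the exponent: 6t(t+1) comes from Q^(t(t+1)) and 3t(t+1) from Q^(t(t-1)/2) Q^t.
      exponent : ∀ z → 6 ℕ.* z ℕ.+ 3 ℕ.* z ≡ 9 ℕ.* z
      exponent = solve-∀
      term : ∀ t → Q ^ (t ℕ.* suc t) * PF.lambertTerm t ≈ (sgn t * q ^ (9 ℕ.* (t ℕ.* suc t)))
        * (geom (q ^ (1 ℕ.+ t ℕ.* 6)) + q ^ (5 ℕ.+ t ℕ.* 6) * geom (q ^ (5 ℕ.+ t ℕ.* 6)))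
      term t = begin
        Q ^ (t ℕ.* suc t) * PF.lambertTerm t
          ≈⟨ *-cong (^-assocʳ q 6 (t ℕ.* suc t)) (lambertTerm-power t) ⟩
        q ^ (6 ℕ.* (t ℕ.* suc t)) * ((sgn t * q ^ (3 ℕ.* (t ℕ.* suc t))) * _)
          ≈⟨ solve 4 (λ x s y z → x :* ((s :* y) :* z) := (s :* (x :* y)) :* z) refl _ _ _ _ ⟩
        (sgn t * (q ^ (6 ℕ.* (t ℕ.* suc t)) * q ^ (3 ℕ.* (t ℕ.* suc t)))) * _
          ≈⟨ *-congʳ (*-congˡ (trans (sym (^-homo-* q (6 ℕ.* (t ℕ.* suc t)) (3 ℕ.* (t ℕ.* suc t)))) (^-congʳ q (exponent (t ℕ.* suc t))))) ⟩
        (sgn t * q ^ (9 ℕ.* (t ℕ.* suc t))) * _ ∎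

    reciprocal-theta-six : ∀ n → L ℕ.+ L ℕ.≤ n →
      prod (suc n) (λ t → a t * b t) ≈ (Φ⁻¹ (- 1#) q 6 6 * Φ⁻¹ (- 1#) q 6 6) * Λ 3 n q
    reciprocal-theta-six n 2L≤n = trans (PF.reciprocal-theta n 2L≤n)
      (*-cong (*-cong PB.ρ∞-Φ⁻¹ PB.ρ∞-Φ⁻¹) (sum-cong (suc n) lambertTerm-power))

  -- `reciprocal-theta-six` read in reverse with denominators cleared: the product of all
  -- `a t * b t` inverts (q;q⁶)_∞ (q⁵;q⁶)_∞.
  lambert-product : ∀ {q} → Nil q → ∀ n → L ℕ.+ L ℕ.≤ n →
    (φ⁻ q 1 6 * φ⁻ q 5 6) * Λ 3 n q ≈ φ⁻ q 6 6 * φ⁻ q 6 6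
  lambert-product {q} nil n 2L≤n = begin
    (φ⁻ q 1 6 * φ⁻ q 5 6) * Λ 3 n q
      ≈⟨ *-congˡ (trans (*-congʳ (trans (*-cong unit unit) (*-identityˡ 1#))) (*-identityˡ _)) ⟨
    (φ⁻ q 1 6 * φ⁻ q 5 6) * (((φ⁻ q 6 6 * ψ) * (φ⁻ q 6 6 * ψ)) * Λ 3 n q)
      ≈⟨ solve 4 (λ x f p l → x :* (((f :* p) :* (f :* p)) :* l) := (f :* f) :* (x :* ((p :* p) :* l))) refl _ _ _ _ ⟩
    (φ⁻ q 6 6 * φ⁻ q 6 6) * ((φ⁻ q 1 6 * φ⁻ q 5 6) * ((ψ * ψ) * Λ 3 n q))
      ≈⟨ *-congˡ (*-congˡ (BaseSix.reciprocal-theta-six nil a b a-inverse b-inverse n 2L≤n)) ⟨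
    (φ⁻ q 6 6 * φ⁻ q 6 6) * ((φ⁻ q 1 6 * φ⁻ q 5 6) * prod (suc n) (λ t → a t * b t))
      ≈⟨ *-congˡ (*-congʳ (trans (prod-* (suc n) _ _) (*-cong (Φ-limit (- 1#) nil 1 5 L≤n) (Φ-limit (- 1#) nil 5 5 L≤n)))) ⟨
    (φ⁻ q 6 6 * φ⁻ q 6 6) * (prod (suc n) (λ i → (1# + - 1# * q ^ (1 ℕ.+ i ℕ.* 6)) * (1# + - 1# * q ^ (5 ℕ.+ i ℕ.* 6))) * prod (suc n) (λ t → a t * b t))
      ≈⟨ *-congˡ (prod-inverse (suc n) (λ t → trans
           (solve 4 (λ x y a b → ((:1 :+ :- :1 :* x) :* (:1 :+ :- :1 :* y)) :* (a :* b) := ((:1 :- x) :* a) :* ((:1 :- y) :* b)) refl _ _ _ _)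
           (trans (*-cong (a-inverse t) (b-inverse t)) (*-identityˡ 1#)))) ⟩
    (φ⁻ q 6 6 * φ⁻ q 6 6) * 1#
      ≈⟨ *-identityʳ _ ⟩
    φ⁻ q 6 6 * φ⁻ q 6 6 ∎
    where
    a b : ℕ → Carrier
    a t = geom (q ^ (1 ℕ.+ t ℕ.* 6))
    b t = geom (q ^ (5 ℕ.+ t ℕ.* 6))
    a-inverse : ∀ t → (1# - q ^ (1 ℕ.+ t ℕ.* 6)) * a t ≈ 1#
    a-inverse t = geom-inverse (nil-^ nil (t ℕ.* 6))
    b-inverse : ∀ t → (1# - q ^ (5 ℕ.+ t ℕ.* 6)) * b t ≈ 1#
    b-inverse t = geom-inverse (nil-^ nil (4 ℕ.+ t ℕ.* 6))
    ψ : Carrier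
    ψ = Φ⁻¹ (- 1#) q 6 6
    unit : φ⁻ q 6 6 * ψ ≈ 1#
    unit = Φ-inverse (- 1#) nil 5 6
    L≤n : L ℕ.≤ suc n
    L≤n = ℕP.≤-trans (ℕP.m≤m+n L L) (ℕP.≤-trans 2L≤n (ℕP.n≤1+n n))

-- Theta series and products modulo 4

FourVanishes : ∀ {c ℓ} → CommutativeRing c ℓ → Set ℓ
FourVanishes R = (1# + 1#) + (1# + 1#) ≈ 0#
  where open CommutativeRing R

module ModFour {c ℓ} (R : CommutativeRing c ℓ) (L : ℕ) (four≈0 : FourVanishes R) where
  open CommutativeRing R
  open QSeries R
  open IntegerSolver R
  open InfiniteProducts R L public
  open import Relation.Binary.Reasoning.Setoid setoid

  :2 : ∀ {n} → Polynomial n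
  :2 = :1 :+ :1

  2# : Carrier
  2# = 1# + 1#

  drop-four : ∀ x y → x + (2# + 2#) * y ≈ x
  drop-four x y = trans (+-congˡ (trans (*-congʳ four≈0) (zeroˡ y))) (+-identityʳ x)

  two-sign : ∀ k x → 2# * ((- 1#) ^ k * x) ≈ 2# * x
  two-sign zero    x = *-congˡ (*-identityˡ x)
  two-sign (suc k) x = begin
    2# * ((- 1# * (- 1#) ^ k) * x)   ≈⟨ drop-four _ _ ⟨
    2# * ((- 1# * (- 1#) ^ k) * x) + (2# + 2#) * ((- 1#) ^ k * x)
                                     ≈⟨ solve 2 (λ s x → :2 :* ((:- :1 :* s) :* x) :+ (:2 :+ :2) :* (s :* x) := :2 :* (s :* x)) refl _ _ ⟩
    2# * ((- 1#) ^ k * x)            ≈⟨ two-sign k x ⟩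
    2# * x                           ∎

  -- V p n, ϑ p n and U p n are truncations of Σ_{k≥1} p^{k²}, 1 + 2 Σ_{k≥1} p^{k²}
  -- and 1 + 2 Σ_{k≥1} (p^{k²} + p^{3k²}).
  V ϑ U : Carrier → ℕ → Carrier
  V p n = sum n (λ k → p ^ (suc k ℕ.* suc k))
  ϑ p n = 1# + 2# * V p n
  U p n = 1# + 2# * (V p n + V (p ^ 3) n)

  U-ϑ : ∀ p n → ϑ p n * ϑ (p ^ 3) n ≈ U p n
  U-ϑ p n = begin
    ϑ p n * ϑ (p ^ 3) n                                     ≈⟨ solve 2 (λ v w → (:1 :+ :2 :* v) :* (:1 :+ :2 :* w) := (:1 :+ :2 :* (v :+ w)) :+ (:2 :+ :2) :* (v :* w)) refl _ _ ⟩
    U p n + (2# + 2#) * (V p n * V (p ^ 3) n)               ≈⟨ drop-four _ _ ⟩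
    U p n                                                   ∎

  ϑ² : ∀ p n → ϑ p n * ϑ p n ≈ 1#
  ϑ² p n = begin
    ϑ p n * ϑ p n                                ≈⟨ solve 1 (λ v → (:1 :+ :2 :* v) :* (:1 :+ :2 :* v) := :1 :+ (:2 :+ :2) :* (v :+ v :* v)) refl _ ⟩
    1# + (2# + 2#) * (V p n + V p n * V p n)     ≈⟨ drop-four _ _ ⟩
    1#                                           ∎

  -- The indices k and -k pair up to a coefficient 2, under which the sign (-1)^k disappears modulo
  -- 4.
  ϑ-θ⁻ : ∀ {p} → Nil p → ∀ n → L ℕ.≤ n → θ⁻ (suc n) p 1 1 2 ≈ ϑ p n
  ϑ-θ⁻ {p} nil n L≤n = begin
    θ⁻ (suc n) p 1 1 2
      ≈⟨ +-cong (sum-cong (suc n) (λ k → term (suc k))) (sum-cong (suc n) term) ⟩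
    (sum n (λ k → h (suc k)) + h (suc n)) + sum (suc n) h
      -- The half with positive index runs to n + 1, the other only to n; the surplus term vanishes.
      ≈⟨ +-cong (+-congˡ h≈0) (sum-head n h) ⟩
    (sum n (λ k → h (suc k)) + 0#) + (1# * 1# + sum n (λ k → h (suc k)))
      ≈⟨ solve 1 (λ x → (x :+ con (+ 0)) :+ (:1 :* :1 :+ x) := :1 :+ :2 :* x) refl _ ⟩
    1# + 2# * sum n (λ k → h (suc k))
      ≈⟨ +-congˡ (trans (sum-*ˡ n 2# _) (trans (sum-cong n (λ k → two-sign (suc k) _)) (sym (sum-*ˡ n 2# _)))) ⟩
    ϑ p n ∎
    where
    h : ℕ → Carrier
    h k = (- 1#) ^ k * p ^ (k ℕ.* k)
    term : ∀ k → (- 1#) ^ k * p ^ expo 1 2 k ≈ h k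
    term k = *-congˡ (^-congʳ p (≡.trans (≡.cong (ℕ._+ tri k ℕ.* 2) (ℕP.*-identityʳ k))
      (≡.trans (ℕP.+-comm k _) (tri-double k))))
    h≈0 : h (suc n) ≈ 0#
    h≈0 = trans (*-congˡ (nil-power nil (ℕP.≤-trans L≤n (ℕP.≤-trans (ℕP.n≤1+n n) (ℕP.m≤m*n (suc n) (suc n)))))) (zeroʳ _)

  module _ {p : Carrier} (nil : Nil p) (n : ℕ) (2L≤n : L ℕ.+ L ℕ.≤ n) where
    private
      L≤n : L ℕ.≤ n
      L≤n = ℕP.≤-trans (ℕP.m≤m+n L L) 2L≤n
      Ω⁺ Ω⁻ : Carrier
      Ω⁺ = φ⁺ p 1 3 * φ⁺ p 2 3
      Ω⁻ = φ⁻ p 1 3 * φ⁻ p 2 3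

    ϑ-gauss : ϑ p n * φ⁺ p 1 1 ≈ φ⁻ p 1 1
    ϑ-gauss = trans (*-congʳ (sym (ϑ-θ⁻ nil n L≤n))) (gauss nil n 2L≤n)

    ϑ-gauss-cubed : ϑ (p ^ 3) n * φ⁺ p 3 3 ≈ φ⁻ p 3 3
    ϑ-gauss-cubed = begin
      ϑ (p ^ 3) n * φ⁺ p 3 3
        ≈⟨ *-cong (sym (ϑ-θ⁻ (nil-^ nil 2) n L≤n)) (sym (Φ-^ 1# p 3 1 1)) ⟩
      θ⁻ (suc n) (p ^ 3) 1 1 2 * φ⁺ (p ^ 3) 1 1
        ≈⟨ gauss (nil-^ nil 2) n 2L≤n ⟩
      φ⁻ (p ^ 3) 1 1   ≈⟨ Φ-^ (- 1#) p 3 1 1 ⟩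
      φ⁻ p 3 3         ∎

    U² : U p n * U p n ≈ 1#
    U² = begin
      U p n * U p n                                         ≈⟨ *-cong (U-ϑ p n) (U-ϑ p n) ⟨
      (ϑ p n * ϑ (p ^ 3) n) * (ϑ p n * ϑ (p ^ 3) n)         ≈⟨ solve 2 (λ a b → (a :* b) :* (a :* b) := (a :* a) :* (b :* b)) refl _ _ ⟩
      (ϑ p n * ϑ p n) * (ϑ (p ^ 3) n * ϑ (p ^ 3) n)         ≈⟨ *-cong (ϑ² p n) (ϑ² (p ^ 3) n) ⟩
      1# * 1#                                               ≈⟨ *-identityˡ 1# ⟩
      1#                                                    ∎

    -- Splitting (±p;p)_∞ modulo 3 in Gauss's formulas for p and p³ gives ϑ(p)/ϑ(p³) = Ω⁻/Ω⁺, and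
    -- ϑ(p³) is its own inverse, so the quotient is U.
    U-Ω : U p n * Ω⁺ ≈ Ω⁻
    U-Ω = Φ-cancel (- 1#) nil 2 3 (Φ-cancel 1# nil 2 3 (begin
      φ⁺ p 3 3 * (φ⁻ p 3 3 * (U p n * Ω⁺))
        ≈⟨ *-congˡ (*-cong (sym ϑ-gauss-cubed) (*-congʳ (sym (U-ϑ p n)))) ⟩
      φ⁺ p 3 3 * ((ϑ (p ^ 3) n * φ⁺ p 3 3) * ((ϑ p n * ϑ (p ^ 3) n) * Ω⁺))
        ≈⟨ solve 4 (λ f s t o → f :* ((s :* f) :* ((t :* s) :* o)) := (f :* (s :* s)) :* (t :* (o :* f))) refl _ _ _ _ ⟩
      (φ⁺ p 3 3 * (ϑ (p ^ 3) n * ϑ (p ^ 3) n)) * (ϑ p n * (Ω⁺ * φ⁺ p 3 3))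
        ≈⟨ *-cong (trans (*-congˡ (ϑ² (p ^ 3) n)) (*-identityʳ _)) (*-congˡ (sym (Φ-split₃ 1# nil))) ⟩
      φ⁺ p 3 3 * (ϑ p n * φ⁺ p 1 1)
        ≈⟨ *-congˡ (trans ϑ-gauss (Φ-split₃ (- 1#) nil)) ⟩
      φ⁺ p 3 3 * (Ω⁻ * φ⁻ p 3 3)
        ≈⟨ *-congˡ (*-comm _ _) ⟩
      φ⁺ p 3 3 * (φ⁻ p 3 3 * Ω⁻) ∎))

    -- Multiply `U-Ω` by (p³;p³)_∞; the triple product turns the two sides into the unsigned and the
    -- signed pentagonal series.
    U-pentagonal : U p n * θ⁺ (suc n) p 1 2 3 ≈ θ⁻ (suc n) p 1 2 3
    U-pentagonal = begin
      U p n * θ⁺ (suc n) p 1 2 3    ≈⟨ *-congˡ (product-θ (*-identityˡ 1#) nil 0 1 n 2L≤n) ⟨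
      U p n * (φ⁻ p 3 3 * Ω⁺)       ≈⟨ solve 3 (λ u f o → u :* (f :* o) := f :* (u :* o)) refl _ _ _ ⟩
      φ⁻ p 3 3 * (U p n * Ω⁺)       ≈⟨ *-congˡ U-Ω ⟩
      φ⁻ p 3 3 * Ω⁻                 ≈⟨ product-θ (solve 0 (:- :1 :* :- :1 := :1) refl) nil 0 1 n 2L≤n ⟩
      θ⁻ (suc n) p 1 2 3            ∎

    -- As U is its own inverse, `U-Ω` also gives U Ω⁻ = Ω⁺, whose inverse is known from `euler₃`.
    U-Ω⁻ : (U p n * Ω⁻) * (φ⁻ p 1 6 * φ⁻ p 5 6) ≈ 1#
    U-Ω⁻ = begin
      (U p n * Ω⁻) * (φ⁻ p 1 6 * φ⁻ p 5 6)           ≈⟨ *-congʳ (*-congˡ U-Ω) ⟨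
      (U p n * (U p n * Ω⁺)) * (φ⁻ p 1 6 * φ⁻ p 5 6) ≈⟨ *-congʳ (trans (sym (*-assoc _ _ _)) (trans (*-congʳ U²) (*-identityˡ _))) ⟩
      Ω⁺ * (φ⁻ p 1 6 * φ⁻ p 5 6)                     ≈⟨ euler₃ nil ⟩
      1#                                             ∎

  -- Multiplied by (q²;q²)_∞ (q;q⁶)_∞ (q⁵;q⁶)_∞, both sides become the square of (q⁶;q⁶)_∞. On the
  -- right, the triple product provides (-q;q⁶)_∞ (-q⁵;q⁶)_∞; with the conjugate factors these form
  -- products in p = q², to which `U-Ω⁻` applies.
  lambert-theta : ∀ {q} → Nil q → ∀ n → L ℕ.+ L ℕ.≤ n →
    Φ⁻¹ (- 1#) q 2 2 * Λ 3 n q ≈ U (q ^ 2) n * θ⁺ (suc n) q 1 5 6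
  lambert-theta {q} nil n 2L≤n = Φ-cancel (- 1#) nil 0 6 (Φ-cancel (- 1#) nil 4 6 (Φ-cancel (- 1#) nil 1 2 (trans left (sym right))))
    where
    p : Carrier
    p = q ^ 2
    p-nil : Nil p
    p-nil = nil-^ nil 1
    F : Carrier
    F = φ⁻ q 6 6
    F≈ : F ≈ φ⁻ p 3 3
    F≈ = sym (Φ-^ (- 1#) q 2 3 3)
    left : φ⁻ q 2 2 * (φ⁻ q 5 6 * (φ⁻ q 1 6 * (Φ⁻¹ (- 1#) q 2 2 * Λ 3 n q))) ≈ F * F
    left = begin
      φ⁻ q 2 2 * (φ⁻ q 5 6 * (φ⁻ q 1 6 * (Φ⁻¹ (- 1#) q 2 2 * Λ 3 n q)))
        ≈⟨ solve 5 (λ d x y c l → d :* (x :* (y :* (c :* l))) := (d :* c) :* ((y :* x) :* l)) refl _ _ _ _ _ ⟩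
      (φ⁻ q 2 2 * Φ⁻¹ (- 1#) q 2 2) * ((φ⁻ q 1 6 * φ⁻ q 5 6) * Λ 3 n q)
        ≈⟨ *-cong (Φ-inverse (- 1#) nil 1 2) (lambert-product nil n 2L≤n) ⟩
      1# * (F * F)   ≈⟨ *-identityˡ _ ⟩
      F * F          ∎
    right : φ⁻ q 2 2 * (φ⁻ q 5 6 * (φ⁻ q 1 6 * (U p n * θ⁺ (suc n) q 1 5 6))) ≈ F * F
    right = begin
      φ⁻ q 2 2 * (φ⁻ q 5 6 * (φ⁻ q 1 6 * (U p n * θ⁺ (suc n) q 1 5 6)))
        ≈⟨ *-congˡ (*-congˡ (*-congˡ (*-congˡ (product-θ (*-identityˡ 1#) nil 0 4 n 2L≤n)))) ⟨
      φ⁻ q 2 2 * (φ⁻ q 5 6 * (φ⁻ q 1 6 * (U p n * (F * (φ⁺ q 1 6 * φ⁺ q 5 6)))))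
        ≈⟨ solve 7 (λ d x y u f a b → d :* (x :* (y :* (u :* (f :* (a :* b))))) := ((u :* d) :* ((a :* y) :* (b :* x))) :* f) refl _ _ _ _ _ _ _ ⟩
      ((U p n * φ⁻ q 2 2) * ((φ⁺ q 1 6 * φ⁻ q 1 6) * (φ⁺ q 5 6 * φ⁻ q 5 6))) * F
        ≈⟨ *-congʳ (*-cong (*-congˡ (trans (sym (Φ-^ (- 1#) q 2 1 1)) (Φ-split₃ (- 1#) p-nil)))
             (*-cong (trans (φ-conjugate q 1 6) (sym (Φ-^ (- 1#) q 2 1 6))) (trans (φ-conjugate q 5 6) (sym (Φ-^ (- 1#) q 2 5 6))))) ⟩
      ((U p n * ((φ⁻ p 1 3 * φ⁻ p 2 3) * φ⁻ p 3 3)) * (φ⁻ p 1 6 * φ⁻ p 5 6)) * F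
        ≈⟨ solve 5 (λ u o g y f → ((u :* (o :* g)) :* y) :* f := (((u :* o) :* y) :* g) :* f) refl _ _ _ _ _ ⟩
      (((U p n * (φ⁻ p 1 3 * φ⁻ p 2 3)) * (φ⁻ p 1 6 * φ⁻ p 5 6)) * φ⁻ p 3 3) * F
        ≈⟨ *-congʳ (*-cong (U-Ω⁻ p-nil n 2L≤n) (sym F≈)) ⟩
      (1# * F) * F   ≈⟨ *-congʳ (*-identityˡ F) ⟩
      F * F          ∎

-- Sections modulo 3 and modulo 4

module Dissection {c ℓ} (R : CommutativeRing c ℓ) (L : ℕ) (four≈0 : FourVanishes R) where
  open CommutativeRing R
  open QSeries R
  open IntegerSolver R
  open ModFour R L four≈0 public
  open import Relation.Binary.Reasoning.Setoid setoid

  θ-^ : ∀ ε B p d a b m → θ ε B (p ^ d) a b m ≈ θ ε B p (d ℕ.* a) (d ℕ.* b) (d ℕ.* m)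
  θ-^ ε B p d a b m = +-cong (sum-cong B (λ k → term a (suc k))) (sum-cong B (term b))
    where
    exponent : ∀ d k a t m → d ℕ.* (k ℕ.* a ℕ.+ t ℕ.* m) ≡ k ℕ.* (d ℕ.* a) ℕ.+ t ℕ.* (d ℕ.* m)
    exponent = solve-∀
    term : ∀ a k → ε ^ k * (p ^ d) ^ expo a m k ≈ ε ^ k * p ^ expo (d ℕ.* a) (d ℕ.* m) k
    term a k = *-congˡ (trans (^-assocʳ p d (expo a m k)) (^-congʳ p (exponent d k a (tri k) m)))

  θ-extend : ∀ ε {p} → Nil p → ∀ a b m {B C} → L ℕ.≤ B → B ℕ.≤ C →
    θ ε B p (suc a) (suc b) m ≈ θ ε C p (suc a) (suc b) m
  θ-extend ε {p} nil a b m L≤B B≤C = +-cong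
    (sum-extend _ B≤C (λ k B≤k → vanish a (suc k) (ℕP.≤-trans B≤k (ℕP.n≤1+n k))))
    (sum-extend _ B≤C (vanish b))
    where
    vanish : ∀ a k → _ ℕ.≤ k → ε ^ k * p ^ expo (suc a) m k ≈ 0#
    vanish a k B≤k = trans (*-congˡ (nil-power nil (ℕP.≤-trans L≤B (ℕP.≤-trans B≤k
      (ℕP.≤-trans (ℕP.m≤m*n k (suc a)) (ℕP.m≤m+n _ (tri k ℕ.* m))))))) (zeroʳ _)

  V-extend : ∀ {p} → Nil p → ∀ {m n} → L ℕ.≤ m → m ℕ.≤ n → V p m ≈ V p n
  V-extend nil L≤m m≤n = sum-extend _ m≤n (λ k m≤k → nil-power nil
    (ℕP.≤-trans L≤m (ℕP.≤-trans m≤k (ℕP.≤-trans (ℕP.n≤1+n k) (ℕP.m≤m*n (suc k) (suc k))))))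

  sum-parity : ∀ n f → sum (n ℕ.* 2) f ≈ sum n (λ i → f (i ℕ.* 2)) + sum n (λ i → f (suc (i ℕ.* 2)))
  sum-parity zero    f = sym (+-identityʳ 0#)
  sum-parity (suc n) f = trans (+-congʳ (+-congʳ (sum-parity n f)))
    (solve 4 (λ a b c d → ((a :+ b) :+ c) :+ d := (a :+ c) :+ (b :+ d)) refl _ _ _ _)

  tri-even : ∀ i → tri (i ℕ.* 2) ≡ tri i ℕ.* 4 ℕ.+ i
  tri-even zero    = ≡.refl
  tri-even (suc i) = ≡.trans (≡.cong (λ t → suc (i ℕ.* 2) ℕ.+ (i ℕ.* 2 ℕ.+ t)) (tri-even i)) (step i (tri i))
    where
    step : ∀ i t → suc (i ℕ.* 2) ℕ.+ (i ℕ.* 2 ℕ.+ (t ℕ.* 4 ℕ.+ i)) ≡ (i ℕ.+ t) ℕ.* 4 ℕ.+ suc i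
    step = solve-∀

  -- `E` stands for f(q) ↦ f(q^m), known here only as a ring endomorphism with its value at q.
  module Substitution (E : Carrier → Carrier) (E-hom : IsRingHomomorphism rawRing rawRing E)
    (q : Carrier) (q-nil : Nil q) (m : ℕ) (E-q : E q ≈ q ^ m) where
    open IsRingHomomorphism E-hom using () renaming
      (⟦⟧-cong to E-cong; +-homo to E-+; *-homo to E-*; -‿homo to E-neg; 0#-homo to E-0; 1#-homo to E-1) public

    E-^ : ∀ x n → E (x ^ n) ≈ E x ^ n
    E-^ x zero    = E-1
    E-^ x (suc n) = trans (E-* _ _) (*-congˡ (E-^ x n))

    E-power : ∀ n → E (q ^ n) ≈ q ^ (m ℕ.* n)
    E-power n = trans (E-^ q n) (trans (^-congˡ n E-q) (^-assocʳ q m n))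

    shifted : ∀ k s r → k ≡ s ℕ.+ m ℕ.* r → q ^ k ≈ q ^ s * E (q ^ r)
    shifted k s r eq = trans (^-congʳ q eq) (trans (^-homo-* q s _) (*-congˡ (sym (E-power r))))

    E-sum : ∀ n f → E (sum n f) ≈ sum n (λ i → E (f i))
    E-sum zero    f = E-0
    E-sum (suc n) f = trans (E-+ _ _) (+-congʳ (E-sum n f))

    E-prod : ∀ n f → E (prod n f) ≈ prod n (λ i → E (f i))
    E-prod zero    f = E-1
    E-prod (suc n) f = trans (E-* _ _) (*-congʳ (E-prod n f))

    E-sgn : ∀ n → E (sgn n) ≈ sgn n
    E-sgn zero    = E-1
    E-sgn (suc n) = trans (E-neg _) (-‿cong (E-sgn n))

    geom-cong : ∀ {x y} → x ≈ y → geom x ≈ geom y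
    geom-cong x≈y = sum-cong L (λ i → ^-congˡ i x≈y)

    E-geom : ∀ x → E (geom x) ≈ geom (E x)
    E-geom x = trans (E-sum L _) (sum-cong L (E-^ x))

    E-Φ⁻¹ : ∀ k l → E (Φ⁻¹ (- 1#) q k l) ≈ Φ⁻¹ (- 1#) q (m ℕ.* k) (m ℕ.* l)
    E-Φ⁻¹ k l = trans (E-prod L _) (prod-cong L (λ i → trans (E-geom _) (geom-cong (trans (E-* _ _) (*-cong
      (trans (E-power (k ℕ.+ i ℕ.* l)) (^-congʳ q (exponent m k i l)))
      (trans (E-neg _) (-‿cong (trans (E-neg _) (-‿cong E-1)))))))))
      where
      exponent : ∀ m k i l → m ℕ.* (k ℕ.+ i ℕ.* l) ≡ m ℕ.* k ℕ.+ i ℕ.* (m ℕ.* l)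
      exponent = solve-∀

    -- The s-th section of x is f s: the coefficient of q^{mn+s} in x is that of q^n in f s.
    _HasSections_ : Carrier → (ℕ → Carrier) → Set ℓ
    x HasSections f = x ≈ sum m (λ s → q ^ s * E (f s))

  module SectionsModThree (E : Carrier → Carrier) (E-hom : IsRingHomomorphism rawRing rawRing E)
    (q : Carrier) (q-nil : Nil q) (E-q : E q ≈ q ^ 3) where
    open Substitution E E-hom q q-nil 3 E-q public

    -- 1/(1 - x) = (1 + x + x²)/(1 - x³) sorts the exponents of x by residue modulo 3.
    geom-cube : ∀ {x} → Nil x → geom x ≈ (1# + (x + x * x)) * geom (x ^ 3)
    geom-cube {x} nil = inverse-unique (geom-inverse nil) (begin
      (1# - x) * ((1# + (x + x * x)) * geom (x ^ 3))
        ≈⟨ solve 2 (λ x g → (:1 :- x) :* ((:1 :+ (x :+ x :* x)) :* g) := (:1 :- x :* (x :* (x :* :1))) :* g) refl x _ ⟩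
      (1# - x ^ 3) * geom (x ^ 3)
        ≈⟨ geom-inverse (nil-^ nil 2) ⟩
      1# ∎)

    -- The factors q^(9t(t+1)) and 1/(q⁶;q⁶)_∞ are already images under q ↦ q³, so only the
    -- geometric series are dissected. With x = q^(6t+1) and y = q^(6t+5), residue 0 arises from the
    -- 1 in 1 + x + x² and the y³ in y + y² + y³; these rebuild `Λ 3`, and the prefactor q moves
    -- them to section 1.
    Λ-sections : ∀ n → ∃ λ f → (q * (Φ⁻¹ (- 1#) q 6 6 * Λ 9 n q)) HasSections f
      × f 1 ≡ Φ⁻¹ (- 1#) q 2 2 * Λ 3 n q
    Λ-sections n = f , proof , ≡.refl
      where
      x y X Y w : ℕ → Carrier
      x t = q ^ (1 ℕ.+ t ℕ.* 6)
      y t = q ^ (5 ℕ.+ t ℕ.* 6)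
      X t = geom (x t)
      Y t = geom (y t)
      w t = sgn t * q ^ (3 ℕ.* (t ℕ.* suc t))
      G₀ G₁ G₂ : ℕ → Carrier
      G₀ t = w t * (X t + y t * Y t)
      G₁ t = w t * (q ^ (t ℕ.* 2) * X t + q ^ (3 ℕ.+ t ℕ.* 4) * Y t)
      G₂ t = w t * (q ^ (t ℕ.* 4) * X t + q ^ (1 ℕ.+ t ℕ.* 2) * Y t)
      C : Carrier
      C = Φ⁻¹ (- 1#) q 2 2
      f : ℕ → Carrier
      -- The prefactor q raises q² E(...) to q³ E(...), and q³ = E(q) puts a q inside.
      f 0 = q * (C * sum (suc n) G₂)
      f 1 = C * Λ 3 n q
      f _ = C * sum (suc n) G₁

      E-w : ∀ t → E (w t) ≈ sgn t * q ^ (9 ℕ.* (t ℕ.* suc t))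
      E-w t = trans (E-* _ _) (*-cong (E-sgn t) (trans (E-power (3 ℕ.* (t ℕ.* suc t))) (^-congʳ q (≡.sym (ℕP.*-assoc 3 3 (t ℕ.* suc t))))))

      E-x³ : ∀ k → E (geom (q ^ k)) ≈ geom ((q ^ k) ^ 3)
      E-x³ k = trans (E-geom _) (geom-cong (trans (E-power k) (trans (^-congʳ q (ℕP.*-comm 3 k)) (sym (^-assocʳ q k 3)))))

      E-combine : ∀ t a b → E (w t * (a * X t + b * Y t)) ≈ E (w t) * (E a * E (X t) + E b * E (Y t))
      E-combine t a b = trans (E-* _ _) (*-congˡ (trans (E-+ _ _) (+-cong (E-* _ _) (E-* _ _))))

      term : ∀ t → (sgn t * q ^ (9 ℕ.* (t ℕ.* suc t))) * (X t + y t * Y t) ≈ E (G₀ t) + (q * E (G₁ t) + (q * q) * E (G₂ t))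
      term t = begin
        (sgn t * q ^ (9 ℕ.* (t ℕ.* suc t))) * (X t + y t * Y t)
          ≈⟨ *-cong (sym (E-w t)) (+-cong (trans (geom-cube (nil-^ q-nil (t ℕ.* 6))) (*-congˡ (sym (E-x³ (1 ℕ.+ t ℕ.* 6)))))
               (*-congˡ (trans (geom-cube (nil-^ q-nil (4 ℕ.+ t ℕ.* 6))) (*-congˡ (sym (E-x³ (5 ℕ.+ t ℕ.* 6))))))) ⟩
        E (w t) * ((1# + (x t + x t * x t)) * E (X t) + y t * ((1# + (y t + y t * y t)) * E (Y t)))
          ≈⟨ solve 5 (λ w x y a b → w :* ((:1 :+ (x :+ x :* x)) :* a :+ y :* ((:1 :+ (y :+ y :* y)) :* b))
               := w :* ((a :+ (x :+ x :* x) :* a) :+ (y :* (y :* y) :+ (y :+ y :* y)) :* b)) refl _ _ _ _ _ ⟩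
        E (w t) * ((E (X t) + (x t + x t * x t) * E (X t)) + (y t * (y t * y t) + (y t + y t * y t)) * E (Y t))
          ≈⟨ *-congˡ (+-cong (+-congˡ (*-congʳ (+-cong x₁ x₂))) (*-congʳ (+-cong y₃ (+-cong y₁ y₂)))) ⟩
        E (w t) * ((E (X t) + (q ^ 1 * E (q ^ (t ℕ.* 2)) + q ^ 2 * E (q ^ (t ℕ.* 4))) * E (X t))
          + (q ^ 0 * E (y t) + (q ^ 2 * E (q ^ (1 ℕ.+ t ℕ.* 2)) + q ^ 1 * E (q ^ (3 ℕ.+ t ℕ.* 4)))) * E (Y t))
          ≈⟨ solve 9 (λ w a b q x₁ x₂ y₁ y₂ y₃ →
               w :* ((a :+ (q :* :1 :* x₁ :+ (q :* (q :* :1)) :* x₂) :* a) :+ (:1 :* y₃ :+ ((q :* (q :* :1)) :* y₁ :+ q :* :1 :* y₂)) :* b)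
               := w :* (a :+ y₃ :* b) :+ (q :* (w :* (x₁ :* a :+ y₂ :* b)) :+ (q :* q) :* (w :* (x₂ :* a :+ y₁ :* b))))
               refl _ _ _ _ _ _ _ _ _ ⟩
        E (w t) * (E (X t) + E (y t) * E (Y t))
          + (q * (E (w t) * (E (q ^ (t ℕ.* 2)) * E (X t) + E (q ^ (3 ℕ.+ t ℕ.* 4)) * E (Y t)))
          + (q * q) * (E (w t) * (E (q ^ (t ℕ.* 4)) * E (X t) + E (q ^ (1 ℕ.+ t ℕ.* 2)) * E (Y t))))
          ≈⟨ +-cong (trans (E-* _ _) (*-congˡ (trans (E-+ _ _) (+-congˡ (E-* _ _)))))
               (+-cong (*-congˡ (E-combine t _ _)) (*-congˡ (E-combine t _ _))) ⟨
        E (G₀ t) + (q * E (G₁ t) + (q * q) * E (G₂ t)) ∎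
        where
        e₁ : ∀ t → 1 ℕ.+ t ℕ.* 6 ≡ 1 ℕ.+ 3 ℕ.* (t ℕ.* 2)
        e₁ = solve-∀
        e₂ : ∀ t → (1 ℕ.+ t ℕ.* 6) ℕ.+ (1 ℕ.+ t ℕ.* 6) ≡ 2 ℕ.+ 3 ℕ.* (t ℕ.* 4)
        e₂ = solve-∀
        e₃ : ∀ t → 5 ℕ.+ t ℕ.* 6 ≡ 2 ℕ.+ 3 ℕ.* (1 ℕ.+ t ℕ.* 2)
        e₃ = solve-∀
        e₄ : ∀ t → (5 ℕ.+ t ℕ.* 6) ℕ.+ (5 ℕ.+ t ℕ.* 6) ≡ 1 ℕ.+ 3 ℕ.* (3 ℕ.+ t ℕ.* 4)
        e₄ = solve-∀
        e₅ : ∀ t → (5 ℕ.+ t ℕ.* 6) ℕ.+ ((5 ℕ.+ t ℕ.* 6) ℕ.+ (5 ℕ.+ t ℕ.* 6)) ≡ 0 ℕ.+ 3 ℕ.* (5 ℕ.+ t ℕ.* 6)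
        e₅ = solve-∀
        x₁ : x t ≈ q ^ 1 * E (q ^ (t ℕ.* 2))
        x₁ = shifted _ 1 (t ℕ.* 2) (e₁ t)
        x₂ : x t * x t ≈ q ^ 2 * E (q ^ (t ℕ.* 4))
        x₂ = trans (sym (^-homo-* q (1 ℕ.+ t ℕ.* 6) (1 ℕ.+ t ℕ.* 6))) (shifted _ 2 (t ℕ.* 4) (e₂ t))
        y₁ : y t ≈ q ^ 2 * E (q ^ (1 ℕ.+ t ℕ.* 2))
        y₁ = shifted _ 2 (1 ℕ.+ t ℕ.* 2) (e₃ t)
        y₂ : y t * y t ≈ q ^ 1 * E (q ^ (3 ℕ.+ t ℕ.* 4))
        y₂ = trans (sym (^-homo-* q (5 ℕ.+ t ℕ.* 6) (5 ℕ.+ t ℕ.* 6))) (shifted _ 1 (3 ℕ.+ t ℕ.* 4) (e₄ t))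
        y₃ : y t * (y t * y t) ≈ q ^ 0 * E (y t)
        y₃ = trans (*-congˡ (sym (^-homo-* q (5 ℕ.+ t ℕ.* 6) (5 ℕ.+ t ℕ.* 6))))
          (trans (sym (^-homo-* q (5 ℕ.+ t ℕ.* 6) _)) (shifted _ 0 (5 ℕ.+ t ℕ.* 6) (e₅ t)))

      Λ≈ : Λ 9 n q ≈ E (Λ 3 n q) + (q * E (sum (suc n) G₁) + (q * q) * E (sum (suc n) G₂))
      Λ≈ = begin
        Λ 9 n q
          ≈⟨ sum-cong (suc n) term ⟩
        sum (suc n) (λ t → E (G₀ t) + (q * E (G₁ t) + (q * q) * E (G₂ t)))
          ≈⟨ trans (sum-+ (suc n) _ _) (+-congˡ (sum-+ (suc n) _ _)) ⟩
        sum (suc n) (λ t → E (G₀ t)) + (sum (suc n) (λ t → q * E (G₁ t)) + sum (suc n) (λ t → (q * q) * E (G₂ t)))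
          ≈⟨ +-cong (sym (E-sum (suc n) G₀)) (+-cong
               (trans (sym (sum-*ˡ (suc n) _ _)) (*-congˡ (sym (E-sum (suc n) G₁))))
               (trans (sym (sum-*ˡ (suc n) _ _)) (*-congˡ (sym (E-sum (suc n) G₂))))) ⟩
        E (Λ 3 n q) + (q * E (sum (suc n) G₁) + (q * q) * E (sum (suc n) G₂)) ∎

      proof : (q * (Φ⁻¹ (- 1#) q 6 6 * Λ 9 n q)) HasSections f
      proof = begin
        q * (Φ⁻¹ (- 1#) q 6 6 * Λ 9 n q)
          ≈⟨ *-congˡ (*-cong (sym (E-Φ⁻¹ 2 2)) Λ≈) ⟩
        q * (E C * (E (Λ 3 n q) + (q * E (sum (suc n) G₁) + (q * q) * E (sum (suc n) G₂))))
          ≈⟨ solve 5 (λ q c a b d → q :* (c :* (a :+ (q :* b :+ (q :* q) :* d)))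
               := ((con (+ 0) :+ :1 :* ((q :* (q :* (q :* :1))) :* (c :* d))) :+ (q :* :1) :* (c :* a)) :+ (q :* (q :* :1)) :* (c :* b)) refl _ _ _ _ _ ⟩
        ((0# + 1# * (q ^ 3 * (E C * E (sum (suc n) G₂)))) + q ^ 1 * (E C * E (Λ 3 n q))) + q ^ 2 * (E C * E (sum (suc n) G₁))
          ≈⟨ +-cong (+-cong (+-congˡ (*-congˡ (trans (E-* _ _) (*-cong E-q (E-* _ _))))) (*-congˡ (E-* _ _))) (*-congˡ (E-* _ _)) ⟨
        sum 3 (λ s → q ^ s * E (f s)) ∎

  module SectionsModFour (E : Carrier → Carrier) (E-hom : IsRingHomomorphism rawRing rawRing E)
    (q : Carrier) (q-nil : Nil q) (E-q : E q ≈ q ^ 4) where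
    open Substitution E E-hom q q-nil 4 E-q public

    unshifted : ∀ k r → k ≡ 4 ℕ.* r → q ^ k ≈ E (q ^ r)
    unshifted k r eq = trans (^-congʳ q eq) (sym (E-power r))

    oddSquares : ℕ → ℕ → Carrier
    oddSquares d n = sum n (λ i → q ^ (d ℕ.* (i ℕ.* suc i)))

    -- Σ_{k≥1} q^{dk²} split by the parity of k; 4 divides (2i + 1)² - 1.
    V-sections : ∀ d n → L ℕ.≤ n →
      V (q ^ suc d) n ≈ E (V (q ^ suc d) n) + q ^ suc d * E (oddSquares (suc d) n)
    V-sections d n L≤n = begin
      V p n
        ≈⟨ V-extend (nil-^ q-nil d) L≤n (ℕP.m≤m*n n 2) ⟩
      V p (n ℕ.* 2)
        ≈⟨ sum-parity n _ ⟩
      sum n (λ i → p ^ (suc (i ℕ.* 2) ℕ.* suc (i ℕ.* 2))) + sum n (λ i → p ^ ((suc i ℕ.* 2) ℕ.* (suc i ℕ.* 2)))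
        ≈⟨ +-cong (sum-cong n odd) (sum-cong n even) ⟩
      sum n (λ i → p * E (q ^ (suc d ℕ.* (i ℕ.* suc i)))) + sum n (λ i → E (p ^ (suc i ℕ.* suc i)))
        ≈⟨ +-cong (trans (sym (sum-*ˡ n p _)) (*-congˡ (sym (E-sum n _)))) (sym (E-sum n _)) ⟩
      p * E (oddSquares (suc d) n) + E (V p n)
        ≈⟨ +-comm _ _ ⟩
      E (V p n) + p * E (oddSquares (suc d) n) ∎
      where
      p : Carrier
      p = q ^ suc d
      odd-exponent : ∀ d i → d ℕ.* (suc (i ℕ.* 2) ℕ.* suc (i ℕ.* 2)) ≡ d ℕ.+ 4 ℕ.* (d ℕ.* (i ℕ.* suc i))
      odd-exponent = solve-∀
      even-exponent : ∀ d j → d ℕ.* ((j ℕ.* 2) ℕ.* (j ℕ.* 2)) ≡ 4 ℕ.* (d ℕ.* (j ℕ.* j))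
      even-exponent = solve-∀
      odd : ∀ i → p ^ (suc (i ℕ.* 2) ℕ.* suc (i ℕ.* 2)) ≈ p * E (q ^ (suc d ℕ.* (i ℕ.* suc i)))
      odd i = trans (^-assocʳ q (suc d) (suc (i ℕ.* 2) ℕ.* suc (i ℕ.* 2))) (shifted _ (suc d) (suc d ℕ.* (i ℕ.* suc i)) (odd-exponent (suc d) i))
      even : ∀ i → p ^ ((suc i ℕ.* 2) ℕ.* (suc i ℕ.* 2)) ≈ E (p ^ (suc i ℕ.* suc i))
      even i = trans (^-assocʳ q (suc d) ((suc i ℕ.* 2) ℕ.* (suc i ℕ.* 2))) (trans (unshifted _ (suc d ℕ.* (suc i ℕ.* suc i)) (even-exponent (suc d) (suc i)))
        (E-cong (sym (^-assocʳ q (suc d) (suc i ℕ.* suc i)))))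

    -- Only the residues 0 and 2 appear: for odd k both 2k² and 6k² are 2 modulo 4, and q⁶ = q² E(q)
    -- brings the two odd parts together.
    U-sections : ∀ n → L ℕ.≤ n → let p = q ^ 2 in
      U p n ≈ E (U p n) + q ^ 2 * E (2# * (oddSquares 2 n + q * oddSquares 6 n))
    U-sections n L≤n = begin
      1# + 2# * (V p n + V (p ^ 3) n)
        ≈⟨ +-congˡ (*-congˡ (+-cong (V-sections 1 n L≤n) (trans p³ (trans (V-sections 5 n L≤n)
             (+-cong (E-cong (sym p³)) (*-congʳ (trans (^-homo-* q 2 4) (*-congˡ (sym E-q))))))))) ⟩
      1# + 2# * ((E (V p n) + q ^ 2 * E O₂) + (E (V (p ^ 3) n) + (q ^ 2 * E q) * E O₆))
        ≈⟨ solve 7 (λ t v x y w e z → :1 :+ t :* ((v :+ x :* y) :+ (w :+ (x :* e) :* z))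
             := (:1 :+ t :* (v :+ w)) :+ x :* (t :* (y :+ e :* z))) refl 2# (E (V p n)) (q ^ 2) (E O₂) (E (V (p ^ 3) n)) (E q) (E O₆) ⟩
      (1# + 2# * (E (V p n) + E (V (p ^ 3) n))) + q ^ 2 * (2# * (E O₂ + E q * E O₆))
        ≈⟨ +-cong (trans (E-+ _ _) (+-cong E-1 (trans (E-* _ _) (*-cong E-2 (E-+ _ _)))))
             (*-congˡ (trans (E-* _ _) (*-cong E-2 (trans (E-+ _ _) (+-congˡ (E-* _ _)))))) ⟨
      E (U p n) + q ^ 2 * E (2# * (O₂ + q * O₆)) ∎
      where
      p O₂ O₆ : Carrier
      p = q ^ 2
      O₂ = oddSquares 2 n
      O₆ = oddSquares 6 n
      p³ : V (p ^ 3) n ≈ V (q ^ 6) n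
      p³ = sum-cong n (λ k → ^-congˡ (suc k ℕ.* suc k) (^-assocʳ q 2 3))
      E-2 : E 2# ≈ 2#
      E-2 = trans (E-+ _ _) (+-cong E-1 E-1)

    -- Σ_k q^{3k²-2k} split by the parity of k.
    θ-sections : ∀ n → L ℕ.≤ n → θ⁺ n q 1 5 6 ≈ E (θ⁺ n q 2 4 6) + q * E (θ⁺ n q 1 5 6)
    θ-sections n L≤n = begin
      θ⁺ n q 1 5 6
        ≈⟨ θ-extend 1# q-nil 0 4 6 L≤n (ℕP.m≤m*n n 2) ⟩
      θ⁺ (n ℕ.* 2) q 1 5 6
        -- For odd k put k = 1 - 2j: then 3k² - 2k = 1 + 4(3j² - 2j), so the odd part reproduces the
        -- series. This substitution reverses the order and exchanges the two halves, whence `t 5`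
        -- appears in `odd₁` and `t 1` in `odd₂`.
        ≈⟨ +-cong (trans (sum-parity n _) (+-cong (sum-cong n odd₁) (sum-cong n even₁)))
                  (trans (sum-parity n _) (+-cong (sum-cong n even₂) (sum-cong n odd₂))) ⟩
      (sum n (λ i → q * E (t 5 i)) + sum n (λ i → E (t 2 (suc i))))
        + (sum n (λ i → E (t 4 i)) + sum n (λ i → q * E (t 1 (suc i))))
        ≈⟨ +-cong (+-cong (pull _) (sym (E-sum n _))) (+-cong (sym (E-sum n _)) (pull _)) ⟩
      (q * E (sum n (t 5)) + E (sum n (λ i → t 2 (suc i)))) + (E (sum n (t 4)) + q * E (sum n (λ i → t 1 (suc i))))
        ≈⟨ solve 5 (λ q a b c d → (q :* a :+ b) :+ (c :+ q :* d) := (b :+ c) :+ q :* (d :+ a)) refl _ _ _ _ _ ⟩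
      (E (sum n (λ i → t 2 (suc i))) + E (sum n (t 4))) + q * (E (sum n (λ i → t 1 (suc i))) + E (sum n (t 5)))
        ≈⟨ +-cong (E-+ _ _) (*-congˡ (E-+ _ _)) ⟨
      E (θ⁺ n q 2 4 6) + q * E (θ⁺ n q 1 5 6) ∎
      where
      t : ℕ → ℕ → Carrier
      t a k = 1# ^ k * q ^ expo a 6 k
      pull : ∀ g → sum n (λ i → q * E (g i)) ≈ q * E (sum n g)
      pull g = trans (sym (sum-*ˡ n q _)) (*-congˡ (sym (E-sum n g)))
      one-^ : ∀ k x → 1# ^ k * x ≈ x
      one-^ zero    x = *-identityˡ x
      one-^ (suc k) x = trans (*-congʳ (*-identityˡ _)) (one-^ k x)
      e₁ : ∀ i x → suc (i ℕ.* 2) ℕ.* 1 ℕ.+ (i ℕ.* 2 ℕ.+ (x ℕ.* 4 ℕ.+ i)) ℕ.* 6 ≡ 1 ℕ.+ 4 ℕ.* (i ℕ.* 5 ℕ.+ x ℕ.* 6)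
      e₁ = solve-∀
      e₂ : ∀ i x → (i ℕ.* 2) ℕ.* 1 ℕ.+ (x ℕ.* 4 ℕ.+ i) ℕ.* 6 ≡ 4 ℕ.* (i ℕ.* 2 ℕ.+ x ℕ.* 6)
      e₂ = solve-∀
      e₃ : ∀ i x → (i ℕ.* 2) ℕ.* 5 ℕ.+ (x ℕ.* 4 ℕ.+ i) ℕ.* 6 ≡ 4 ℕ.* (i ℕ.* 4 ℕ.+ x ℕ.* 6)
      e₃ = solve-∀
      e₄ : ∀ i x → suc (i ℕ.* 2) ℕ.* 5 ℕ.+ (i ℕ.* 2 ℕ.+ (x ℕ.* 4 ℕ.+ i)) ℕ.* 6
        ≡ 1 ℕ.+ 4 ℕ.* (suc i ℕ.* 1 ℕ.+ (i ℕ.+ x) ℕ.* 6)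
      e₄ = solve-∀
      odd₁ : ∀ i → t 1 (suc (i ℕ.* 2)) ≈ q * E (t 5 i)
      odd₁ i = trans (one-^ (suc (i ℕ.* 2)) _) (trans
        (shifted _ 1 (expo 5 6 i) (≡.trans (≡.cong (λ x → suc (i ℕ.* 2) ℕ.* 1 ℕ.+ (i ℕ.* 2 ℕ.+ x) ℕ.* 6) (tri-even i)) (e₁ i (tri i))))
        (*-cong (*-identityʳ q) (E-cong (sym (one-^ i _)))))
      even₁ : ∀ i → t 1 (suc i ℕ.* 2) ≈ E (t 2 (suc i))
      even₁ i = trans (one-^ (suc i ℕ.* 2) _) (trans
        (unshifted _ (expo 2 6 (suc i)) (≡.trans (≡.cong (λ x → (suc i ℕ.* 2) ℕ.* 1 ℕ.+ x ℕ.* 6) (tri-even (suc i))) (e₂ (suc i) (tri (suc i)))))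
        (E-cong (sym (one-^ (suc i) _))))
      even₂ : ∀ i → t 5 (i ℕ.* 2) ≈ E (t 4 i)
      even₂ i = trans (one-^ (i ℕ.* 2) _) (trans
        (unshifted _ (expo 4 6 i) (≡.trans (≡.cong (λ x → (i ℕ.* 2) ℕ.* 5 ℕ.+ x ℕ.* 6) (tri-even i)) (e₃ i (tri i))))
        (E-cong (sym (one-^ i _))))
      odd₂ : ∀ i → t 5 (suc (i ℕ.* 2)) ≈ q * E (t 1 (suc i))
      odd₂ i = trans (one-^ (suc (i ℕ.* 2)) _) (trans
        (shifted _ 1 (expo 1 6 (suc i)) (≡.trans (≡.cong (λ x → suc (i ℕ.* 2) ℕ.* 5 ℕ.+ (i ℕ.* 2 ℕ.+ x) ℕ.* 6) (tri-even i)) (e₄ i (tri i))))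
        (*-cong (*-identityʳ q) (E-cong (sym (one-^ (suc i) _)))))

    -- The residues 0, 2 of U and 0, 1 of the theta series sum to each residue modulo 4 exactly
    -- once, so every section is a single product.
    Uθ-sections : ∀ n → L ℕ.+ L ℕ.≤ n → ∃ λ f → (U (q ^ 2) n * θ⁺ (suc n) q 1 5 6) HasSections f
      × f 0 ≈ θ⁻ (suc n) q 2 4 6
      × f 1 ≡ U (q ^ 2) n * θ⁺ (suc n) q 1 5 6
    Uθ-sections n 2L≤n = f , proof , f₀ , ≡.refl
      where
      L≤n : L ℕ.≤ n
      L≤n = ℕP.≤-trans (ℕP.m≤m+n L L) 2L≤n
      W₀ W₁ O : Carrier
      W₀ = θ⁺ (suc n) q 2 4 6
      W₁ = θ⁺ (suc n) q 1 5 6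
      O = 2# * (oddSquares 2 n + q * oddSquares 6 n)
      f : ℕ → Carrier
      f 0 = U (q ^ 2) n * W₀
      f 1 = U (q ^ 2) n * W₁
      f 2 = O * W₀
      f _ = O * W₁
      f₀ : f 0 ≈ θ⁻ (suc n) q 2 4 6
      f₀ = begin
        U (q ^ 2) n * θ⁺ (suc n) q 2 4 6             ≈⟨ *-congˡ (θ-^ 1# (suc n) q 2 1 2 3) ⟨
        U (q ^ 2) n * θ⁺ (suc n) (q ^ 2) 1 2 3       ≈⟨ U-pentagonal (nil-^ q-nil 1) n 2L≤n ⟩
        θ⁻ (suc n) (q ^ 2) 1 2 3                     ≈⟨ θ-^ (- 1#) (suc n) q 2 1 2 3 ⟩
        θ⁻ (suc n) q 2 4 6                           ∎
      proof : (U (q ^ 2) n * W₁) HasSections f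
      proof = begin
        U (q ^ 2) n * W₁
          ≈⟨ *-cong (U-sections n L≤n) (θ-sections (suc n) (ℕP.≤-trans L≤n (ℕP.n≤1+n n))) ⟩
        (E (U (q ^ 2) n) + q ^ 2 * E O) * (E W₀ + q * E W₁)
          ≈⟨ solve 5 (λ q u o a b → (u :+ (q :* (q :* :1)) :* o) :* (a :+ q :* b)
               := (((con (+ 0) :+ :1 :* (u :* a)) :+ (q :* :1) :* (u :* b)) :+ (q :* (q :* :1)) :* (o :* a)) :+ (q :* (q :* (q :* :1))) :* (o :* b)) refl _ _ _ _ _ ⟩
        (((0# + 1# * (E (U (q ^ 2) n) * E W₀)) + q ^ 1 * (E (U (q ^ 2) n) * E W₁)) + q ^ 2 * (E O * E W₀)) + q ^ 3 * (E O * E W₁)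
          ≈⟨ +-cong (+-cong (+-cong (+-congˡ (*-congˡ (E-* _ _))) (*-congˡ (E-* _ _))) (*-congˡ (E-* _ _))) (*-congˡ (E-* _ _)) ⟨
        sum 4 (λ s → q ^ s * E (f s)) ∎

-- Formal power series, dilation q ↦ q^m, and the truncated ring

module PowerSeries {c ℓ} (K : CommutativeRing c ℓ) where
  open CommutativeRing K
  open import Relation.Binary.Reasoning.Setoid setoid
  open IntegerSolver K
  open import Algebra.Properties.Ring ring using (-0#≈0#)
  open import Algebra.Properties.CommutativeSemigroup ℕP.+-commutativeSemigroup using (x∙yz≈y∙xz)

  PS : Set c
  PS = ℕ → Carrier

  -- The Cauchy product by recursion on the left factor, so that inductions shift f instead of
  -- reindexing finite sums.
  _⋆_ : PS → PS → PS
  (f ⋆ g) zero    = f 0 * g 0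
  (f ⋆ g) (suc n) = f 0 * g (suc n) + ((f ∘ suc) ⋆ g) n

  _⊕_ : PS → PS → PS
  (f ⊕ g) n = f n + g n

  ⊖_ : PS → PS
  (⊖ f) n = - f n

  𝟘 𝟙 q : PS
  𝟘 n = 0#
  𝟙 zero    = 1#
  𝟙 (suc n) = 0#
  q zero    = 0#
  q (suc n) = 𝟙 n

  ⋆-cong : ∀ {f f′ g g′} n → (∀ i → i ℕ.≤ n → f i ≈ f′ i) → (∀ i → i ℕ.≤ n → g i ≈ g′ i) → (f ⋆ g) n ≈ (f′ ⋆ g′) n
  ⋆-cong zero    hf hg = *-cong (hf 0 z≤n) (hg 0 z≤n)
  ⋆-cong (suc n) hf hg = +-cong (*-cong (hf 0 z≤n) (hg (suc n) ℕP.≤-refl))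
    (⋆-cong n (λ i i≤n → hf (suc i) (s≤s i≤n)) (λ i i≤n → hg i (ℕP.m≤n⇒m≤1+n i≤n)))

  ⋆-congˡ : ∀ {f f′} g → (∀ i → f i ≈ f′ i) → ∀ n → (f ⋆ g) n ≈ (f′ ⋆ g) n
  ⋆-congˡ g h n = ⋆-cong n (λ i _ → h i) (λ _ _ → refl)

  ⋆-congʳ : ∀ f {g g′} → (∀ i → g i ≈ g′ i) → ∀ n → (f ⋆ g) n ≈ (f ⋆ g′) n
  ⋆-congʳ f h n = ⋆-cong n (λ _ _ → refl) (λ i _ → h i)

  ⋆-last : ∀ f g n → (f ⋆ g) (suc n) ≈ f (suc n) * g 0 + (f ⋆ (g ∘ suc)) n
  ⋆-last f g zero    = +-comm _ _
  ⋆-last f g (suc n) = trans (+-congˡ (⋆-last (f ∘ suc) g n))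
    (solve 3 (λ a b c → a :+ (b :+ c) := b :+ (a :+ c)) refl _ _ _)

  ⋆-comm : ∀ f g n → (f ⋆ g) n ≈ (g ⋆ f) n
  ⋆-comm f g zero    = *-comm _ _
  ⋆-comm f g (suc n) = trans (+-cong (*-comm _ _) (⋆-comm (f ∘ suc) g n)) (sym (⋆-last g f n))

  ⋆-scaleˡ : ∀ x f g n → ((λ i → x * f i) ⋆ g) n ≈ x * (f ⋆ g) n
  ⋆-scaleˡ x f g zero    = *-assoc _ _ _
  ⋆-scaleˡ x f g (suc n) = trans (+-cong (*-assoc _ _ _) (⋆-scaleˡ x (f ∘ suc) g n)) (sym (distribˡ _ _ _))

  ⋆-distribʳ : ∀ h f g n → ((f ⊕ g) ⋆ h) n ≈ (f ⋆ h) n + (g ⋆ h) n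
  ⋆-distribʳ h f g zero    = distribʳ _ _ _
  ⋆-distribʳ h f g (suc n) = trans (+-cong (distribʳ _ _ _) (⋆-distribʳ h (f ∘ suc) (g ∘ suc) n))
    (solve 4 (λ a b c d → (a :+ b) :+ (c :+ d) := (a :+ c) :+ (b :+ d)) refl _ _ _ _)

  ⋆-distribˡ : ∀ h f g n → (h ⋆ (f ⊕ g)) n ≈ (h ⋆ f) n + (h ⋆ g) n
  ⋆-distribˡ h f g n = trans (⋆-comm h (f ⊕ g) n) (trans (⋆-distribʳ h f g n) (+-cong (⋆-comm f h n) (⋆-comm g h n)))

  ⋆-assoc : ∀ f g h n → ((f ⋆ g) ⋆ h) n ≈ (f ⋆ (g ⋆ h)) n
  ⋆-assoc f g h zero    = *-assoc _ _ _
  ⋆-assoc f g h (suc n) = begin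
    (f 0 * g 0) * h (suc n) + (((λ i → f 0 * g (suc i)) ⊕ ((f ∘ suc) ⋆ g)) ⋆ h) n
      ≈⟨ +-congˡ (⋆-distribʳ h (λ i → f 0 * g (suc i)) ((f ∘ suc) ⋆ g) n) ⟩
    (f 0 * g 0) * h (suc n) + (((λ i → f 0 * g (suc i)) ⋆ h) n + (((f ∘ suc) ⋆ g) ⋆ h) n)
      ≈⟨ +-congˡ (+-cong (⋆-scaleˡ (f 0) (g ∘ suc) h n) (⋆-assoc (f ∘ suc) g h n)) ⟩
    (f 0 * g 0) * h (suc n) + (f 0 * ((g ∘ suc) ⋆ h) n + ((f ∘ suc) ⋆ (g ⋆ h)) n)
      ≈⟨ solve 5 (λ a b c d e → (a :* b) :* c :+ (a :* d :+ e) := a :* (b :* c :+ d) :+ e) refl _ _ _ _ _ ⟩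
    f 0 * (g 0 * h (suc n) + ((g ∘ suc) ⋆ h) n) + ((f ∘ suc) ⋆ (g ⋆ h)) n ∎

  ⋆-zeroˡ : ∀ {f} g n → (∀ i → i ℕ.≤ n → f i ≈ 0#) → (f ⋆ g) n ≈ 0#
  ⋆-zeroˡ g zero    h = trans (*-congʳ (h 0 z≤n)) (zeroˡ _)
  ⋆-zeroˡ g (suc n) h = trans (+-cong (trans (*-congʳ (h 0 z≤n)) (zeroˡ _)) (⋆-zeroˡ g n (λ i i≤n → h (suc i) (s≤s i≤n)))) (+-identityʳ 0#)

  ⋆-identityˡ : ∀ f n → (𝟙 ⋆ f) n ≈ f n
  ⋆-identityˡ f zero    = *-identityˡ _
  ⋆-identityˡ f (suc n) = trans (+-cong (*-identityˡ _) (⋆-zeroˡ f n (λ _ _ → refl))) (+-identityʳ _)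

  ⋆-identityʳ : ∀ f n → (f ⋆ 𝟙) n ≈ f n
  ⋆-identityʳ f n = trans (⋆-comm f 𝟙 n) (⋆-identityˡ f n)

  ⋆-drop : ∀ j {f} g n → (∀ i → i ℕ.< j → f i ≈ 0#) → (f ⋆ g) (j ℕ.+ n) ≈ ((λ i → f (j ℕ.+ i)) ⋆ g) n
  ⋆-drop zero    g n h = refl
  ⋆-drop (suc j) g n h = trans (+-congʳ (trans (*-congʳ (h 0 (s≤s z≤n))) (zeroˡ _)))
    (trans (+-identityˡ _) (⋆-drop j g n (λ i i<j → h (suc i) (s≤s i<j))))

  -- Monomials whose coefficients compute; `q-power` identifies them with the powers of `q` in the
  -- truncated ring.
  q^_ : ℕ → PS
  (q^ zero)  n       = 𝟙 n
  (q^ suc e) zero    = 0#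
  (q^ suc e) (suc n) = (q^ e) n

  q^-< : ∀ e n → n ℕ.< e → (q^ e) n ≈ 0#
  q^-< (suc e) zero    _         = refl
  q^-< (suc e) (suc n) (s≤s n<e) = q^-< e n n<e

  q^-≥ : ∀ e n → (q^ e) (e ℕ.+ n) ≈ 𝟙 n
  q^-≥ zero    n = refl
  q^-≥ (suc e) n = q^-≥ e n

  q^-≢ : ∀ e n → e ≢ n → (q^ e) n ≈ 0#
  q^-≢ zero    zero    0≢0 = contradiction ≡.refl 0≢0
  q^-≢ zero    (suc n) _   = refl
  q^-≢ (suc e) zero    _   = refl
  q^-≢ (suc e) (suc n) e≢n = q^-≢ e n (e≢n ∘ ≡.cong suc)

  q^-≡ : ∀ n → (q^ n) n ≈ 1#
  q^-≡ zero    = refl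
  q^-≡ (suc n) = q^-≡ n

  q⋆q^ : ∀ e n → (q ⋆ (q^ e)) n ≈ (q^ suc e) n
  q⋆q^ e zero    = zeroˡ _
  q⋆q^ e (suc n) = trans (+-cong (zeroˡ _) (⋆-identityˡ (q^ e) n)) (+-identityˡ _)

  q^⋆-< : ∀ e f n → n ℕ.< e → ((q^ e) ⋆ f) n ≈ 0#
  q^⋆-< e f n n<e = ⋆-zeroˡ f n (λ i i≤n → q^-< e i (ℕP.≤-<-trans i≤n n<e))

  q^⋆-≥ : ∀ e f n → ((q^ e) ⋆ f) (e ℕ.+ n) ≈ f n
  q^⋆-≥ e f n = trans (⋆-drop e f n (q^-< e)) (trans (⋆-congˡ f (q^-≥ e) n) (⋆-identityˡ f n))

  module _ (m-1 : ℕ) where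
    private
      m : ℕ
      m = suc m-1

    pick : ℕ → Carrier → Carrier
    pick zero    x = x
    pick (suc _) x = 0#

    pick-cong : ∀ r {x y} → x ≈ y → pick r x ≈ pick r y
    pick-cong zero    x≈y = x≈y
    pick-cong (suc r) x≈y = refl

    -- dilate f = f(q^m)
    dilate : PS → PS
    dilate f n = pick (n % m) (f (n / m))

    dilate-at : ∀ f r n → r ℕ.< m → dilate f (r ℕ.+ n ℕ.* m) ≡ pick r (f n)
    dilate-at f r n r<m = ≡.cong₂ (λ r n → pick r (f n))
      (≡.trans (DivMod.[m+kn]%n≡m%n r n m) (DivMod.m<n⇒m%n≡m r<m))
      (≡.trans (DivMod.+-distrib-/-∣ʳ r (Divides.n∣m*n n)) (≡.cong₂ ℕ._+_ (DivMod.m<n⇒m/n≡0 r<m) (DivMod.m*n/n≡m n m)))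
      where import Data.Nat.Divisibility as Divides

    by-residue : ∀ {p} {P : ℕ → Set p} → (∀ r n → r ℕ.< m → P (r ℕ.+ n ℕ.* m)) → ∀ n → P n
    by-residue {P = P} h n = ≡.subst P (≡.sym (DivMod.m≡m%n+[m/n]*n n m)) (h (n % m) (n / m) (DivMod.m%n<n n m))

    dilate-drop : ∀ f n → dilate f (m ℕ.+ n) ≡ dilate (f ∘ suc) n
    dilate-drop f = by-residue (λ r n r<m → ≡.trans
      (≡.cong (dilate f) (x∙yz≈y∙xz m r (n ℕ.* m)))
      (≡.trans (dilate-at f r (suc n) r<m) (≡.sym (dilate-at (f ∘ suc) r n r<m))))

    dilate-low : ∀ f i → suc i ℕ.< m → dilate f (suc i) ≈ 0#
    dilate-low f i 1+i<m = reflexive (≡.trans (≡.cong (dilate f) (≡.sym (ℕP.+-identityʳ (suc i)))) (dilate-at f (suc i) 0 1+i<m))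

    -- Of the first m coefficients of `dilate f` only the one at 0 can be nonzero, and dropping them
    -- leaves `dilate (f ∘ suc)`; so induction on n follows the recursion of `⋆`. Both the
    -- multiplicativity of `dilate` and the extraction of sections rest on this.
    dilate-⋆ : ∀ f g r n → r ℕ.< m → (dilate f ⋆ g) (r ℕ.+ n ℕ.* m) ≈ (f ⋆ (λ k → g (r ℕ.+ k ℕ.* m))) n
    dilate-⋆ f g r zero    r<m = ≡.subst (λ k → (dilate f ⋆ g) k ≈ f 0 * g k) (≡.sym (ℕP.+-identityʳ r)) (at r r<m)
      where
      at : ∀ r → r ℕ.< m → (dilate f ⋆ g) r ≈ f 0 * g r
      at zero    _ = *-congʳ (reflexive (dilate-at f 0 0 (s≤s z≤n)))
      at (suc r) 1+r<m = trans (+-cong (*-congʳ (reflexive (dilate-at f 0 0 (s≤s z≤n))))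
        (⋆-zeroˡ g r (λ i i≤r → dilate-low f i (ℕP.≤-<-trans (s≤s i≤r) 1+r<m)))) (+-identityʳ _)
    dilate-⋆ f g r (suc n) r<m = begin
      (dilate f ⋆ g) (r ℕ.+ (m ℕ.+ n ℕ.* m))
        ≡⟨ ≡.cong (dilate f ⋆ g) (x∙yz≈y∙xz r m (n ℕ.* m)) ⟩
      dilate f 0 * g (m ℕ.+ (r ℕ.+ n ℕ.* m)) + ((dilate f ∘ suc) ⋆ g) (m-1 ℕ.+ (r ℕ.+ n ℕ.* m))
        ≈⟨ +-cong (*-cong (reflexive (dilate-at f 0 0 (s≤s z≤n))) (reflexive (≡.cong g (x∙yz≈y∙xz m r (n ℕ.* m)))))
             (⋆-drop m-1 g (r ℕ.+ n ℕ.* m) (λ i i<m-1 → dilate-low f i (s≤s i<m-1))) ⟩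
      f 0 * g (r ℕ.+ suc n ℕ.* m) + ((λ i → dilate f (m ℕ.+ i)) ⋆ g) (r ℕ.+ n ℕ.* m)
        ≈⟨ +-congˡ (trans (⋆-congˡ g (λ i → reflexive (dilate-drop f i)) (r ℕ.+ n ℕ.* m)) (dilate-⋆ (f ∘ suc) g r n r<m)) ⟩
      (f ⋆ (λ k → g (r ℕ.+ k ℕ.* m))) (suc n) ∎

    pick-⋆ : ∀ r f g n → pick r ((f ⋆ g) n) ≈ (f ⋆ (λ k → pick r (g k))) n
    pick-⋆ zero    f g n = refl
    pick-⋆ (suc r) f g n = sym (trans (⋆-comm f 𝟘 n) (⋆-zeroˡ f n (λ _ _ → refl)))

    dilate-homo-⋆ : ∀ f g n → dilate (f ⋆ g) n ≈ (dilate f ⋆ dilate g) n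
    dilate-homo-⋆ f g = by-residue (λ r n r<m → begin
      dilate (f ⋆ g) (r ℕ.+ n ℕ.* m)                        ≡⟨ dilate-at (f ⋆ g) r n r<m ⟩
      pick r ((f ⋆ g) n)                                    ≈⟨ pick-⋆ r f g n ⟩
      (f ⋆ (λ k → pick r (g k))) n                          ≈⟨ ⋆-congʳ f (λ k → reflexive (dilate-at g r k r<m)) n ⟨
      (f ⋆ (λ k → dilate g (r ℕ.+ k ℕ.* m))) n              ≈⟨ dilate-⋆ f (dilate g) r n r<m ⟨
      (dilate f ⋆ dilate g) (r ℕ.+ n ℕ.* m)                 ∎)

    pick-+ : ∀ r x y → pick r (x + y) ≈ pick r x + pick r y
    pick-+ zero    x y = refl
    pick-+ (suc r) x y = sym (+-identityʳ 0#)

    pick-neg : ∀ r x → pick r (- x) ≈ - pick r x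
    pick-neg zero    x = refl
    pick-neg (suc r) x = sym -0#≈0#

    pick-0 : ∀ r → pick r 0# ≈ 0#
    pick-0 zero    = refl
    pick-0 (suc r) = refl

    pick-𝟙 : ∀ r n → pick r (𝟙 n) ≈ 𝟙 (r ℕ.+ n ℕ.* m)
    pick-𝟙 zero    zero    = refl
    pick-𝟙 zero    (suc n) = refl
    pick-𝟙 (suc r) n       = refl

    dilate-𝟙 : ∀ n → dilate 𝟙 n ≈ 𝟙 n
    dilate-𝟙 = by-residue (λ r n r<m → trans (reflexive (dilate-at 𝟙 r n r<m)) (pick-𝟙 r n))

    dilate-q : ∀ n → dilate q n ≈ (q^ m) n
    dilate-q = by-residue (λ r n r<m → trans (reflexive (dilate-at q r n r<m)) (value r n r<m))
      where
      value : ∀ r n → r ℕ.< m → pick r (q n) ≈ (q^ m) (r ℕ.+ n ℕ.* m)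
      value r zero    r<m = trans (pick-0 r) (sym (trans (reflexive (≡.cong (q^ m) (ℕP.+-identityʳ r))) (q^-< m r r<m)))
      value r (suc n) r<m = trans (pick-𝟙 r n) (sym (trans
        (reflexive (≡.cong (q^ m) (x∙yz≈y∙xz r m (n ℕ.* m)))) (q^-≥ m (r ℕ.+ n ℕ.* m))))

    section : ∀ s f r n → s ℕ.< m → r ℕ.< m → ((q^ s) ⋆ dilate f) (r ℕ.+ n ℕ.* m) ≈ (f ⋆ (λ k → (q^ s) (r ℕ.+ k ℕ.* m))) n
    section s f r n s<m r<m = trans (⋆-comm (q^ s) (dilate f) (r ℕ.+ n ℕ.* m)) (dilate-⋆ f (q^ s) r n r<m)

    section-≡ : ∀ f r n → r ℕ.< m → ((q^ r) ⋆ dilate f) (r ℕ.+ n ℕ.* m) ≈ f n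
    section-≡ f r n r<m = trans (section r f r n r<m r<m) (trans (⋆-congʳ f value n) (⋆-identityʳ f n))
      where
      value : ∀ k → (q^ r) (r ℕ.+ k ℕ.* m) ≈ 𝟙 k
      value zero    = q^-≥ r 0
      value (suc k) = q^-≥ r (suc k ℕ.* m)

    section-≢ : ∀ f s r n → s ℕ.< m → r ℕ.< m → s ≢ r → ((q^ s) ⋆ dilate f) (r ℕ.+ n ℕ.* m) ≈ 0#
    section-≢ f s r n s<m r<m s≢r = trans (section s f r n s<m r<m)
      (trans (⋆-congʳ f value n) (trans (⋆-comm f 𝟘 n) (⋆-zeroˡ f n (λ _ _ → refl))))
      where
      value : ∀ k → (q^ s) (r ℕ.+ k ℕ.* m) ≈ 0#
      value zero    = q^-≢ s _ (λ s≡r → s≢r (≡.trans s≡r (ℕP.+-identityʳ r)))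
      value (suc k) = q^-≢ s _ (ℕP.<⇒≢ (ℕP.<-≤-trans s<m (ℕP.≤-trans (ℕP.m≤m+n m (k ℕ.* m)) (ℕP.m≤n+m _ r))))

  module _ (L : ℕ) where

    -- Power series modulo q^L, with full sequences as elements: only the equality is truncated.
    truncated : CommutativeRing c ℓ
    truncated = record
      { Carrier = PS
      ; _≈_ = λ f g → ∀ n → n ℕ.< L → f n ≈ g n
      ; _+_ = _⊕_
      ; _*_ = _⋆_
      ; -_ = ⊖_
      ; 0# = 𝟘
      ; 1# = 𝟙
      ; isCommutativeRing = record
        { isRing = record
          { +-isAbelianGroup = record
            { isGroup = record
              { isMonoid = record
                { isSemigroup = record
                  { isMagma = record
                    { isEquivalence = record
                      { refl = λ n _ → refl
                      ; sym = λ f≈g n n<L → sym (f≈g n n<L)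
                      ; trans = λ f≈g g≈h n n<L → trans (f≈g n n<L) (g≈h n n<L) }
                    ; ∙-cong = λ f≈f′ g≈g′ n n<L → +-cong (f≈f′ n n<L) (g≈g′ n n<L) }
                  ; assoc = λ f g h n _ → +-assoc _ _ _ }
                ; identity = (λ f n _ → +-identityˡ _) , (λ f n _ → +-identityʳ _) }
              ; inverse = (λ f n _ → -‿inverseˡ _) , (λ f n _ → -‿inverseʳ _)
              ; ⁻¹-cong = λ f≈g n n<L → -‿cong (f≈g n n<L) }
            ; comm = λ f g n _ → +-comm _ _ }
          ; *-cong = λ f≈f′ g≈g′ n n<L → ⋆-cong n (λ i i≤n → f≈f′ i (ℕP.≤-<-trans i≤n n<L)) (λ i i≤n → g≈g′ i (ℕP.≤-<-trans i≤n n<L))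
          ; *-assoc = λ f g h n _ → ⋆-assoc f g h n
          ; *-identity = (λ f n _ → ⋆-identityˡ f n) , (λ f n _ → ⋆-identityʳ f n)
          ; distrib = (λ h f g n _ → ⋆-distribˡ h f g n) , (λ h f g n _ → ⋆-distribʳ h f g n) }
        ; *-comm = λ f g n _ → ⋆-comm f g n } }

    private
      module T = CommutativeRing truncated

    dilate-isRingHomomorphism : ∀ m-1 → IsRingHomomorphism T.rawRing T.rawRing (dilate m-1)
    dilate-isRingHomomorphism m-1 = record
      { isSemiringHomomorphism = record
        { isNearSemiringHomomorphism = record
          { +-isMonoidHomomorphism = record
            { isMagmaHomomorphism = record
              { isRelHomomorphism = record
                { cong = λ f≈g n n<L → pick-cong m-1 (n % m) (f≈g (n / m) (ℕP.≤-<-trans (DivMod.m/n≤m n m) n<L)) }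
              ; homo = λ f g n _ → pick-+ m-1 (n % m) _ _ }
            ; ε-homo = λ n _ → pick-0 m-1 (n % m) }
          ; *-homo = λ f g n _ → dilate-homo-⋆ m-1 f g n }
        ; 1#-homo = λ n _ → dilate-𝟙 m-1 n }
      ; -‿homo = λ f n _ → pick-neg m-1 (n % m) _ }
      where
      m : ℕ
      m = suc m-1

    open import Algebra.Properties.Semiring.Exp T.semiring using (_^_)

    q-power : ∀ e → q ^ e T.≈ (q^ e)
    q-power zero    n _   = refl
    q-power (suc e) n n<L = trans (T.*-congˡ {q} (q-power e) n n<L) (q⋆q^ e n)

    q-nil : q ^ L T.≈ T.0#
    q-nil n n<L = trans (q-power L n n<L) (q^-< L n n<L)

    dilate-q-power : ∀ m-1 → dilate m-1 q T.≈ q ^ suc m-1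
    dilate-q-power m-1 n n<L = trans (dilate-q m-1 n) (sym (q-power (suc m-1) n n<L))

    open FiniteSums truncated using (sum)

    sum-at : ∀ n f k → sum n f k ≈ FiniteSums.sum K n (λ i → f i k)
    sum-at zero    f k = refl
    sum-at (suc n) f k = +-congʳ (sum-at n f k)

  open FiniteSums K using () renaming (sum to ∑; sum-zero to ∑-zero) public

  ∑-single : ∀ n g r → r ℕ.< n → (∀ i → i ℕ.< n → i ≢ r → g i ≈ 0#) → ∑ n g ≈ g r
  ∑-single (suc n) g r r<1+n h with r ℕP.≟ n
  ... | yes ≡.refl = trans (+-congʳ (∑-zero n (λ i i<n → h i (ℕP.m≤n⇒m≤1+n i<n) (ℕP.<⇒≢ i<n)))) (+-identityˡ _)
  ... | no r≢n = trans (+-cong (∑-single n g r (ℕP.≤∧≢⇒< (ℕP.≤-pred r<1+n) r≢n) (λ i i<n → h i (ℕP.m≤n⇒m≤1+n i<n)))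
                   (h n ℕP.≤-refl (λ n≡r → r≢n (≡.sym n≡r)))) (+-identityʳ _)

-- The integers modulo N

module IntegersModulo (N : ℤ) where
  -- A record, so that x and y can be inferred from x ≈ y.
  record _≈_ (x y : ℤ) : Set where
    constructor congruent
    field divides-difference : N ℤDiv.∣ x ℤ.- y
  open _≈_ public

  ≈-reflexive : ∀ {x y} → x ≡ y → x ≈ y
  ≈-reflexive {x} ≡.refl = congruent (≡.subst (N ℤDiv.∣_) (≡.sym (ℤP.+-inverseʳ x)) (divides (+ 0) ≡.refl))

  via : ∀ {x y z} → x ℤ.- y ≡ z → N ℤDiv.∣ z → x ≈ y
  via x-y≡z N∣z = congruent (≡.subst (N ℤDiv.∣_) (≡.sym x-y≡z) N∣z)

  ≈-sym : ∀ {x y} → x ≈ y → y ≈ x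
  ≈-sym {x} {y} (congruent h) = via (identity x y) (ℤDiv.∣m⇒∣-m h)
    where
    identity : ∀ x y → y ℤ.- x ≡ ℤ.- (x ℤ.- y)
    identity = ℤSolver.solve-∀

  ≈-trans : ∀ {x y z} → x ≈ y → y ≈ z → x ≈ z
  ≈-trans {x} {y} {z} (congruent h) (congruent k) = via (identity x y z) (ℤDiv.∣m∣n⇒∣m+n h k)
    where
    identity : ∀ x y z → x ℤ.- z ≡ (x ℤ.- y) ℤ.+ (y ℤ.- z)
    identity = ℤSolver.solve-∀

  +-cong : ∀ {x y u v} → x ≈ y → u ≈ v → (x ℤ.+ u) ≈ (y ℤ.+ v)
  +-cong {x} {y} {u} {v} (congruent h) (congruent k) = via (identity x y u v) (ℤDiv.∣m∣n⇒∣m+n h k)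
    where
    identity : ∀ x y u v → (x ℤ.+ u) ℤ.- (y ℤ.+ v) ≡ (x ℤ.- y) ℤ.+ (u ℤ.- v)
    identity = ℤSolver.solve-∀

  *-cong : ∀ {x y u v} → x ≈ y → u ≈ v → (x ℤ.* u) ≈ (y ℤ.* v)
  *-cong {x} {y} {u} {v} (congruent h) (congruent k) =
    via (identity x y u v) (ℤDiv.∣m∣n⇒∣m+n (ℤDiv.∣m⇒∣m*n u h) (ℤDiv.∣n⇒∣m*n y k))
    where
    identity : ∀ x y u v → (x ℤ.* u) ℤ.- (y ℤ.* v) ≡ (x ℤ.- y) ℤ.* u ℤ.+ y ℤ.* (u ℤ.- v)
    identity = ℤSolver.solve-∀

  -‿cong : ∀ {x y} → x ≈ y → (ℤ.- x) ≈ (ℤ.- y)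
  -‿cong {x} {y} (congruent h) = via (identity x y) (ℤDiv.∣m⇒∣-m h)
    where
    identity : ∀ x y → (ℤ.- x) ℤ.- (ℤ.- y) ≡ ℤ.- (x ℤ.- y)
    identity = ℤSolver.solve-∀

  commutativeRing : CommutativeRing 0ℓ 0ℓ
  commutativeRing = record
    { Carrier = ℤ
    ; _≈_ = _≈_
    ; _+_ = ℤ._+_
    ; _*_ = ℤ._*_
    ; -_ = ℤ.-_
    ; 0# = + 0
    ; 1# = + 1
    ; isCommutativeRing = record
      { isRing = record
        { +-isAbelianGroup = record
          { isGroup = record
            { isMonoid = record
              { isSemigroup = record
                { isMagma = record
                  { isEquivalence = record
                    { refl = ≈-reflexive ≡.refl
                    ; sym = ≈-sym
                    ; trans = ≈-trans }
                  ; ∙-cong = +-cong }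
                ; assoc = λ x y z → ≈-reflexive (ℤP.+-assoc x y z) }
              ; identity = (λ x → ≈-reflexive (ℤP.+-identityˡ x)) , (λ x → ≈-reflexive (ℤP.+-identityʳ x)) }
            ; inverse = (λ x → ≈-reflexive (ℤP.+-inverseˡ x)) , (λ x → ≈-reflexive (ℤP.+-inverseʳ x))
            ; ⁻¹-cong = -‿cong }
          ; comm = λ x y → ≈-reflexive (ℤP.+-comm x y) }
        ; *-cong = *-cong
        ; *-assoc = λ x y z → ≈-reflexive (ℤP.*-assoc x y z)
        ; *-identity = (λ x → ≈-reflexive (ℤP.*-identityˡ x)) , (λ x → ≈-reflexive (ℤP.*-identityʳ x))
        ; distrib = (λ x y z → ≈-reflexive (ℤP.*-distribˡ-+ x y z)) , (λ x y z → ≈-reflexive (ℤP.*-distribʳ-+ x y z)) }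
      ; *-comm = λ x y → ≈-reflexive (ℤP.*-comm x y) } }

-- From the coefficients of ξ to power series modulo 4

ℤ/4 : CommutativeRing 0ℓ 0ℓ
ℤ/4 = IntegersModulo.commutativeRing (+ 4)

module ℤ/4 = CommutativeRing ℤ/4
module PS = PowerSeries ℤ/4
open PS using (_⋆_; q^_; 𝟙)
open FiniteSums ℤ/4 using () renaming (sum to ∑; sum-extend to ∑-extend; sum-cong to ∑-cong)

embed : (ℕ → ℕ) → ℕ → ℤ
embed f n = + f n

sumTo-head : ∀ n f → sumTo (suc n) f ≡ f 0 ℕ.+ sumTo n (f ∘ suc)
sumTo-head zero    f = ≡.refl
sumTo-head (suc n) f = ≡.trans (≡.cong (ℕ._+ f (suc (suc n))) (sumTo-head n f)) (ℕP.+-assoc (f 0) _ _)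

embed-⊛ : ∀ f g n → embed (f ⊛ g) n ≡ (embed f ⋆ embed g) n
embed-⊛ f g zero    = ℤP.pos-* (f 0) (g 0)
embed-⊛ f g (suc n) = ≡.trans (≡.cong +_ (sumTo-head n (λ i → f i ℕ.* g (suc n ℕ.∸ i))))
  (≡.cong₂ ℤ._+_ (ℤP.pos-* (f 0) (g (suc n))) (embed-⊛ (f ∘ suc) g n))

embed-sumTo : ∀ n f → + sumTo n f ≡ ∑ (suc n) (λ i → + f i)
embed-sumTo zero    f = ≡.refl
embed-sumTo (suc n) f = ≡.cong (ℤ._+ (+ f (suc n))) (embed-sumTo n f)

embed-one : ∀ n → embed one n ≡ 𝟙 n
embed-one zero    = ≡.refl
embed-one (suc n) = ≡.refl

embed-shift : ∀ e f n → embed (shift e f) n ℤ/4.≈ ((q^ e) ⋆ embed f) n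
embed-shift e f n with e ≤? n
... | yes e≤n = ℤ/4.sym (≡.subst (λ k → ((q^ e) ⋆ embed f) k ℤ/4.≈ + f (n ℕ.∸ e)) (ℕP.m+[n∸m]≡n e≤n) (PS.q^⋆-≥ e (embed f) (n ℕ.∸ e)))
... | no e≰n  = ℤ/4.sym (PS.q^⋆-< e (embed f) n (ℕP.≰⇒> e≰n))

-- Together with `geomInv-<`: multiplication by 1 - q^a leaves only the constant term.
geomInv-+ : ∀ a n → geomInv a (a ℕ.+ n) ≡ geomInv a n
geomInv-+ a n with a ℕDiv.∣? (a ℕ.+ n) | a ℕDiv.∣? n
... | yes _ | yes _ = ≡.refl
... | no _  | no _  = ≡.refl
... | yes a∣a+n | no a∤n = contradiction (ℕDiv.∣m+n∣m⇒∣n a∣a+n ℕDiv.∣-refl) a∤n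
... | no a∤a+n | yes a∣n = contradiction (ℕDiv.∣m∣n⇒∣m+n ℕDiv.∣-refl a∣n) a∤a+n

geomInv-< : ∀ a n → n ℕ.< a → embed (geomInv a) n ≡ 𝟙 n
geomInv-< a zero    _ with a ℕDiv.∣? 0
... | yes _  = ≡.refl
... | no a∤0 = contradiction (a ℕDiv.∣0) a∤0
geomInv-< a (suc n) n<a with a ℕDiv.∣? suc n
... | yes a∣n = contradiction a∣n (ℕDiv.>⇒∤ n<a)
... | no _    = ≡.refl

-- Resolves the truncated subtraction and exhibits the exponent as one factor q times Q^(M(M+1)),
-- the weight summed in `appell-lerch`.
xiExponent : ∀ M → 6 ℕ.* suc M ℕ.* suc M ℕ.∸ 6 ℕ.* suc M ℕ.+ 1 ≡ suc (6 ℕ.* (M ℕ.* suc M))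
xiExponent M = ≡.trans (≡.cong (λ e → e ℕ.∸ 6 ℕ.* suc M ℕ.+ 1) (ℕP.*-suc (6 ℕ.* suc M) M))
  (≡.trans (≡.cong (ℕ._+ 1) (ℕP.m+n∸m≡n (6 ℕ.* suc M) (6 ℕ.* suc M ℕ.* M))) (rearrange M))
  where
  rearrange : ∀ M → 6 ℕ.* suc M ℕ.* M ℕ.+ 1 ≡ suc (6 ℕ.* (M ℕ.* suc M))
  rearrange = solve-∀

truncated-four≈0 : ∀ L → FourVanishes (PS.truncated L)
truncated-four≈0 L zero    _ = IntegersModulo.congruent (divides (+ 1) ≡.refl)
truncated-four≈0 L (suc n) _ = IntegersModulo.congruent (divides (+ 0) ≡.refl)

xiSum : ℕ → ℤ
xiSum N = + sumTo N (λ i → xiTerm (suc i) N)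

pξ-xiSum : ∀ m → + pξ (suc m) ≡ + 2 ℤ.* xiSum (suc m)
pξ-xiSum m = ℤP.pos-* 2 (sumTo (suc m) (λ i → xiTerm (suc i) (suc m)))

-- Twice the generalised pentagonal number, since the pentagonal series is taken at q².
pentagonal : ℤ → ℤ
pentagonal k = k ℤ.* (+ 3 ℤ.* k ℤ.- + 1)

-- The difference of the values is (k - l)(3(k + l) - 1), whose second factor is nonzero as 3 does
-- not divide 1. Hence at most one term of the theta series meets a given exponent.
pentagonal-injective : ∀ {k l} → pentagonal k ≡ pentagonal l → k ≡ l
pentagonal-injective {k} {l} eq
  with ℤP.i*j≡0⇒i≡0∨j≡0 (k ℤ.- l) (≡.trans (≡.sym (difference k l)) (ℤP.i≡j⇒i-j≡0 eq))
  where
  difference : ∀ k l → k ℤ.* (+ 3 ℤ.* k ℤ.- + 1) ℤ.- l ℤ.* (+ 3 ℤ.* l ℤ.- + 1) ≡ (k ℤ.- l) ℤ.* (+ 3 ℤ.* (k ℤ.+ l) ℤ.- + 1)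
  difference = ℤSolver.solve-∀
... | inj₁ k-l≡0 = ℤP.i-j≡0⇒i≡j k l k-l≡0
... | inj₂ 3x-1≡0 = contradiction (ℤDiv.∣⇒∣ᵤ (divides (k ℤ.+ l)
        (≡.trans (≡.sym (ℤP.i-j≡0⇒i≡j _ (+ 1) 3x-1≡0)) (ℤP.*-comm (+ 3) (k ℤ.+ l))))) (ℕDiv.>⇒∤ (s≤s (s≤s z≤n)))

-- The coefficient of q^n in (q²;q²)_∞ as a relation: its constructors are the two cases of the
-- theorem, so each congruence is proved once for both.
data PentagonalCoefficient (n : ℕ) : ℤ → Set where
  at-pentagonal : ∀ k → + n ≡ pentagonal k → PentagonalCoefficient n ((ℤ.- + 1) ℤ.^ ℤ.∣ k ∣)
  otherwise     : ¬ ∃ (λ k → + n ≡ pentagonal k) → PentagonalCoefficient n (+ 0)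

-- Coefficients of ξ at precision L

module XiModFour (L n₀ : ℕ) (2L≤n₀ : L ℕ.+ L ℕ.≤ n₀) where

  T : CommutativeRing 0ℓ 0ℓ
  T = PS.truncated L

  open CommutativeRing T
  open QSeries T using (_^_; sum; prod; sum-*ˡ; sum-cong; tri)
  open IntegerSolver T
  open Dissection T L (truncated-four≈0 L)

  q : Carrier
  q = PS.q
  q-nil : Nil q
  q-nil = PS.q-nil L

  geomInv-inverse : ∀ a → (1# - q ^ suc a) * embed (geomInv (suc a)) ≈ 1#
  geomInv-inverse a n n<L = ℤ/4.trans
    (solve 2 (λ x g → (:1 :- x) :* g := g :- x :* g) refl (q ^ suc a) g n n<L)
    (ℤ/4.trans (ℤ/4.+-congˡ {g n} (ℤ/4.-‿cong {((q ^ suc a) ⋆ g) n} (*-congʳ {g} (PS.q-power L (suc a)) n n<L))) at)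
    where
    g : ℕ → ℤ
    g = embed (geomInv (suc a))
    at : g n ℤ.- ((q^ suc a) ⋆ g) n ℤ/4.≈ 𝟙 n
    at with ℕP.<-≤-connex n (suc a)
    ... | inj₁ n≤a = ℤ/4.trans (ℤ/4.+-cong (ℤ/4.reflexive (geomInv-< (suc a) n n≤a)) (ℤ/4.-‿cong (PS.q^⋆-< (suc a) g n n≤a)))
                       (ℤ/4.reflexive (ℤP.+-identityʳ _))
    ... | inj₂ a<n with ℕP.m≤n⇒∃[o]m+o≡n a<n
    ...   | k , ≡.refl = ℤ/4.trans (ℤ/4.+-cong (ℤ/4.reflexive (≡.cong +_ (geomInv-+ (suc a) k))) (ℤ/4.-‿cong (PS.q^⋆-≥ (suc a) g k)))
                           (ℤ/4.reflexive (ℤP.+-inverseʳ (g k)))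

  a b : ℕ → Carrier
  a t = embed (geomInv (6 ℕ.* t ℕ.+ 1))
  b t = embed (geomInv (6 ℕ.* t ℕ.+ 5))

  a-inverse : ∀ t → (1# - q ^ (1 ℕ.+ t ℕ.* 6)) * a t ≈ 1#
  a-inverse t = ≡.subst (λ e → (1# - q ^ (1 ℕ.+ t ℕ.* 6)) * embed (geomInv e) ≈ 1#) (exponent t) (geomInv-inverse (t ℕ.* 6))
    where
    exponent : ∀ t → 1 ℕ.+ t ℕ.* 6 ≡ 6 ℕ.* t ℕ.+ 1
    exponent = solve-∀

  b-inverse : ∀ t → (1# - q ^ (5 ℕ.+ t ℕ.* 6)) * b t ≈ 1#
  b-inverse t = ≡.subst (λ e → (1# - q ^ (5 ℕ.+ t ℕ.* 6)) * embed (geomInv e) ≈ 1#) (exponent t) (geomInv-inverse (4 ℕ.+ t ℕ.* 6))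
    where
    exponent : ∀ t → 5 ℕ.+ t ℕ.* 6 ≡ 6 ℕ.* t ℕ.+ 5
    exponent = solve-∀

  embed-pochInv : ∀ n → embed (pochInv n) ≈ prod n (λ t → a t * b t)
  embed-pochInv zero    n n<L = ℤ/4.reflexive (embed-one n)
  embed-pochInv (suc n) = trans (λ k _ → ℤ/4.reflexive (embed-⊛ (pochInv n) _ k))
    (*-cong (embed-pochInv n) (λ k _ → ℤ/4.reflexive (embed-⊛ (geomInv (6 ℕ.* n ℕ.+ 1)) (geomInv (6 ℕ.* n ℕ.+ 5)) k)))

  embed-xiTerm : ∀ M → embed (xiTerm (suc M)) ≈ q * (q ^ (6 ℕ.* (M ℕ.* suc M)) * prod (suc M) (λ t → a t * b t))
  embed-xiTerm M = trans (λ k _ → embed-shift (6 ℕ.* suc M ℕ.* suc M ℕ.∸ 6 ℕ.* suc M ℕ.+ 1) (pochInv (suc M)) k)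
    (trans (*-congʳ (trans (λ k _ → ℤ/4.reflexive (≡.cong (λ e → (q^ e) k) (xiExponent M)))
                           (sym (PS.q-power L (suc (6 ℕ.* (M ℕ.* suc M)))))))
      (trans (*-congˡ (embed-pochInv (suc M))) (*-assoc _ _ _)))

  xiSum-Λ : ∀ N → N ℕ.< L → xiSum N ℤ/4.≈ (q * (Φ⁻¹ (- 1#) q 6 6 * Λ 9 n₀ q)) N
  xiSum-Λ N N<L = ℤ/4.trans (ℤ/4.reflexive (embed-sumTo N (λ i → xiTerm (suc i) N)))
    -- The defining sum is lengthened from N + 1 to n₀ + 1 terms; the added ones begin beyond q^N.
    (ℤ/4.trans (∑-extend _ (ℕP.≤-trans N<L (ℕP.≤-trans (ℕP.m≤m+n L L) (ℕP.≤-trans 2L≤n₀ (ℕP.n≤1+n n₀)))) vanish)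
    (ℤ/4.trans (ℤ/4.sym (PS.sum-at L (suc n₀) (λ i → embed (xiTerm (suc i))) N))
      (series N N<L)))
    where
    series : sum (suc n₀) (λ i → embed (xiTerm (suc i))) ≈ q * (Φ⁻¹ (- 1#) q 6 6 * Λ 9 n₀ q)
    series = trans (sum-cong (suc n₀) embed-xiTerm) (trans (sym (sum-*ˡ (suc n₀) q _))
      (*-congˡ (BaseSix.appell-lerch-six q-nil a b a-inverse b-inverse n₀ 2L≤n₀)))
    vanish : ∀ i → suc N ℕ.≤ i → + xiTerm (suc i) N ℤ/4.≈ + 0
    vanish i N<i = ℤ/4.trans (embed-shift e (pochInv (suc i)) N) (PS.q^⋆-< e _ N
      (≡.subst (N ℕ.<_) (≡.sym (xiExponent i)) (s≤s (ℕP.≤-trans (ℕP.≤-trans (ℕP.n≤1+n N) N<i)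
        (ℕP.≤-trans (ℕP.m≤m*n i (suc i)) (ℕP.m≤n*m (i ℕ.* suc i) 6))))))
      where
      e : ℕ
      e = 6 ℕ.* suc i ℕ.* suc i ℕ.∸ 6 ℕ.* suc i ℕ.+ 1

  section-coefficient : ∀ m-1 {x} (f : ℕ → Carrier) r k → r ℕ.< suc m-1 →
    x ≈ sum (suc m-1) (λ s → q ^ s * PS.dilate m-1 (f s)) → r ℕ.+ k ℕ.* suc m-1 ℕ.< L →
    x (r ℕ.+ k ℕ.* suc m-1) ℤ/4.≈ f r k
  section-coefficient m-1 {x} f r k r<m h i<L = ℤ/4.trans (h i i<L)
    (ℤ/4.trans (PS.sum-at L (suc m-1) _ i)
    (ℤ/4.trans (∑-cong (suc m-1) (λ s → *-congʳ {PS.dilate m-1 (f s)} (PS.q-power L s) i i<L))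
    (ℤ/4.trans (PS.∑-single (suc m-1) (λ s → ((q^ s) ⋆ PS.dilate m-1 (f s)) i) r r<m
      (λ s s<m s≢r → PS.section-≢ m-1 (f s) s r k s<m r<m s≢r))
      (PS.section-≡ m-1 (f r) r k r<m))))
    where
    i : ℕ
    i = r ℕ.+ k ℕ.* suc m-1

  private
    -- The argument of `dilate` is one less than the exponent: `dilate 2` is q ↦ q³ and `dilate 3`
    -- is q ↦ q⁴.
    module M₃ = SectionsModThree (PS.dilate 2) (PS.dilate-isRingHomomorphism L 2) q q-nil (PS.dilate-q-power L 2)
    module M₄ = SectionsModFour (PS.dilate 3) (PS.dilate-isRingHomomorphism L 3) q q-nil (PS.dilate-q-power L 3)

  Uθ : Carrier
  Uθ = U (q ^ 2) n₀ * θ⁺ (suc n₀) q 1 5 6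

  xiSum-Uθ : ∀ k → 1 ℕ.+ k ℕ.* 3 ℕ.< L → xiSum (1 ℕ.+ k ℕ.* 3) ℤ/4.≈ Uθ k
  xiSum-Uθ k 1+3k<L = let f , sections , f₁ = M₃.Λ-sections n₀ in ℤ/4.trans (xiSum-Λ (1 ℕ.+ k ℕ.* 3) 1+3k<L) (ℤ/4.trans
    (section-coefficient 2 f 1 k (s≤s (s≤s z≤n)) sections 1+3k<L)
    (ℤ/4.trans (ℤ/4.reflexive (≡.cong (λ g → g k) f₁)) (lambert-theta q-nil n₀ 2L≤n₀ k k<L)))
    where
    k<L : k ℕ.< L
    k<L = ℕP.≤-<-trans (ℕP.≤-trans (ℕP.m≤m*n k 3) (ℕP.n≤1+n _)) 1+3k<L

  Uθ-0 : ∀ k → k ℕ.* 4 ℕ.< L → Uθ (k ℕ.* 4) ℤ/4.≈ θ⁻ (suc n₀) q 2 4 6 k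
  Uθ-0 k 4k<L = let f , sections , f₀ , f₁ = M₄.Uθ-sections n₀ 2L≤n₀ in ℤ/4.trans (section-coefficient 3 f 0 k (s≤s z≤n) sections 4k<L)
    (f₀ k (ℕP.≤-<-trans (ℕP.m≤m*n k 4) 4k<L))

  Uθ-1 : ∀ k → 1 ℕ.+ k ℕ.* 4 ℕ.< L → Uθ (1 ℕ.+ k ℕ.* 4) ℤ/4.≈ Uθ k
  Uθ-1 k 1+4k<L = let f , sections , f₀ , f₁ = M₄.Uθ-sections n₀ 2L≤n₀ in ℤ/4.trans (section-coefficient 3 f 1 k (s≤s (s≤s z≤n)) sections 1+4k<L)
    (ℤ/4.reflexive (≡.cong (λ g → g k) f₁))

  tri-doubleℤ : ∀ k → + tri k ℤ.* + 2 ℤ.+ + k ≡ + k ℤ.* + k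
  tri-doubleℤ k = ≡.trans (≡.cong (ℤ._+ + k) (≡.sym (ℤP.pos-* (tri k) 2))) (≡.trans (≡.cong +_ (tri-double k)) (ℤP.pos-* k k))

  pentagonal-pos : ∀ k → + expo 2 6 k ≡ pentagonal (+ k)
  pentagonal-pos k = ≡.trans (≡.cong₂ ℤ._+_ (ℤP.pos-* k 2) (ℤP.pos-* (tri k) 6))
    (≡.trans (rearrange (+ k) (+ tri k)) (≡.trans (≡.cong (λ s → + 3 ℤ.* s ℤ.- + k) (tri-doubleℤ k)) (factor (+ k))))
    where
    rearrange : ∀ x t → x ℤ.* + 2 ℤ.+ t ℤ.* + 6 ≡ + 3 ℤ.* (t ℤ.* + 2 ℤ.+ x) ℤ.- x
    rearrange = ℤSolver.solve-∀
    factor : ∀ x → + 3 ℤ.* (x ℤ.* x) ℤ.- x ≡ x ℤ.* (+ 3 ℤ.* x ℤ.- + 1)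
    factor = ℤSolver.solve-∀

  pentagonal-neg : ∀ k → + expo 4 6 k ≡ pentagonal (ℤ.- + k)
  pentagonal-neg k = ≡.trans (≡.cong₂ ℤ._+_ (ℤP.pos-* k 4) (ℤP.pos-* (tri k) 6))
    (≡.trans (rearrange (+ k) (+ tri k)) (≡.trans (≡.cong (λ s → + 3 ℤ.* s ℤ.+ + k) (tri-doubleℤ k)) (factor (+ k))))
    where
    rearrange : ∀ x t → x ℤ.* + 4 ℤ.+ t ℤ.* + 6 ≡ + 3 ℤ.* (t ℤ.* + 2 ℤ.+ x) ℤ.+ x
    rearrange = ℤSolver.solve-∀
    factor : ∀ x → + 3 ℤ.* (x ℤ.* x) ℤ.+ x ≡ (ℤ.- x) ℤ.* (+ 3 ℤ.* (ℤ.- x) ℤ.- + 1)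
    factor = ℤSolver.solve-∀

  sign-power : ∀ k f n → n ℕ.< L → ((- 1#) ^ k * f) n ℤ/4.≈ (ℤ.- + 1) ℤ.^ k ℤ.* f n
  sign-power zero    f n n<L = ℤ/4.trans (*-identityˡ f n n<L) (ℤ/4.sym (ℤ/4.*-identityˡ (f n)))
  sign-power (suc k) f n n<L = ℤ/4.trans
    (solve 2 (λ s f → (:- :1 :* s) :* f := :- (s :* f)) refl ((- 1#) ^ k) f n n<L)
    (ℤ/4.trans (ℤ/4.-‿cong (sign-power k f n n<L)) (ℤ/4.reflexive (identity ((ℤ.- + 1) ℤ.^ k) (f n))))
    where
    identity : ∀ s x → ℤ.- (s ℤ.* x) ≡ ((ℤ.- + 1) ℤ.* s) ℤ.* x
    identity = ℤSolver.solve-∀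

  -- The coefficient of q^v in (-1)^k q^{expo a 6 k}.
  θ-term : ℕ → ℕ → ℕ → ℤ
  θ-term a v k = (ℤ.- + 1) ℤ.^ k ℤ.* (q^ expo a 6 k) v

  θ⁻-at : ∀ v → v ℕ.< L → θ⁻ (suc n₀) q 2 4 6 v ℤ/4.≈ ∑ (suc n₀) (λ k → θ-term 2 v (suc k)) ℤ.+ ∑ (suc n₀) (θ-term 4 v)
  θ⁻-at v v<L = ℤ/4.+-cong
    (ℤ/4.trans (PS.sum-at L (suc n₀) (λ k → (- 1#) ^ suc k * q ^ expo 2 6 (suc k)) v) (∑-cong (suc n₀) (λ k → term 2 (suc k))))
    (ℤ/4.trans (PS.sum-at L (suc n₀) (λ k → (- 1#) ^ k * q ^ expo 4 6 k) v) (∑-cong (suc n₀) (term 4)))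
    where
    term : ∀ a k → ((- 1#) ^ k * q ^ expo a 6 k) v ℤ/4.≈ θ-term a v k
    term a k = ℤ/4.trans (sign-power k (q ^ expo a 6 k) v v<L) (ℤ/4.*-congˡ {(ℤ.- + 1) ℤ.^ k} (PS.q-power L (expo a 6 k) v v<L))

  θ-term-≢ : ∀ a v k → expo a 6 k ≢ v → θ-term a v k ℤ/4.≈ + 0
  θ-term-≢ a v k e≢v = ℤ/4.trans (ℤ/4.*-congˡ {(ℤ.- + 1) ℤ.^ k} (PS.q^-≢ (expo a 6 k) v e≢v)) (ℤ/4.zeroʳ ((ℤ.- + 1) ℤ.^ k))

  θ-term-≡ : ∀ a v k → expo a 6 k ≡ v → θ-term a v k ℤ/4.≈ (ℤ.- + 1) ℤ.^ k
  θ-term-≡ a v k ≡.refl = ℤ/4.trans (ℤ/4.*-congˡ {(ℤ.- + 1) ℤ.^ k} (PS.q^-≡ (expo a 6 k))) (ℤ/4.*-identityʳ ((ℤ.- + 1) ℤ.^ k))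

  in-range : ∀ a {k v} → expo (suc a) 6 k ≡ v → v ℕ.< L → k ℕ.< suc n₀
  in-range a {k} ≡.refl v<L = s≤s (ℕP.≤-trans (ℕP.≤-trans (ℕP.m≤m*n k (suc a)) (ℕP.m≤m+n _ (tri k ℕ.* 6)))
    (ℕP.≤-trans (ℕP.<⇒≤ v<L) (ℕP.≤-trans (ℕP.m≤m+n L L) 2L≤n₀)))

  -- The second half of `θ⁻` runs over the indices -j ≤ 0, zero included. Injectivity of
  -- `pentagonal` excludes its other terms and, as their indices are positive, all terms of the
  -- first half.
  negative-case : ∀ j v → + v ≡ pentagonal (ℤ.- + j) → v ℕ.< L → θ⁻ (suc n₀) q 2 4 6 v ℤ/4.≈ (ℤ.- + 1) ℤ.^ j
  negative-case j v v≡ v<L = ℤ/4.trans (θ⁻-at v v<L) (ℤ/4.trans (ℤ/4.+-cong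
    (PS.∑-zero (suc n₀) (λ i _ → θ-term-≢ 2 v (suc i) (λ e≡v → positive≢ j {i} (pentagonal-injective
      (≡.trans (≡.sym (pentagonal-pos (suc i))) (≡.trans (≡.cong +_ e≡v) v≡))))))
    (ℤ/4.trans (PS.∑-single (suc n₀) (θ-term 4 v) j (in-range 3 e≡v v<L)
      (λ i _ i≢j → θ-term-≢ 4 v i (λ e≡v → i≢j (ℤP.+-injective (ℤP.neg-injective (pentagonal-injective
        (≡.trans (≡.sym (pentagonal-neg i)) (≡.trans (≡.cong +_ e≡v) v≡))))))))
      (θ-term-≡ 4 v j e≡v)))
    (ℤ/4.+-identityˡ _))
    where
    e≡v : expo 4 6 j ≡ v
    e≡v = ℤP.+-injective (≡.trans (pentagonal-neg j) (≡.sym v≡))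
    positive≢ : ∀ j {i} → + suc i ≢ ℤ.- + j
    positive≢ zero    ()
    positive≢ (suc j) ()

  pentagonal-coefficient : ∀ {v c} → PentagonalCoefficient v c → v ℕ.< L → θ⁻ (suc n₀) q 2 4 6 v ℤ/4.≈ c
  pentagonal-coefficient {v} (at-pentagonal (+ zero) v≡)   v<L = negative-case 0 v v≡ v<L
  pentagonal-coefficient {v} (at-pentagonal -[1+ i ] v≡)   v<L = negative-case (suc i) v v≡ v<L
  pentagonal-coefficient {v} (at-pentagonal (+ suc j) v≡)  v<L = ℤ/4.trans (θ⁻-at v v<L) (ℤ/4.trans (ℤ/4.+-cong
    (ℤ/4.trans (PS.∑-single (suc n₀) (λ k → θ-term 2 v (suc k)) j (ℕP.<-trans (ℕP.n<1+n j) (in-range 1 e≡v v<L))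
      (λ i _ i≢j → θ-term-≢ 2 v (suc i) (λ e≡v → i≢j (ℕP.suc-injective (ℤP.+-injective (pentagonal-injective
        (≡.trans (≡.sym (pentagonal-pos (suc i))) (≡.trans (≡.cong +_ e≡v) v≡))))))))
      (θ-term-≡ 2 v (suc j) e≡v))
    (PS.∑-zero (suc n₀) (λ i _ → θ-term-≢ 4 v i (λ e≡v → positive≢ i (pentagonal-injective
      (≡.trans (≡.sym v≡) (≡.trans (≡.cong +_ (≡.sym e≡v)) (pentagonal-neg i))))))))
    (ℤ/4.+-identityʳ _))
    where
    e≡v : expo 2 6 (suc j) ≡ v
    e≡v = ℤP.+-injective (≡.trans (pentagonal-pos (suc j)) (≡.sym v≡))
    positive≢ : ∀ i → + suc j ≢ ℤ.- + i
    positive≢ zero    ()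
    positive≢ (suc i) ()
  pentagonal-coefficient {v} (otherwise ∄k) v<L = ℤ/4.trans (θ⁻-at v v<L) (ℤ/4.trans (ℤ/4.+-cong
    (PS.∑-zero (suc n₀) (λ i _ → θ-term-≢ 2 v (suc i) (λ e≡v → ∄k (+ suc i , ≡.trans (≡.cong +_ (≡.sym e≡v)) (pentagonal-pos (suc i))))))
    (PS.∑-zero (suc n₀) (λ i _ → θ-term-≢ 4 v i (λ e≡v → ∄k (ℤ.- + i , ≡.trans (≡.cong +_ (≡.sym e≡v)) (pentagonal-neg i))))))
    (ℤ/4.+-identityˡ _))

-- The two congruences modulo 8

eight-divides : ∀ m c → xiSum (suc m) ℤ/4.≈ c → + 8 ℤUnsigned.∣ (+ pξ (suc m) ℤ.- + 2 ℤ.* c)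
eight-divides m c h = ℤDiv.∣⇒∣ᵤ (≡.subst (+ 8 ℤDiv.∣_)
  (≡.trans (distribute (xiSum (suc m)) c) (≡.cong (ℤ._- + 2 ℤ.* c) (≡.sym (pξ-xiSum m))))
  (ℤDiv.*-monoʳ-∣ (+ 2) (IntegersModulo.divides-difference h)))
  where
  distribute : ∀ x c → + 2 ℤ.* (x ℤ.- c) ≡ + 2 ℤ.* x ℤ.- + 2 ℤ.* c
  distribute = ℤSolver.solve-∀

pξ-12n+1 : ∀ n {c} → PentagonalCoefficient n c → + 8 ℤUnsigned.∣ (+ pξ (12 ℕ.* n ℕ.+ 1) ℤ.- + 2 ℤ.* c)
pξ-12n+1 n {c} h = ≡.subst (λ N → + 8 ℤUnsigned.∣ (+ pξ N ℤ.- + 2 ℤ.* c)) (index n)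
  (eight-divides (n ℕ.* 4 ℕ.* 3) c (ℤ/4.trans (xiSum-Uθ (n ℕ.* 4) ℕP.≤-refl)
    (ℤ/4.trans (Uθ-0 n 4n<L) (pentagonal-coefficient h (ℕP.≤-<-trans (ℕP.m≤m*n n 4) 4n<L)))))
  where
  L : ℕ
  -- One above the index 12n + 1 = 3(4n) + 1, which is read as section 1 modulo 3 and then section 0
  -- modulo 4.
  L = suc (1 ℕ.+ n ℕ.* 4 ℕ.* 3)
  open XiModFour L (L ℕ.+ L) ℕP.≤-refl
  4n<L : n ℕ.* 4 ℕ.< L
  4n<L = s≤s (ℕP.≤-trans (ℕP.m≤m*n (n ℕ.* 4) 3) (ℕP.n≤1+n _))
  index : ∀ n → 1 ℕ.+ n ℕ.* 4 ℕ.* 3 ≡ 12 ℕ.* n ℕ.+ 1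
  index = solve-∀

-- 48n + 4 = 3(4(4n) + 1) + 1: after section 1 modulo 3, section 1 modulo 4 returns the same series
-- at 4n, the place to which 12n + 1 leads directly.
pξ-48n+4 : ∀ n {c} → PentagonalCoefficient n c → + 8 ℤUnsigned.∣ (+ pξ (48 ℕ.* n ℕ.+ 4) ℤ.- + 2 ℤ.* c)
pξ-48n+4 n {c} h = ≡.subst (λ N → + 8 ℤUnsigned.∣ (+ pξ N ℤ.- + 2 ℤ.* c)) (index n)
  (eight-divides (M ℕ.* 3) c (ℤ/4.trans (xiSum-Uθ M ℕP.≤-refl) (ℤ/4.trans (Uθ-1 (n ℕ.* 4) M<L)
    (ℤ/4.trans (Uθ-0 n 4n<L) (pentagonal-coefficient h (ℕP.≤-<-trans (ℕP.m≤m*n n 4) 4n<L))))))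
  where
  M L : ℕ
  M = 1 ℕ.+ n ℕ.* 4 ℕ.* 4
  L = suc (1 ℕ.+ M ℕ.* 3)
  open XiModFour L (L ℕ.+ L) ℕP.≤-refl
  M<L : M ℕ.< L
  M<L = s≤s (ℕP.≤-trans (ℕP.m≤m*n M 3) (ℕP.n≤1+n _))
  4n<L : n ℕ.* 4 ℕ.< L
  4n<L = ℕP.≤-<-trans (ℕP.≤-trans (ℕP.m≤m*n (n ℕ.* 4) 4) (ℕP.n≤1+n _)) M<L
  index : ∀ n → 1 ℕ.+ (1 ℕ.+ n ℕ.* 4 ℕ.* 4) ℕ.* 3 ≡ 48 ℕ.* n ℕ.+ 4
  index = solve-∀

open import Data.Nat using (ℕ; _+_; _*_)
open import Data.Integer using (ℤ; +_; -_; _-_; _^_; ∣_∣) renaming (_*_ to _*ℤ_)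
open import Data.Integer.Divisibility using (_∣_)
open import Data.Product using (_×_; ∃)
open import Relation.Nullary using (¬_)
open import Relation.Binary.PropositionalEquality using (_≡_)

theorem4p10 : (n : ℕ) →
    ((k : ℤ) → + n ≡ k *ℤ (+ 3 *ℤ k - + 1) →
    (+ 8 ∣ (+ pξ (48 * n + 4) - + 2 *ℤ (- + 1) ^ ∣ k ∣))
    × (+ 8 ∣ (+ pξ (12 * n + 1) - + 2 *ℤ (- + 1) ^ ∣ k ∣)))
    × (¬ (∃ λ (k : ℤ) → + n ≡ k *ℤ (+ 3 *ℤ k - + 1)) →
    (+ 8 ∣ + pξ (48 * n + 4)) × (+ 8 ∣ + pξ (12 * n + 1)))
theorem4p10 n = hit , miss
  where
  hit : (k : ℤ) → + n ≡ k *ℤ (+ 3 *ℤ k - + 1) →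
    (+ 8 ∣ (+ pξ (48 * n + 4) - + 2 *ℤ (- + 1) ^ ∣ k ∣))
    × (+ 8 ∣ (+ pξ (12 * n + 1) - + 2 *ℤ (- + 1) ^ ∣ k ∣))
  hit k n≡ = pξ-48n+4 n (at-pentagonal k n≡) , pξ-12n+1 n (at-pentagonal k n≡)
  -- In the second case c is `+ 0`, and its double computes to `+ 0`.
  drop-zero : ∀ i → + 8 ∣ (i - + 0) → + 8 ∣ i
  drop-zero i = ≡.subst (+ 8 ∣_) (ℤP.+-identityʳ i)
  miss : ¬ (∃ λ (k : ℤ) → + n ≡ k *ℤ (+ 3 *ℤ k - + 1)) →
    (+ 8 ∣ + pξ (48 * n + 4)) × (+ 8 ∣ + pξ (12 * n + 1))
  miss ∄k = drop-zero (+ pξ (48 * n + 4)) (pξ-48n+4 n (otherwise ∄k)) , drop-zero (+ pξ (12 * n + 1)) (pξ-12n+1 n (otherwise ∄k))
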